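{- Neither $L_{10}$ nor $L_{11}$ is a union of congruence classes modulo $N$ for any positive integer $N$.
   Context: Let $\omega=\zeta_7$ be a primitive 7th root of unity, $K=\mathbb Q(\omega)$, $R=\mathbb Z[\omega]$, $\pi=1-\omega$. Put $A=R/7R\cong\mathbb F_7[\pi]/(\pi^6)$ and, in $A$, $\Lambda=\log\omega=-\sum_{j=1}^5\pi^j/j$; then $A=\mathbb F_7[\Lambda]/(\Lambda^6)$. For $z\in A^\times$ with constant residue $a=z\bmod\pi\in\mathbb F_7^\times$ write $\log(z/a)=\sum_{j=1}^5c_j(z)\Lambda^j$, where $\log(1+X)=\sum_{j=1}^5(-1)^{j+1}X^j/j$ for $X\in\pi A$, and define $\mathrm d(z)=4c_3(z)$, $\mathrm e(z)=c_5(z)$, both in $\mathbb F_7$. The field $K$ has class number one, so every ideal $\mathfrak a$ of $R$ coprime to $7$ has a generator; $\mathrm d(\mathfrak a)$ and $\mathrm e(\mathfrak a)$ denote the values at any generator (they are independent of the generator). For a rational prime $\ell\ne7$, $f_\ell=\operatorname{ord}_7(\ell)$ is the multiplicative order of $\ell$ modulo $7$. Choose a prime ideal $\mathfrak q\mid\ell$ of $R$. $\delta(\ell)\in\{0,1,2,3\}$ is the unique representative of the pair $\{\pm\mathrm d(\mathfrak q)\}\subset\mathbb F_7$, and $\ell$ is called invisible if $(\mathrm d(\mathfrak q),\mathrm e(\mathfrak q))=(0,0)$; both are independent of the choice of $\mathfrak q$. A prime divisor $\ell$ of $m=\pm\prod_{\ell\neq7}\ell^{a_\ell}$ is called usable if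 $a_\ell\ge f_\ell$. $L_{10}$ is the set of nonzero integers $m=\pm\prod_{\ell\ne7}\ell^{a_\ell}$ coprime to $7$ for which there exist integers $j_\ell$ with $|j_\ell|\le\lfloor a_\ell/f_\ell\rfloor$ and $\sum_\ell j_\ell\delta(\ell)\equiv\pm1\pmod7$. $L_{11}$ is the set of nonzero integers $m$ coprime to $7$ having a usable prime divisor that is not invisible. (These are the sets of cofactors $m$ coprime to $7$ for which $7^{10}m$, respectively $7^{11}m$, is an integer group determinant of $C_7\times C_7$.) -}

module Defs where

open import Data.Integer as ℤ using (ℤ; +_; -[1+_]; ∣_∣)
open import Data.Integer.Coprimality using (Coprime)
open import Data.Integer.Divisibility using (_∣_)
open import Data.List as List using (List; deduplicate; filter; length; takeWhile)
open import Data.List.Membership.Propositional using () renaming (_∈_ to _∈ˡ_)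
open import Data.Nat as ℕ using (ℕ; suc; _≤_)
open import Data.Nat.Primality using (Prime)
open import Data.Nat.Primality.Factorisation using (factorise; factors)
open import Data.Product using (Σ-syntax; ∃-syntax; _×_)
open import Data.Sum using (_⊎_)
open import Data.Vec using (Vec; []; _∷_; foldr′; map; replicate; zipWith)
open import Function.Bundles using (_⇔_)
open import Level using (0ℓ) renaming (suc to lsuc)
open import Relation.Binary.PropositionalEquality using (_≡_)
open import Relation.Nullary using (¬_; ¬?)
open import Relation.Unary using (Pred; _∈_; _∉_; _≐_)

infix 4 _≡_[mod_]

_≡_[mod_] : ℤ → ℤ → ℕ → Set
x ≡ y [mod n ] = + n ∣ x ℤ.- y

IsUnionOfClasses : ∀ {a} → ℕ → Pred ℤ a → Set (lsuc a)
IsUnionOfClasses {a} N L =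
  Σ[ S ∈ Pred ℤ a ] (∀ m → m ∈ L ⇔ (∃[ r ] r ∈ S × m ≡ r [mod N ]))

-- The ring R = ℤ[ω], ω a primitive 7th root of unity.  The vector
-- (a₀ , … , a₅) stands for a₀ + a₁ω + … + a₅ω⁵; as 1, ω, …, ω⁵ is a ℤ-basis,
-- propositional equality of vectors is equality in R.

R : Set
R = Vec ℤ 6

infixl 6 _+_ _-_
infixl 7 _*_

_+_ _-_ : R → R → R
_+_ = zipWith ℤ._+_
_-_ = zipWith ℤ._-_

-- Multiplication by ω, using ω⁶ = -(1 + ω + … + ω⁵).
ω· : R → R
ω· (a₀ ∷ a₁ ∷ a₂ ∷ a₃ ∷ a₄ ∷ a₅ ∷ []) =
  (ℤ.- a₅) ∷ (a₀ ℤ.- a₅) ∷ (a₁ ℤ.- a₅) ∷ (a₂ ℤ.- a₅) ∷ (a₃ ℤ.- a₅) ∷ (a₄ ℤ.- a₅) ∷ []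

-- Horner's rule: (Σ aᵢωⁱ) y = a₀y + ω(a₁y + ω(a₂y + …)).  Opaque only because
-- the type checker would otherwise expand symbolic products in the types below.
opaque
  _*_ : R → R → R
  x * y = foldr′ (λ a acc → map (a ℤ.*_) y + ω· acc) (replicate 6 (+ 0)) x

ι : ℤ → R
ι k = k ∷ replicate 5 (+ 0)

ω π : R
ω = ω· (ι (+ 1))
π = ι (+ 1) - ω

⟨_⟩ : R → Pred R 0ℓ
⟨ g ⟩ x = ∃[ y ] x ≡ g * y

record IsPrimeIdeal (𝔮 : Pred R 0ℓ) : Set where
  field
    0∈     : ι (+ 0) ∈ 𝔮
    +-clos : ∀ {x y} → x ∈ 𝔮 → y ∈ 𝔮 → x + y ∈ 𝔮
    *-clos : ∀ x {y} → y ∈ 𝔮 → x * y ∈ 𝔮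
    proper : ι (+ 1) ∉ 𝔮
    prime  : ∀ x y → x * y ∈ 𝔮 → x ∈ 𝔮 ⊎ y ∈ 𝔮

infix 4 _≈_

-- Equality in A = R/7R, whose elements are represented by elements of R.
_≈_ : R → R → Set
x ≈ y = x - y ∈ ⟨ ι (+ 7) ⟩

-- evalPoly (c₁ , … , cₙ) X = c₁X + … + cₙXⁿ.
evalPoly : ∀ {n} → Vec ℤ n → R → R
evalPoly c X = foldr′ (λ cⱼ acc → X * (ι cⱼ + acc)) (ι (+ 0)) c

-- log (1 + X) = Σ_{j=1}^5 (-1)^{j+1} Xʲ / j for X ∈ πA; modulo 7 the inverses
-- of 1, 2, 3, 4, 5 are 1, 4, 5, 2, 3.
log1+ : R → R
log1+ = evalPoly (+ 1 ∷ ℤ.- + 4 ∷ + 5 ∷ ℤ.- + 2 ∷ + 3 ∷ [])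

-- Λ = log ω, where ω = 1 + (ω - 1) = 1 - π.
Λ : R
Λ = log1+ (ω - ι (+ 1))

-- The coordinates c₁, …, c₅ ∈ 𝔽₇ of log (z / a) in powers of Λ, for z a unit
-- of A with residue a modulo π.  Elements of 𝔽₇ are represented by integers,
-- so the coordinates of a given z are unique only modulo 7; a⁻¹ is an inverse
-- of a modulo 7, and so witnesses that z is a unit of A.
record LogCoords (z : R) : Set where
  field
    a a⁻¹     : ℤ
    residue   : z - ι a ∈ ⟨ π ⟩
    inverse   : a ℤ.* a⁻¹ ≡ + 1 [mod 7 ]
    c₁ c₂ c₃ c₄ c₅ : ℤ
    expansion : log1+ (ι a⁻¹ * z - ι (+ 1)) ≈ evalPoly (c₁ ∷ c₂ ∷ c₃ ∷ c₄ ∷ c₅ ∷ []) Λ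

d e : ∀ {z} → LogCoords z → ℤ
d v = + 4 ℤ.* LogCoords.c₃ v
e v = LogCoords.c₅ v

-- The multiplicative order of ℓ modulo 7, for ℓ coprime to 7: it is at most 6,
-- and one more than the number of initial k = 1, 2, … with ℓᵏ ≢ 1.
ord₇ : ℕ → ℕ
ord₇ ℓ = suc (length (takeWhile (λ k → ¬? ((ℓ ℕ.^ k) ℕ.% 7 ℕ.≟ 1))
                                (1 List.∷ 2 List.∷ 3 List.∷ 4 List.∷ 5 List.∷ List.[])))

record _LiesOver_ (𝔮 : Pred R 0ℓ) (ℓ : ℕ) : Set where
  field
    isPrimeIdeal : IsPrimeIdeal 𝔮
    ℓ∈𝔮          : ι (+ ℓ) ∈ 𝔮

-- The values d(𝔮), e(𝔮) are those at a generator g of 𝔮.  They do not depend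
-- on g, nor do the two notions below depend on 𝔮; hence "for some 𝔮 and g"
-- (used for δ) and "for all 𝔮 and g" (used for invisibility) agree.

Isδ : ℕ → ℕ → Set₁
Isδ ℓ n = n ≤ 3 ×
  (∃[ 𝔮 ] 𝔮 LiesOver ℓ × (∃[ g ] 𝔮 ≐ ⟨ g ⟩ ×
    (Σ[ v ∈ LogCoords g ] (+ n ≡ d v [mod 7 ] ⊎ + n ≡ ℤ.- d v [mod 7 ]))))

Invisible : ℕ → Set₁
Invisible ℓ = ∀ 𝔮 → 𝔮 LiesOver ℓ → ∀ g → 𝔮 ≐ ⟨ g ⟩ → (v : LogCoords g) →
  d v ≡ + 0 [mod 7 ] × e v ≡ + 0 [mod 7 ]

primeFactors : (m : ℤ) → .{{ℤ.NonZero m}} → List ℕ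
primeFactors m = factors (factorise ∣ m ∣)

primeDivisors : (m : ℤ) → .{{ℤ.NonZero m}} → List ℕ
primeDivisors m = deduplicate ℕ._≟_ (primeFactors m)

-- The exponent a_ℓ in m = ± ∏ ℓ^{a_ℓ}.
exponent : (m : ℤ) → .{{ℤ.NonZero m}} → ℕ → ℕ
exponent m ℓ = length (filter (ℓ ℕ.≟_) (primeFactors m))

sumOver : List ℕ → (ℕ → ℤ) → ℤ
sumOver ℓs f = List.foldr (λ ℓ s → f ℓ ℤ.+ s) (+ 0) ℓs

-- The sum over all ℓ ≠ 7 is taken over the prime divisors of m only: for every
-- other ℓ, a_ℓ = 0 forces j_ℓ = 0.
record L₁₀ (m : ℤ) : Set₁ where
  field
    {{nonZero}} : ℤ.NonZero m
    coprime : Coprime m (+ 7)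
    δ       : ℕ → ℕ
    isδ     : ∀ {ℓ} → ℓ ∈ˡ primeDivisors m → Isδ ℓ (δ ℓ)
    j       : ℕ → ℤ
    bound   : ∀ {ℓ} → ℓ ∈ˡ primeDivisors m → ∣ j ℓ ∣ ≤ exponent m ℓ ℕ./ ord₇ ℓ
    sum≡±1  : let s = sumOver (primeDivisors m) (λ ℓ → j ℓ ℤ.* + δ ℓ) in
              s ≡ + 1 [mod 7 ] ⊎ s ≡ ℤ.- + 1 [mod 7 ]

record L₁₁ (m : ℤ) : Set₁ where
  field
    {{nonZero}} : ℤ.NonZero m
    coprime    : Coprime m (+ 7)
    ℓ          : ℕ
    divisor    : ℓ ∈ˡ primeDivisors m
    usable     : ord₇ ℓ ≤ exponent m ℓ
    notInvisible : ¬ Invisible ℓ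

{-# OPTIONS --safe #-}

-- If L is a union of classes modulo N and 1 ∉ L, then no m ≡ 1 modulo N lies in
-- L.  So it is enough to find a prime ℓ ∤ 7N below a prime ideal ⟨ g ⟩ with
-- d(g) ≠ 0: a suitable power of ℓ is congruent to 1 and lies in both sets.
--
-- Write N as a power of 7 times a number M coprime to 7, and put
-- α = 1 + M √-7.  Up to units 4c₃ is the third cumulant of the moments Σ iᵏ aᵢ
-- of Σ aᵢ ωⁱ modulo 7, which is nonzero at α.  Cumulants are additive on
-- products and R is norm-Euclidean, so some prime g ∣ α has d(g) ≠ 0; a rational
-- prime ℓ ∣ N, ℓ ≠ 7, in ⟨ g ⟩ would divide M, giving 1 = α - M √-7 ∈ ⟨ g ⟩.
--
-- The Euclidean property is Lenstra's: with τ(z) the sum of z z̄ over the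
-- three complex places, every z ∈ ℚ(ω) has a translate by R with τ < 3, and
-- 27 Nm ≤ τ³ by AM-GM.
module Submission where

open import Defs
open import Algebra.Bundles using (CommutativeRing)
import Algebra.Solver.Ring
open import Algebra.Solver.Ring.AlmostCommutativeRing
open import Data.Empty using (⊥; ⊥-elim)
open import Data.Fin as Fin using (Fin; #_; zero; suc)
import Data.Fin.Properties as Finₚ
open import Data.Integer as ℤ using (ℤ; +_; -[1+_]; +≤+; +<+; ∣_∣)
import Data.Integer.DivMod as ℤDivMod
import Data.Integer.Divisibility.Signed as Signed
import Data.Integer.Properties as ℤₚ
import Data.Integer.Solver as ℤSolver
open import Data.List as List using (List; deduplicate; filter; length; takeWhile)
open import Data.List.Membership.Propositional using () renaming (_∈_ to _∈ˡ_)
import Data.List.Properties as Listₚ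
open import Data.List.Relation.Binary.Permutation.Propositional using (↭-sym; _↭_)
open import Data.List.Relation.Binary.Permutation.Propositional.Properties using (All-resp-↭; ↭-length)
open import Data.List.Relation.Unary.All as All using (All)
import Data.List.Relation.Unary.All.Properties as Allₚ
open import Data.List.Relation.Unary.Any using (here)
open import Data.Maybe using (Maybe; just; nothing)
open import Data.Nat as ℕ using (ℕ; z≤n; s≤s; suc; zero; NonZero)
open import Data.Nat.Coprimality using (coprime-divisor)
import Data.Nat.Divisibility as ℕDiv
import Data.Nat.DivMod as ℕDivMod
open import Data.Nat.GeneralisedArithmetic using (fold)
open import Data.Nat.ListAction using (product)
open import Data.Nat.Primality using (Prime; prime?; ¬prime[1]; euclidsLemma; prime⇒irreducible; prime⇒nonZero)
open import Data.Nat.Primality.Factorisation using (factorise; factorisationUnique; module PrimeFactorisation)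
import Data.Nat.Properties as ℕₚ
open import Data.Product using (_,_; _×_; ∃-syntax; Σ-syntax; proj₁; proj₂)
open import Data.Sum as Sum using (_⊎_; inj₁; inj₂; [_,_]′)
open import Data.Vec using (Vec; []; _∷_; map; head; foldr′; replicate; zipWith; lookup; _∷ʳ_)
import Data.Vec.Properties as Vecₚ
open import Function using (_∋_; _∘_; id)
open import Function.Bundles using (Equivalence)
open import Level using (0ℓ)
open import Relation.Binary.PropositionalEquality
open import Relation.Nullary using (Dec; yes; no; ¬_; contradiction; ¬?)
open import Relation.Nullary.Decidable using (True; toWitness; from-yes; from-no)
open import Relation.Unary using (Pred; Decidable; _∈_)

-- Why `α` is visible: modulo 7 the Gauss sum √-7 equals `Λ³`, and `Λ⁶ = 0` in `A`, so
-- `log α = M Λ³` and `d(α) = 4M`. Thus `M` has to satisfy two conditions only: it is prime to 7,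
-- and every prime other than 7 dividing `N` divides it.
--
-- The Euclidean property makes irreducible elements generate prime ideals, so that the prime found
-- comes with a generator at which `d` can be evaluated. AM-GM bounds the norm only from above. That
-- `Nm` vanishes at 0 alone has a different source, the prime `π` above 7: an element of norm 0 is
-- divisible by `π` with a quotient of norm 0 again, hence by every power of 7.
--
-- Both claims are negations, so the prime divisor of `α` is needed only under a double negation.
-- Irreducibility is then derived by contradiction, and no search for factors takes place.

module ℤ-Solver = ℤSolver.+-*-Solver

open ℤ-Solver using (Polynomial; ⟦_⟧; ⟦_⟧N; var; con; _:+_; _:*_; _:-_; :-_; normalise; correct)
  renaming (solve to ℤ-solve; _:=_ to _:≡_)

-- The commutative ring R

infixl 7 _•_
infix  8 −_  -- U+2212, as the hyphen is the subtraction of R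

_•_ : ℤ → R → R
k • x = map (k ℤ.*_) x

−_ : R → R
− x = map ℤ.-_ x

0R 1R : R
0R = ι (+ 0)
1R = ι (+ 1)

-- Vectors of integer polynomials mirror the operations of R, so that an
-- identity between coordinates is decided by comparing normal forms.
module Symbolic where

  Poly = Vec (Polynomial 6) 6

  generic : Poly
  generic = var (# 0) ∷ var (# 1) ∷ var (# 2) ∷ var (# 3) ∷ var (# 4) ∷ var (# 5) ∷ []

  ω·ₚ : Poly → Poly
  ω·ₚ (a₀ ∷ a₁ ∷ a₂ ∷ a₃ ∷ a₄ ∷ a₅ ∷ []) =
    :- a₅ ∷ (a₀ :+ :- a₅) ∷ (a₁ :+ :- a₅) ∷ (a₂ :+ :- a₅) ∷ (a₃ :+ :- a₅) ∷ (a₄ :+ :- a₅) ∷ []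

  ιₚ : ℤ → Poly
  ιₚ k = con k ∷ replicate 5 (con (+ 0))

  hornerₚ : (Poly → Poly) → ∀ {n} → Vec (Polynomial 6) n → Poly → Poly
  hornerₚ Ω x y = foldr′ (λ a acc → zipWith _:+_ (map (a :*_) y) (Ω acc)) (ιₚ (+ 0)) x

  scalar : ∀ (ρ : R) (p q : Polynomial 6) → normalise p ≡ normalise q → ⟦ p ⟧ ρ ≡ ⟦ q ⟧ ρ
  scalar ρ p q eq = trans (sym (correct p ρ)) (trans (cong (λ h → ⟦ h ⟧N ρ) eq) (correct q ρ))

  coordinatewise : ∀ {n} (ρ : R) (u v : Vec (Polynomial 6) n) → map normalise u ≡ map normalise v →
                   map (λ p → ⟦ p ⟧ ρ) u ≡ map (λ p → ⟦ p ⟧ ρ) v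
  coordinatewise ρ []      []      _  = refl
  coordinatewise ρ (p ∷ u) (q ∷ v) eq = cong₂ _∷_
    (scalar ρ p q (Vecₚ.∷-injectiveˡ eq)) (coordinatewise ρ u v (Vecₚ.∷-injectiveʳ eq))

open Symbolic using (generic; ω·ₚ; ιₚ; hornerₚ)

+-assoc : ∀ x y z → (x + y) + z ≡ x + (y + z)
+-assoc = Vecₚ.zipWith-assoc ℤₚ.+-assoc

+-comm : ∀ x y → x + y ≡ y + x
+-comm = Vecₚ.zipWith-comm ℤₚ.+-comm

+-identityˡ : ∀ x → 0R + x ≡ x
+-identityˡ = Vecₚ.zipWith-identityˡ ℤₚ.+-identityˡ

+-identityʳ : ∀ x → x + 0R ≡ x
+-identityʳ = Vecₚ.zipWith-identityʳ ℤₚ.+-identityʳ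

−-inverseˡ : ∀ x → − x + x ≡ 0R
−-inverseˡ = Vecₚ.zipWith-inverseˡ ℤₚ.+-inverseˡ

−-inverseʳ : ∀ x → x + − x ≡ 0R
−-inverseʳ = Vecₚ.zipWith-inverseʳ ℤₚ.+-inverseʳ

sub-def : ∀ x y → x - y ≡ x + − y
sub-def x y = zipmap x y
  where
  zipmap : ∀ {n} (u v : Vec ℤ n) → zipWith ℤ._-_ u v ≡ zipWith ℤ._+_ u (map ℤ.-_ v)
  zipmap []      []      = refl
  zipmap (_ ∷ u) (_ ∷ v) = cong (_ ∷_) (zipmap u v)

interchange : ∀ u v w z → (u + v) + (w + z) ≡ (u + w) + (v + z)
interchange u v w z = begin
  (u + v) + (w + z)   ≡⟨ +-assoc u v (w + z) ⟩
  u + (v + (w + z))   ≡⟨ cong (λ s → u + s) (+-assoc v w z) ⟨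
  u + ((v + w) + z)   ≡⟨ cong (λ s → u + (s + z)) (+-comm v w) ⟩
  u + ((w + v) + z)   ≡⟨ cong (λ s → u + s) (+-assoc w v z) ⟩
  u + (w + (v + z))   ≡⟨ +-assoc u w (v + z) ⟨
  (u + w) + (v + z)   ∎
  where open ≡-Reasoning

•-distribˡ : ∀ k x y → k • (x + y) ≡ k • x + k • y
•-distribˡ k x y = go x y
  where
  go : ∀ {n} (u v : Vec ℤ n) → map (k ℤ.*_) (zipWith ℤ._+_ u v) ≡ zipWith ℤ._+_ (map (k ℤ.*_) u) (map (k ℤ.*_) v)
  go []      []      = refl
  go (a ∷ u) (b ∷ v) = cong₂ _∷_ (ℤₚ.*-distribˡ-+ k a b) (go u v)

•-comm : ∀ k l x → k • (l • x) ≡ l • (k • x)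
•-comm k l x = begin
  k • (l • x)              ≡⟨ Vecₚ.map-∘ (k ℤ.*_) (l ℤ.*_) x ⟨
  map (λ a → k ℤ.* (l ℤ.* a)) x ≡⟨ Vecₚ.map-cong (λ a → trans (sym (ℤₚ.*-assoc k l a)) (trans (cong (ℤ._* a) (ℤₚ.*-comm k l)) (ℤₚ.*-assoc l k a))) x ⟩
  map (λ a → l ℤ.* (k ℤ.* a)) x ≡⟨ Vecₚ.map-∘ (l ℤ.*_) (k ℤ.*_) x ⟩
  l • (k • x)              ∎
  where open ≡-Reasoning

•-zeroˡ : ∀ x → + 0 • x ≡ 0R
•-zeroˡ x = go x
  where
  go : ∀ {n} (u : Vec ℤ n) → map (+ 0 ℤ.*_) u ≡ replicate n (+ 0)
  go []      = refl
  go (_ ∷ u) = cong₂ _∷_ refl (go u)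

•-zeroʳ : ∀ k → k • 0R ≡ 0R
•-zeroʳ k rewrite ℤₚ.*-zeroʳ k = refl

record Linear (f : R → R) : Set where
  field
    +-homo : ∀ x y → f (x + y) ≡ f x + f y
    •-homo : ∀ k x → f (k • x) ≡ k • f x

  0-homo : f 0R ≡ 0R
  0-homo = trans (cong f (sym (•-zeroʳ (+ 0)))) (trans (•-homo (+ 0) 0R) (•-zeroˡ (f 0R)))

open Linear

horner : (R → R) → ∀ {n} → Vec ℤ n → R → R
horner Ω x y = foldr′ (λ a acc → a • y + Ω acc) 0R x

-- Horner's rule is built from scalar multiples, sums and `Ω`, so a linear map that intertwines `Ω`
-- with `Ω′` passes through it. Commutativity and associativity of the product and multiplicativity
-- of the conjugations all come from this.
horner-commutes : ∀ {L Ω Ω′} → Linear L → (∀ z → L (Ω z) ≡ Ω′ (L z)) →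
                  ∀ {n} (x : Vec ℤ n) y → L (horner Ω x y) ≡ horner Ω′ x (L y)
horner-commutes         lin LΩ []      y = 0-homo lin
horner-commutes {Ω′ = Ω′} lin LΩ (a ∷ x) y = trans (lin .+-homo _ _)
  (cong₂ _+_ (lin .•-homo a y) (trans (LΩ _) (cong Ω′ (horner-commutes lin LΩ x y))))

horner-linear : ∀ {Ω} → Linear Ω → ∀ {n} (x : Vec ℤ n) → Linear (horner Ω x)
horner-linear {Ω} lin []      = record { +-homo = λ _ _ → refl ; •-homo = λ k _ → sym (•-zeroʳ k) }
horner-linear {Ω} lin (a ∷ x) = record
  { +-homo = λ y z → trans
      (cong₂ _+_ (•-distribˡ a y z) (trans (cong Ω (H .+-homo y z)) (lin .+-homo _ _)))
      (interchange _ _ _ _)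
  ; •-homo = λ k y → trans
      (cong₂ _+_ (•-comm a k y) (trans (cong Ω (H .•-homo k y)) (lin .•-homo k _)))
      (sym (•-distribˡ k (a • y) (Ω (horner Ω x y))))
  }
  where H = horner-linear lin x

sub-+ : ∀ a b c d → (a ℤ.+ b) ℤ.- (c ℤ.+ d) ≡ (a ℤ.- c) ℤ.+ (b ℤ.- d)
sub-+ = ℤ-solve 4 (λ a b c d → (a :+ b) :- (c :+ d) :≡ (a :- c) :+ (b :- d)) refl

sub-* : ∀ k a b → k ℤ.* a ℤ.- k ℤ.* b ≡ k ℤ.* (a ℤ.- b)
sub-* = ℤ-solve 3 (λ k a b → k :* a :- k :* b :≡ k :* (a :- b)) refl

≡R : ∀ {a₀ a₁ a₂ a₃ a₄ a₅ b₀ b₁ b₂ b₃ b₄ b₅ : ℤ} →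
     a₀ ≡ b₀ → a₁ ≡ b₁ → a₂ ≡ b₂ → a₃ ≡ b₃ → a₄ ≡ b₄ → a₅ ≡ b₅ →
     (R ∋ (a₀ ∷ a₁ ∷ a₂ ∷ a₃ ∷ a₄ ∷ a₅ ∷ [])) ≡ b₀ ∷ b₁ ∷ b₂ ∷ b₃ ∷ b₄ ∷ b₅ ∷ []
≡R refl refl refl refl refl refl = refl

ω·-linear : Linear ω·
ω·-linear = record
  { +-homo = λ where
      (a₀ ∷ a₁ ∷ a₂ ∷ a₃ ∷ a₄ ∷ a₅ ∷ []) (b₀ ∷ b₁ ∷ b₂ ∷ b₃ ∷ b₄ ∷ b₅ ∷ []) →
        ≡R (ℤₚ.neg-distrib-+ a₅ b₅) (sub-+ a₀ b₀ a₅ b₅) (sub-+ a₁ b₁ a₅ b₅)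
           (sub-+ a₂ b₂ a₅ b₅) (sub-+ a₃ b₃ a₅ b₅) (sub-+ a₄ b₄ a₅ b₅)
  ; •-homo = λ where
      k (a₀ ∷ a₁ ∷ a₂ ∷ a₃ ∷ a₄ ∷ a₅ ∷ []) →
        ≡R (ℤₚ.neg-distribʳ-* k a₅) (sub-* k a₀ a₅) (sub-* k a₁ a₅)
           (sub-* k a₂ a₅) (sub-* k a₃ a₅) (sub-* k a₄ a₅)
  }

opaque
  unfolding _*_

  -- The ring laws below see the product only through this equation, so it can stay opaque.
  *-horner : ∀ x y → x * y ≡ horner ω· x y
  *-horner x y = refl

horner-identityʳ : ∀ x → horner ω· x 1R ≡ x
horner-identityʳ x@(a₀ ∷ a₁ ∷ a₂ ∷ a₃ ∷ a₄ ∷ a₅ ∷ []) =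
  Symbolic.coordinatewise x (hornerₚ ω·ₚ generic (ιₚ (+ 1))) generic refl

*-linearʳ : ∀ x → Linear (x *_)
*-linearʳ x = record
  { +-homo = λ y z → trans (*-horner x (y + z)) (trans (H .+-homo y z) (sym (cong₂ _+_ (*-horner x y) (*-horner x z))))
  ; •-homo = λ k y → trans (*-horner x (k • y)) (trans (H .•-homo k y) (sym (cong (k •_) (*-horner x y))))
  }
  where H = horner-linear ω·-linear x

*-ω· : ∀ x z → x * ω· z ≡ ω· (x * z)
*-ω· x z = trans (*-horner x (ω· z))
  (trans (sym (horner-commutes ω·-linear (λ _ → refl) x z)) (cong ω· (sym (*-horner x z))))

*-identityʳ : ∀ x → x * 1R ≡ x
*-identityʳ x = trans (*-horner x 1R) (horner-identityʳ x)

-- `x` is the polynomial `horner ω· x` applied to `1R`, and multiplication by `y` commutes with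
-- every polynomial in `ω·`.
*-comm : ∀ x y → x * y ≡ y * x
*-comm x y = sym (begin
  y * x                  ≡⟨ cong (y *_) (horner-identityʳ x) ⟨
  y * horner ω· x 1R     ≡⟨ horner-commutes (*-linearʳ y) (*-ω· y) x 1R ⟩
  horner ω· x (y * 1R)   ≡⟨ cong (horner ω· x) (*-identityʳ y) ⟩
  horner ω· x y          ≡⟨ *-horner x y ⟨
  x * y                  ∎)
  where open ≡-Reasoning

*-assoc : ∀ x y z → (x * y) * z ≡ x * (y * z)
*-assoc x y z = begin
  (x * y) * z            ≡⟨ *-comm (x * y) z ⟩
  z * (x * y)            ≡⟨ cong (z *_) (*-horner x y) ⟩
  z * horner ω· x y      ≡⟨ horner-commutes (*-linearʳ z) (*-ω· z) x y ⟩
  horner ω· x (z * y)    ≡⟨ *-horner x (z * y) ⟨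
  x * (z * y)            ≡⟨ cong (x *_) (*-comm z y) ⟩
  x * (y * z)            ∎
  where open ≡-Reasoning

R-commutativeRing : CommutativeRing 0ℓ 0ℓ
R-commutativeRing = record
  { Carrier = R ; _≈_ = _≡_ ; _+_ = _+_ ; _*_ = _*_ ; -_ = −_ ; 0# = 0R ; 1# = 1R
  ; isCommutativeRing = record
    { isRing = record
      { +-isAbelianGroup = record
        { isGroup = record
          { isMonoid = record
            { isSemigroup = record
              { isMagma = record { isEquivalence = isEquivalence ; ∙-cong = cong₂ _+_ }
              ; assoc = +-assoc }
            ; identity = +-identityˡ , +-identityʳ }
          ; inverse = −-inverseˡ , −-inverseʳ
          ; ⁻¹-cong = cong −_ }
        ; comm = +-comm }
      ; *-cong = cong₂ _*_
      ; *-assoc = *-assoc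
      ; *-identity = (λ x → trans (*-comm 1R x) (*-identityʳ x)) , *-identityʳ
      ; distrib = (λ x y z → *-linearʳ x .+-homo y z)
                , (λ x y z → trans (*-comm (y + z) x) (trans (*-linearʳ x .+-homo y z) (cong₂ _+_ (*-comm x y) (*-comm x z))))
      }
    ; *-comm = *-comm
    }
  }

ι-* : ∀ k x → ι k * x ≡ k • x
ι-* k x = begin
  ι k * x           ≡⟨ *-comm (ι k) x ⟩
  x * ι k           ≡⟨ cong (x *_) ι≡• ⟨
  x * (k • 1R)      ≡⟨ *-linearʳ x .•-homo k 1R ⟩
  k • (x * 1R)      ≡⟨ cong (k •_) (*-identityʳ x) ⟩
  k • x             ∎
  where
  open ≡-Reasoning
  ι≡• : k • 1R ≡ ι k
  ι≡• rewrite ℤₚ.*-identityʳ k | ℤₚ.*-zeroʳ k = refl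

ι-*-homo : ∀ k l → ι (k ℤ.* l) ≡ ι k * ι l
ι-*-homo k l = trans (sym eq) (sym (ι-* k (ι l)))
  where
  eq : k • ι l ≡ ι (k ℤ.* l)
  eq rewrite ℤₚ.*-zeroʳ k = refl

ι-+-homo : ∀ k l → ι (k ℤ.+ l) ≡ ι k + ι l
ι-+-homo k l = refl

ι-injective : ∀ {k l} → ι k ≡ ι l → k ≡ l
ι-injective = Vecₚ.∷-injectiveˡ

module R-Solver where
  almost : AlmostCommutativeRing 0ℓ 0ℓ
  almost = fromCommutativeRing R-commutativeRing

  -- With ℤ as the coefficient ring, the solver computes with constants such as 3 and 7 instead of
  -- treating them as atoms.
  ι-morphism : CommutativeRing.rawRing ℤₚ.+-*-commutativeRing -Raw-AlmostCommutative⟶ almost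
  ι-morphism = record
    { ⟦_⟧ = ι ; +-homo = ι-+-homo ; *-homo = ι-*-homo ; -‿homo = λ _ → refl
    ; 0-homo = refl ; 1-homo = refl }

  weakDec : ∀ k l → Maybe (ι k ≡ ι l)
  weakDec k l with k ℤₚ.≟ l
  ... | yes k≡l = just (cong ι k≡l)
  ... | no  _   = nothing

  open import Algebra.Solver.Ring (CommutativeRing.rawRing ℤₚ.+-*-commutativeRing) almost ι-morphism weakDec public

-- Conjugates, trace and norm

-- `σ` sends `ω` to `ω²` and has order 3; `bar` is complex conjugation. Together they generate the
-- Galois group of `K`.
σ bar : R → R
σ (a₀ ∷ a₁ ∷ a₂ ∷ a₃ ∷ a₄ ∷ a₅ ∷ []) =
  (a₀ ℤ.- a₃) ∷ (a₄ ℤ.- a₃) ∷ (a₁ ℤ.- a₃) ∷ (a₅ ℤ.- a₃) ∷ (a₂ ℤ.- a₃) ∷ (ℤ.- a₃) ∷ []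
bar (a₀ ∷ a₁ ∷ a₂ ∷ a₃ ∷ a₄ ∷ a₅ ∷ []) =
  (a₀ ℤ.- a₁) ∷ (ℤ.- a₁) ∷ (a₅ ℤ.- a₁) ∷ (a₄ ℤ.- a₁) ∷ (a₃ ℤ.- a₁) ∷ (a₂ ℤ.- a₁) ∷ []

σₚ barₚ : Symbolic.Poly → Symbolic.Poly
σₚ (a₀ ∷ a₁ ∷ a₂ ∷ a₃ ∷ a₄ ∷ a₅ ∷ []) =
  (a₀ :+ :- a₃) ∷ (a₄ :+ :- a₃) ∷ (a₁ :+ :- a₃) ∷ (a₅ :+ :- a₃) ∷ (a₂ :+ :- a₃) ∷ (:- a₃) ∷ []
barₚ (a₀ ∷ a₁ ∷ a₂ ∷ a₃ ∷ a₄ ∷ a₅ ∷ []) =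
  (a₀ :+ :- a₁) ∷ (:- a₁) ∷ (a₅ :+ :- a₁) ∷ (a₄ :+ :- a₁) ∷ (a₃ :+ :- a₁) ∷ (a₂ :+ :- a₁) ∷ []

σ-linear : Linear σ
σ-linear = record
  { +-homo = λ where
      (a₀ ∷ a₁ ∷ a₂ ∷ a₃ ∷ a₄ ∷ a₅ ∷ []) (b₀ ∷ b₁ ∷ b₂ ∷ b₃ ∷ b₄ ∷ b₅ ∷ []) →
        ≡R (sub-+ a₀ b₀ a₃ b₃) (sub-+ a₄ b₄ a₃ b₃) (sub-+ a₁ b₁ a₃ b₃)
           (sub-+ a₅ b₅ a₃ b₃) (sub-+ a₂ b₂ a₃ b₃) (ℤₚ.neg-distrib-+ a₃ b₃)
  ; •-homo = λ where
      k (a₀ ∷ a₁ ∷ a₂ ∷ a₃ ∷ a₄ ∷ a₅ ∷ []) →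
        ≡R (sub-* k a₀ a₃) (sub-* k a₄ a₃) (sub-* k a₁ a₃)
           (sub-* k a₅ a₃) (sub-* k a₂ a₃) (ℤₚ.neg-distribʳ-* k a₃)
  }

bar-linear : Linear bar
bar-linear = record
  { +-homo = λ where
      (a₀ ∷ a₁ ∷ a₂ ∷ a₃ ∷ a₄ ∷ a₅ ∷ []) (b₀ ∷ b₁ ∷ b₂ ∷ b₃ ∷ b₄ ∷ b₅ ∷ []) →
        ≡R (sub-+ a₀ b₀ a₁ b₁) (ℤₚ.neg-distrib-+ a₁ b₁) (sub-+ a₅ b₅ a₁ b₁)
           (sub-+ a₄ b₄ a₁ b₁) (sub-+ a₃ b₃ a₁ b₁) (sub-+ a₂ b₂ a₁ b₁)
  ; •-homo = λ where
      k (a₀ ∷ a₁ ∷ a₂ ∷ a₃ ∷ a₄ ∷ a₅ ∷ []) →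
        ≡R (sub-* k a₀ a₁) (ℤₚ.neg-distribʳ-* k a₁) (sub-* k a₅ a₁)
           (sub-* k a₄ a₁) (sub-* k a₃ a₁) (sub-* k a₂ a₁)
  }

-- Both sides equal `horner Ω x (ψ y)`. Here `Ω` plays multiplication by `ψ ω`, written as an
-- iterate of `ω·` so that its compatibility with `ψ` can be checked on coordinates.
multiplicative : ∀ {ψ Ω} → Linear ψ → ψ 1R ≡ 1R → (∀ z → ψ (ω· z) ≡ Ω (ψ z)) →
                 (∀ x z → x * Ω z ≡ Ω (x * z)) → ∀ x y → ψ (x * y) ≡ ψ x * ψ y
multiplicative {ψ} {Ω} lin ψ1 ψω *Ω x y = begin
  ψ (x * y)                    ≡⟨ cong ψ (*-horner x y) ⟩
  ψ (horner ω· x y)            ≡⟨ horner-commutes lin ψω x y ⟩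
  horner Ω x (ψ y)             ≡⟨ cong (horner Ω x) (*-identityʳ (ψ y)) ⟨
  horner Ω x (ψ y * 1R)        ≡⟨ horner-commutes (*-linearʳ (ψ y)) (*Ω (ψ y)) x 1R ⟨
  ψ y * horner Ω x 1R          ≡⟨ cong (λ u → ψ y * horner Ω x u) ψ1 ⟨
  ψ y * horner Ω x (ψ 1R)      ≡⟨ cong (λ u → ψ y * u) (horner-commutes lin ψω x 1R) ⟨
  ψ y * ψ (horner ω· x 1R)     ≡⟨ cong (λ u → ψ y * ψ u) (horner-identityʳ x) ⟩
  ψ y * ψ x                    ≡⟨ *-comm (ψ y) (ψ x) ⟩
  ψ x * ψ y                    ∎
  where open ≡-Reasoning

σ-* : ∀ x y → σ (x * y) ≡ σ x * σ y
σ-* = multiplicative {Ω = λ z → ω· (ω· z)} σ-linear refl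
  (λ where
    z@(_ ∷ _ ∷ _ ∷ _ ∷ _ ∷ _ ∷ []) →
     Symbolic.coordinatewise z (σₚ (ω·ₚ generic)) (ω·ₚ (ω·ₚ (σₚ generic))) refl)
  (λ x z → trans (*-ω· x (ω· z)) (cong ω· (*-ω· x z)))

-- ω⁻¹ = ω⁶.
bar-* : ∀ x y → bar (x * y) ≡ bar x * bar y
bar-* = multiplicative {Ω = λ z → ω·² (ω·² (ω·² z))} bar-linear refl
  (λ where
    z@(_ ∷ _ ∷ _ ∷ _ ∷ _ ∷ _ ∷ []) →
     Symbolic.coordinatewise z (barₚ (ω·ₚ generic)) (ω·²ₚ (ω·²ₚ (ω·²ₚ (barₚ generic)))) refl)
  (λ x z → trans (*-ω·² x _) (cong ω·² (trans (*-ω·² x _) (cong ω·² (*-ω·² x z)))))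
  where
  ω·² : R → R
  ω·² z = ω· (ω· z)
  ω·²ₚ : Symbolic.Poly → Symbolic.Poly
  ω·²ₚ z = ω·ₚ (ω·ₚ z)
  *-ω·² : ∀ x z → x * ω·² z ≡ ω·² (x * z)
  *-ω·² x z = trans (*-ω· x (ω· z)) (cong ω· (*-ω· x z))

σ³ : ∀ z → σ (σ (σ z)) ≡ z
σ³ z@(_ ∷ _ ∷ _ ∷ _ ∷ _ ∷ _ ∷ []) = Symbolic.coordinatewise z (σₚ (σₚ (σₚ generic))) generic refl

bar² : ∀ z → bar (bar z) ≡ z
bar² z@(_ ∷ _ ∷ _ ∷ _ ∷ _ ∷ _ ∷ []) = Symbolic.coordinatewise z (barₚ (barₚ generic)) generic refl

bar-σ : ∀ z → bar (σ z) ≡ σ (bar z)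
bar-σ z@(_ ∷ _ ∷ _ ∷ _ ∷ _ ∷ _ ∷ []) = Symbolic.coordinatewise z (barₚ (σₚ generic)) (σₚ (barₚ generic)) refl

Real : R → Set
Real x = bar x ≡ x

real-σ : ∀ {x} → Real x → Real (σ x)
real-σ {x} rx = trans (bar-σ x) (cong σ rx)

real-* : ∀ {x y} → Real x → Real y → Real (x * y)
real-* {x} {y} rx ry = trans (bar-* x y) (cong₂ _*_ rx ry)

real-+ : ∀ {x y} → Real x → Real y → Real (x + y)
real-+ {x} {y} rx ry = trans (bar-linear .+-homo x y) (cong₂ _+_ rx ry)

−≡• : ∀ x → − x ≡ ℤ.- + 1 • x
−≡• x = Vecₚ.map-cong (λ a → sym (ℤₚ.-1*i≡-i a)) x

real-− : ∀ {x} → Real x → Real (− x)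
real-− {x} rx = begin
  bar (− x)              ≡⟨ cong bar (−≡• x) ⟩
  bar (ℤ.- + 1 • x)      ≡⟨ bar-linear .•-homo (ℤ.- + 1) x ⟩
  ℤ.- + 1 • bar x        ≡⟨ cong (ℤ.- + 1 •_) rx ⟩
  ℤ.- + 1 • x            ≡⟨ −≡• x ⟨
  − x                    ∎
  where open ≡-Reasoning

σ-− : ∀ x → σ (− x) ≡ − σ x
σ-− x = trans (cong σ (−≡• x)) (trans (σ-linear .•-homo (ℤ.- + 1) x) (sym (−≡• (σ x))))

-- Comparing constant coordinates, invariance under `bar` kills `a₁` and invariance under `σ` kills
-- `a₃`; `σ` then links `a₄` and `a₂` to `a₁`, and `a₅` to `a₃`.
fixed⇒integer : ∀ {x} → Real x → σ x ≡ x → x ≡ ι (head x)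
fixed⇒integer {a₀ ∷ a₁ ∷ a₂ ∷ a₃ ∷ a₄ ∷ a₅ ∷ []} rx sx = ≡R refl a₁≡0 a₂≡0 a₃≡0 a₄≡0 a₅≡0
  where
  open ≡-Reasoning
  minus-zero : ∀ {a b} → a ℤ.- b ≡ a → b ≡ + 0
  minus-zero {a} {b} eq = begin
    b                    ≡⟨ ℤ-solve 2 (λ a b → b :≡ a :- (a :- b)) refl a b ⟩
    a ℤ.- (a ℤ.- b)      ≡⟨ cong (λ u → a ℤ.- u) eq ⟩
    a ℤ.- a              ≡⟨ ℤₚ.+-inverseʳ a ⟩
    + 0                  ∎
  coord : ∀ i → lookup (σ (a₀ ∷ a₁ ∷ a₂ ∷ a₃ ∷ a₄ ∷ a₅ ∷ [])) i ≡ lookup (a₀ ∷ a₁ ∷ a₂ ∷ a₃ ∷ a₄ ∷ a₅ ∷ []) i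
  coord i = cong (λ v → lookup v i) sx
  a₁≡0 = minus-zero {a₀} (cong head rx)
  a₃≡0 = minus-zero {a₀} (coord (# 0))
  drop₃ : ∀ {u v} → u ℤ.- a₃ ≡ v → u ≡ v
  drop₃ {u} eq = trans (trans (sym (ℤₚ.+-identityʳ u)) (cong (λ w → u ℤ.- w) (sym a₃≡0))) eq
  a₄≡0 = trans (drop₃ (coord (# 1))) a₁≡0
  a₂≡0 = trans (drop₃ (coord (# 4))) a₄≡0
  a₅≡0 = trans (drop₃ (coord (# 3))) a₃≡0

trace norm₃ : R → R
trace y = y + σ y + σ (σ y)
norm₃ y = y * σ y * σ (σ y)

σ-trace : ∀ y → σ (trace y) ≡ trace y
σ-trace y = begin
  σ (y + σ y + σ (σ y))              ≡⟨ σ-linear .+-homo (y + σ y) (σ (σ y)) ⟩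
  σ (y + σ y) + σ (σ (σ y))          ≡⟨ cong₂ _+_ (σ-linear .+-homo y (σ y)) (σ³ y) ⟩
  σ y + σ (σ y) + y                  ≡⟨ +-comm _ y ⟩
  y + (σ y + σ (σ y))                ≡⟨ +-assoc y (σ y) (σ (σ y)) ⟨
  y + σ y + σ (σ y)                  ∎
  where open ≡-Reasoning

σ-norm₃ : ∀ y → σ (norm₃ y) ≡ norm₃ y
σ-norm₃ y = begin
  σ (y * σ y * σ (σ y))              ≡⟨ σ-* (y * σ y) (σ (σ y)) ⟩
  σ (y * σ y) * σ (σ (σ y))          ≡⟨ cong₂ _*_ (σ-* y (σ y)) (σ³ y) ⟩
  σ y * σ (σ y) * y                  ≡⟨ *-comm _ y ⟩
  y * (σ y * σ (σ y))                ≡⟨ *-assoc y (σ y) (σ (σ y)) ⟨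
  y * σ y * σ (σ y)                  ∎
  where open ≡-Reasoning

∣_∣² : R → R
∣ x ∣² = x * bar x

∣∣²-real : ∀ x → Real ∣ x ∣²
∣∣²-real x = trans (bar-* x (bar x)) (trans (cong (λ u → bar x * u) (bar² x)) (*-comm (bar x) x))

-- `Nm` is the norm of `K` over ℚ, and `τ` is half the trace of `∣ x ∣²`. The elements under `head`
-- are Galois invariant, hence integers, so `head` loses nothing.
τ Nm : R → ℤ
τ x = head (trace ∣ x ∣²)
Nm x = head (norm₃ ∣ x ∣²)

trace-∣∣² : ∀ x → trace ∣ x ∣² ≡ ι (τ x)
trace-∣∣² x = fixed⇒integer (real-+ (real-+ r (real-σ r)) (real-σ (real-σ r))) (σ-trace ∣ x ∣²)
  where r = ∣∣²-real x

norm₃-∣∣² : ∀ x → norm₃ ∣ x ∣² ≡ ι (Nm x)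
norm₃-∣∣² x = fixed⇒integer (real-* (real-* r (real-σ r)) (real-σ (real-σ r))) (σ-norm₃ ∣ x ∣²)
  where r = ∣∣²-real x

-- The trace form in coordinates and its definiteness

sumSq sum : ∀ {n} → Vec ℤ n → ℤ
sumSq = foldr′ (λ a s → a ℤ.* a ℤ.+ s) (+ 0)
sum   = foldr′ ℤ._+_ (+ 0)

sumSqₚ sumₚ : ∀ {n k} → Vec (Polynomial k) n → Polynomial k
sumSqₚ = foldr′ (λ a s → a :* a :+ s) (con (+ 0))
sumₚ   = foldr′ _:+_ (con (+ 0))

opaque
  unfolding _*_

  -- `2 τ x` is the trace of `x x̄` over ℚ. The trace of `ωⁱ⁻ʲ` is 6 for `i = j` and -1 otherwise,
  -- whence `7 Σ aᵢ² - (Σ aᵢ)²`.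
  τ-formula : ∀ x → + 2 ℤ.* τ x ≡ + 7 ℤ.* sumSq x ℤ.- sum x ℤ.* sum x
  τ-formula x@(_ ∷ _ ∷ _ ∷ _ ∷ _ ∷ _ ∷ []) = Vecₚ.∷-injectiveˡ
    (Symbolic.coordinatewise x (con (+ 2) :* head traceₚ ∷ []) (con (+ 7) :* sumSqₚ generic :- sumₚ generic :* sumₚ generic ∷ []) refl)
    where
    θₚ traceₚ : Symbolic.Poly
    θₚ = hornerₚ ω·ₚ generic (barₚ generic)
    _+ₚ_ : Symbolic.Poly → Symbolic.Poly → Symbolic.Poly
    _+ₚ_ = zipWith _:+_
    traceₚ = (θₚ +ₚ σₚ θₚ) +ₚ σₚ (σₚ θₚ)

0≤square : ∀ a → + 0 ℤ.≤ a ℤ.* a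
0≤square a = subst (+ 0 ℤ.≤_) (trans (cong +_ (ℤₚ.abs-* a a)) (square a)) (+≤+ z≤n)
  where
  square : ∀ a → + (∣ a ∣ ℕ.* ∣ a ∣) ≡ a ℤ.* a
  square (+ n) = ℤₚ.pos-* n n
  square (-[1+ n ]) = refl

0≤sumSq : ∀ {n} (u : Vec ℤ n) → + 0 ℤ.≤ sumSq u
0≤sumSq []      = ℤₚ.≤-refl
0≤sumSq (a ∷ u) = ℤₚ.+-mono-≤ (0≤square a) (0≤sumSq u)

sumSq-definite : ∀ {n} (u : Vec ℤ n) → sumSq u ℤ.≤ + 0 → u ≡ replicate n (+ 0)
sumSq-definite []      _  = refl
sumSq-definite (a ∷ u) le = cong₂ _∷_ a≡0 (sumSq-definite u (ℤₚ.≤-trans (subst (ℤ._≤ a ℤ.* a ℤ.+ sumSq u) (ℤₚ.+-identityˡ _) (ℤₚ.+-monoˡ-≤ (sumSq u) (0≤square a))) le))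
  where
  a*a≡0 : a ℤ.* a ≡ + 0
  a*a≡0 = ℤₚ.≤-antisym
    (ℤₚ.≤-trans (subst (ℤ._≤ a ℤ.* a ℤ.+ sumSq u) (ℤₚ.+-identityʳ _) (ℤₚ.+-monoʳ-≤ (a ℤ.* a) (0≤sumSq u))) le)
    (0≤square a)
  a≡0 = [ (λ z → z) , (λ z → z) ]′ (ℤₚ.i*j≡0⇒i≡0∨j≡0 a a*a≡0)

pairwise : ∀ {A : Set} → (A → A → A) → A → A → A → A → A → A → Vec A 15
pairwise _-_ a b c d e f =
  (a - b) ∷ (a - c) ∷ (a - d) ∷ (a - e) ∷ (a - f) ∷ (b - c) ∷ (b - d) ∷ (b - e) ∷ (b - f) ∷
  (c - d) ∷ (c - e) ∷ (c - f) ∷ (d - e) ∷ (d - f) ∷ (e - f) ∷ []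

-- Lagrange's identity: `7 Σ aᵢ² - (Σ aᵢ)²` exceeds `Σ aᵢ²` by the sum of the squared differences
-- listed in `pairwise`.
sumSq≤2τ : ∀ x → sumSq x ℤ.≤ + 2 ℤ.* τ x
sumSq≤2τ x@(a ∷ b ∷ c ∷ d ∷ e ∷ f ∷ []) =
  subst (sumSq x ℤ.≤_) (sym (trans (τ-formula x) (Vecₚ.∷-injectiveˡ lagrange)))
    (subst (ℤ._≤ sumSq x ℤ.+ sumSq w) (ℤₚ.+-identityʳ _) (ℤₚ.+-monoʳ-≤ (sumSq x) (0≤sumSq w)))
  where
  w = pairwise ℤ._-_ a b c d e f
  wₚ : Symbolic.Poly → Vec (Polynomial 6) 15
  wₚ (a ∷ b ∷ c ∷ d ∷ e ∷ f ∷ []) = pairwise _:-_ a b c d e f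
  lagrange : (+ 7 ℤ.* sumSq x ℤ.- sum x ℤ.* sum x) ∷ [] ≡ (sumSq x ℤ.+ sumSq w) ∷ []
  lagrange = Symbolic.coordinatewise x (con (+ 7) :* sumSqₚ generic :- sumₚ generic :* sumₚ generic ∷ [])
    (sumSqₚ generic :+ sumSqₚ (wₚ generic) ∷ []) refl

0≤τ : ∀ x → + 0 ℤ.≤ τ x
0≤τ x = ℤₚ.*-cancelˡ-≤-pos (+ 0) (τ x) (+ 2) (ℤₚ.≤-trans (0≤sumSq x) (sumSq≤2τ x))

τ-definite : ∀ x → τ x ≡ + 0 → x ≡ 0R
τ-definite x eq = sumSq-definite x (subst (λ t → sumSq x ℤ.≤ + 2 ℤ.* t) eq (sumSq≤2τ x))

*-zeroˡ : ∀ x → 0R * x ≡ 0R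
*-zeroˡ x = trans (ι-* (+ 0) x) (•-zeroˡ x)

Nm-0R : Nm 0R ≡ + 0
Nm-0R = cong head (begin
  ∣ 0R ∣² * σ ∣ 0R ∣² * σ (σ ∣ 0R ∣²)   ≡⟨ cong (λ u → u * σ ∣ 0R ∣² * σ (σ ∣ 0R ∣²)) (*-zeroˡ (bar 0R)) ⟩
  0R * σ ∣ 0R ∣² * σ (σ ∣ 0R ∣²)        ≡⟨ cong (λ u → u * σ (σ ∣ 0R ∣²)) (*-zeroˡ _) ⟩
  0R * σ (σ ∣ 0R ∣²)                    ≡⟨ *-zeroˡ _ ⟩
  0R                                    ∎)
  where open ≡-Reasoning

-- The AM-GM inequality between `τ` and `Nm`

am-gm : ∀ t s n .{{_ : ℤ.Positive t}} → + 0 ℤ.≤ s → + 3 ℤ.* s ℤ.≤ t ℤ.* t →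
        + 3 ℤ.* (n ℤ.* t) ℤ.≤ s ℤ.* s → + 27 ℤ.* n ℤ.≤ t ℤ.* (t ℤ.* t)
-- With `t`, `s`, `n` the elementary symmetric functions of three reals, the hypotheses are Newton's
-- inequalities. They chain to `27 n t ≤ 9 s² ≤ t⁴`, and `t` cancels.
am-gm t@(+ suc t-1) s n 0≤s 3s≤t² 3nt≤s² = ℤₚ.*-cancelˡ-≤-pos _ _ t (begin
  t ℤ.* (+ 27 ℤ.* n)                   ≡⟨ ℤ-solve 2 (λ t n → t :* (con (+ 27) :* n) :≡ con (+ 9) :* (con (+ 3) :* (n :* t))) refl t n ⟩
  + 9 ℤ.* (+ 3 ℤ.* (n ℤ.* t))          ≤⟨ ℤₚ.*-monoˡ-≤-nonNeg (+ 9) 3nt≤s² ⟩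
  + 9 ℤ.* (s ℤ.* s)                    ≡⟨ ℤ-solve 1 (λ s → con (+ 9) :* (s :* s) :≡ con (+ 3) :* s :* (con (+ 3) :* s)) refl s ⟩
  + 3 ℤ.* s ℤ.* (+ 3 ℤ.* s)            ≤⟨ ℤₚ.*-monoˡ-≤-nonNeg (+ 3 ℤ.* s) {{ℤ.nonNegative (ℤₚ.*-monoˡ-≤-nonNeg (+ 3) 0≤s)}} 3s≤t² ⟩
  + 3 ℤ.* s ℤ.* (t ℤ.* t)              ≤⟨ ℤₚ.*-monoʳ-≤-nonNeg (t ℤ.* t) 3s≤t² ⟩
  t ℤ.* t ℤ.* (t ℤ.* t)                ≡⟨ ℤₚ.*-assoc t t (t ℤ.* t) ⟩
  t ℤ.* (t ℤ.* (t ℤ.* t))              ∎)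
  where open ℤₚ.≤-Reasoning

open R-Solver using (solve; _:=_) renaming (_:+_ to _⊕_; _:*_ to _⊛_; _:-_ to _⊖_; :-_ to ⊝_; con to κ)

∣∣²-* : ∀ y z → ∣ y * z ∣² ≡ ∣ y ∣² * ∣ z ∣²
∣∣²-* y z = trans (cong (λ u → y * z * u) (bar-* y z))
  (solve 4 (λ a b c d → a ⊛ b ⊛ (c ⊛ d) := a ⊛ c ⊛ (b ⊛ d)) refl y z (bar y) (bar z))

∣∣²-σ : ∀ y → ∣ σ y ∣² ≡ σ ∣ y ∣²
∣∣²-σ y = trans (cong (λ u → σ y * u) (bar-σ y)) (sym (σ-* y (bar y)))

-- With θ₀, θ₁, θ₂ the conjugates of ∣x∣², the integers τ x, τ (x * σ x) and Nm x
-- are their elementary symmetric functions.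
module _ (x : R) where

  private
    θ₀ θ₁ θ₂ : R
    θ₀ = ∣ x ∣²
    θ₁ = σ θ₀
    θ₂ = σ θ₁

    t s n : ℤ
    t = τ x
    s = τ (x * σ x)
    n = Nm x

    real₀ : Real θ₀
    real₀ = ∣∣²-real x

    ∣xσx∣² : ∣ x * σ x ∣² ≡ θ₀ * θ₁
    ∣xσx∣² = trans (∣∣²-* x (σ x)) (cong (λ u → θ₀ * u) (∣∣²-σ x))

    e₁ : θ₀ + θ₁ + θ₂ ≡ ι t
    e₁ = trace-∣∣² x

    σθ₂ : σ θ₂ ≡ θ₀
    σθ₂ = σ³ θ₀

    e₂ : θ₀ * θ₁ + θ₁ * θ₂ + θ₂ * θ₀ ≡ ι s
    e₂ = begin
      θ₀ * θ₁ + θ₁ * θ₂ + θ₂ * θ₀   ≡⟨ cong₂ (λ u v → θ₀ * θ₁ + u + v) (σ-* θ₀ θ₁) (trans (cong σ (σ-* θ₀ θ₁)) (trans (σ-* θ₁ θ₂) (cong (λ u → θ₂ * u) σθ₂))) ⟨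
      trace (θ₀ * θ₁)               ≡⟨ cong trace ∣xσx∣² ⟨
      trace ∣ x * σ x ∣²            ≡⟨ trace-∣∣² (x * σ x) ⟩
      ι s                           ∎
      where open ≡-Reasoning

    e₃ : θ₀ * θ₁ * θ₂ ≡ ι n
    e₃ = norm₃-∣∣² x

    trace-square : ∀ {y} → Real y → y * y + σ y * σ y + σ (σ y) * σ (σ y) ≡ ι (τ y)
    trace-square {y} ry = begin
      y * y + σ y * σ y + σ (σ y) * σ (σ y)    ≡⟨ cong₂ (λ u v → y * y + u + v) (σ-* y y) (trans (cong σ (σ-* y y)) (σ-* (σ y) (σ y))) ⟨
      trace (y * y)                            ≡⟨ cong (λ u → trace (y * u)) ry ⟨
      trace ∣ y ∣²                             ≡⟨ trace-∣∣² y ⟩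
      ι (τ y)                                  ∎
      where open ≡-Reasoning

    σ-sub : ∀ y z → σ (y + − z) ≡ σ y + − σ z
    σ-sub y z = trans (σ-linear .+-homo y (− z)) (cong (λ u → σ y + u) (σ-− z))

    -- The squared differences of the conjugates of a real `a` add up to `τ (a - σ a)`, which is
    -- nonnegative. Applied to `θ₀` and to `θ₀ θ₁`, this gives Newton's two inequalities inside `R`,
    -- without real embeddings.
    variance : ∀ {a} → Real a → ι (τ (a + − σ a)) ≡
               ι (+ 2) * (trace a * trace a + − (ι (+ 3) * (a * σ a + σ a * σ (σ a) + σ (σ a) * a)))
    variance {a} ra = begin
      ι (τ (a + − b))                              ≡⟨ trace-square (real-+ ra (real-− (real-σ ra))) ⟨
      (a + − b) * (a + − b) + σ (a + − b) * σ (a + − b) + σ (σ (a + − b)) * σ (σ (a + − b))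
         ≡⟨ cong₂ (λ u v → (a + − b) * (a + − b) + u * u + v * v) (σ-sub a b) (trans (cong σ (σ-sub a b)) (trans (σ-sub b c) (cong (λ u → c + − u) (σ³ a)))) ⟩
      (a + − b) * (a + − b) + (b + − c) * (b + − c) + (c + − a) * (c + − a)
         ≡⟨ solve 3 (λ a b c → (a ⊖ b) ⊛ (a ⊖ b) ⊕ (b ⊖ c) ⊛ (b ⊖ c) ⊕ (c ⊖ a) ⊛ (c ⊖ a) :=
              κ (+ 2) ⊛ ((a ⊕ b ⊕ c) ⊛ (a ⊕ b ⊕ c) ⊖ κ (+ 3) ⊛ (a ⊛ b ⊕ b ⊛ c ⊕ c ⊛ a))) refl a b c ⟩
      ι (+ 2) * (trace a * trace a + − (ι (+ 3) * (a * b + b * c + c * a))) ∎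
      where
      open ≡-Reasoning
      b = σ a
      c = σ b

    nonneg : ∀ {y} k → ι (τ y) ≡ ι (+ 2) * ι k → + 0 ℤ.≤ k
    nonneg {y} k eq = ℤₚ.*-cancelˡ-≤-pos (+ 0) k (+ 2)
      (subst (+ 0 ℤ.≤_) (ι-injective (trans eq (sym (ι-*-homo (+ 2) k)))) (0≤τ y))

    ι-diff : ∀ k l → ι (k ℤ.* k ℤ.- + 3 ℤ.* l) ≡ ι k * ι k + − (ι (+ 3) * ι l)
    ι-diff k l = trans (ι-+-homo (k ℤ.* k) _) (cong₂ (λ u v → u + − v) (ι-*-homo k k) (ι-*-homo (+ 3) l))

    3s≤t² : + 3 ℤ.* s ℤ.≤ t ℤ.* t
    3s≤t² = ℤₚ.0≤i-j⇒j≤i (nonneg _ (trans (variance real₀)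
      (cong (λ u → ι (+ 2) * u) (trans (cong₂ (λ u v → u * u + − (ι (+ 3) * v)) e₁ e₂) (sym (ι-diff t s))))))

    φ : R
    φ = θ₀ * θ₁

    σφ : σ φ ≡ θ₁ * θ₂
    σφ = σ-* θ₀ θ₁

    σσφ : σ (σ φ) ≡ θ₂ * θ₀
    σσφ = trans (cong σ σφ) (trans (σ-* θ₁ θ₂) (cong (λ u → θ₂ * u) σθ₂))

    3nt≤s² : + 3 ℤ.* (n ℤ.* t) ℤ.≤ s ℤ.* s
    3nt≤s² = ℤₚ.0≤i-j⇒j≤i (nonneg _ (trans (variance (real-* real₀ (real-σ real₀)))
      (cong (λ u → ι (+ 2) * u) (trans
        (cong₂ (λ u v → u * u + − (ι (+ 3) * v)) trace-φ products) (sym (ι-diff s (n ℤ.* t)))))))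
      where
      open ≡-Reasoning
      trace-φ : trace φ ≡ ι s
      trace-φ = trans (cong₂ (λ u v → φ + u + v) σφ σσφ) e₂
      products : φ * σ φ + σ φ * σ (σ φ) + σ (σ φ) * φ ≡ ι (n ℤ.* t)
      products = begin
        φ * σ φ + σ φ * σ (σ φ) + σ (σ φ) * φ
          ≡⟨ cong₂ (λ u v → φ * u + u * v + v * φ) σφ σσφ ⟩
        θ₀ * θ₁ * (θ₁ * θ₂) + θ₁ * θ₂ * (θ₂ * θ₀) + θ₂ * θ₀ * (θ₀ * θ₁)
          ≡⟨ solve 3 (λ a b c → a ⊛ b ⊛ (b ⊛ c) ⊕ b ⊛ c ⊛ (c ⊛ a) ⊕ c ⊛ a ⊛ (a ⊛ b) := a ⊛ b ⊛ c ⊛ (a ⊕ b ⊕ c)) refl θ₀ θ₁ θ₂ ⟩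
        θ₀ * θ₁ * θ₂ * (θ₀ + θ₁ + θ₂)  ≡⟨ cong₂ _*_ e₃ e₁ ⟩
        ι n * ι t                       ≡⟨ ι-*-homo n t ⟨
        ι (n ℤ.* t)                     ∎

  -- The product `z` of the conjugates of `x` under `σ` has `∣ z ∣²` equal to the integer `Nm x`, so
  -- `τ z = 3 Nm x`.
  0≤Nm : + 0 ℤ.≤ Nm x
  0≤Nm = ℤₚ.*-cancelˡ-≤-pos (+ 0) n (+ 3) (subst (+ 0 ℤ.≤_) (ι-injective eq) (0≤τ (x * σ x * σ (σ x))))
    where
    open ≡-Reasoning
    z = x * σ x * σ (σ x)
    norm-z : ∣ z ∣² ≡ ι n
    norm-z = begin
      ∣ x * σ x * σ (σ x) ∣²          ≡⟨ ∣∣²-* (x * σ x) (σ (σ x)) ⟩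
      ∣ x * σ x ∣² * ∣ σ (σ x) ∣²     ≡⟨ cong₂ _*_ ∣xσx∣² (trans (∣∣²-σ (σ x)) (cong σ (∣∣²-σ x))) ⟩
      θ₀ * θ₁ * θ₂                    ≡⟨ e₃ ⟩
      ι n                             ∎
    eq : ι (τ z) ≡ ι (+ 3 ℤ.* n)
    eq = begin
      ι (τ z)               ≡⟨ trace-∣∣² z ⟨
      trace ∣ z ∣²          ≡⟨ cong trace norm-z ⟩
      trace (ι n)           ≡⟨ cong (λ u → ι n + u + σ u) σι ⟩
      ι n + ι n + σ (ι n)   ≡⟨ cong (λ u → ι n + ι n + u) σι ⟩
      ι n + ι n + ι n       ≡⟨ solve 1 (λ a → a ⊕ a ⊕ a := κ (+ 3) ⊛ a) refl (ι n) ⟩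
      ι (+ 3) * ι n         ≡⟨ ι-*-homo (+ 3) n ⟨
      ι (+ 3 ℤ.* n)         ∎
      where
      σι : σ (ι n) ≡ ι n
      σι = cong (λ u → u ∷ replicate 5 (+ 0)) (ℤₚ.+-identityʳ n)

  27Nm≤τ³ : + 27 ℤ.* Nm x ℤ.≤ τ x ℤ.* (τ x ℤ.* τ x)
  27Nm≤τ³ with + 0 ℤₚ.<? t
  ... | yes 0<t = am-gm t s n {{ℤ.positive 0<t}} (0≤τ (x * σ x)) 3s≤t² 3nt≤s²
  ... | no  0≮t = subst₂ (λ u v → + 27 ℤ.* u ℤ.≤ v ℤ.* (v ℤ.* v)) (sym n≡0) (sym t≡0) ℤₚ.≤-refl
    where
    t≡0 = ℤₚ.≤-antisym (ℤₚ.≮⇒≥ 0≮t) (0≤τ x)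
    n≡0 : n ≡ + 0
    n≡0 = trans (cong Nm (τ-definite x t≡0)) Nm-0R

-- Division with remainder

Nm-* : ∀ x y → Nm (x * y) ≡ Nm x ℤ.* Nm y
Nm-* x y = ι-injective (begin
  ι (Nm (x * y))             ≡⟨ norm₃-∣∣² (x * y) ⟨
  norm₃ ∣ x * y ∣²           ≡⟨ cong norm₃ (∣∣²-* x y) ⟩
  norm₃ (a * b)              ≡⟨ cong₂ (λ u v → a * b * u * v) (σ-* a b) (trans (cong σ (σ-* a b)) (σ-* (σ a) (σ b))) ⟩
  a * b * (σ a * σ b) * (σ (σ a) * σ (σ b))
                             ≡⟨ solve 6 (λ a a′ a″ b b′ b″ → a ⊛ b ⊛ (a′ ⊛ b′) ⊛ (a″ ⊛ b″) := a ⊛ a′ ⊛ a″ ⊛ (b ⊛ b′ ⊛ b″)) refl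
                                  a (σ a) (σ (σ a)) b (σ b) (σ (σ b)) ⟩
  norm₃ a * norm₃ b          ≡⟨ cong₂ _*_ (norm₃-∣∣² x) (norm₃-∣∣² y) ⟩
  ι (Nm x) * ι (Nm y)        ≡⟨ ι-*-homo (Nm x) (Nm y) ⟨
  ι (Nm x ℤ.* Nm y)          ∎)
  where
  open ≡-Reasoning
  a = ∣ x ∣²
  b = ∣ y ∣²

-- The product of the five other conjugates of `x`; divided by `Nm x` it is the inverse of `x` in
-- `K`.
adjoint : R → R
adjoint x = bar x * σ ∣ x ∣² * σ (σ ∣ x ∣²)

*-adjoint : ∀ x → x * adjoint x ≡ ι (Nm x)
*-adjoint x = trans
  (solve 4 (λ a b c d → a ⊛ (b ⊛ c ⊛ d) := a ⊛ b ⊛ c ⊛ d) refl x (bar x) (σ ∣ x ∣²) (σ (σ ∣ x ∣²)))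
  (norm₃-∣∣² x)

_⁶ : ℤ → ℤ
k ⁶ = k ℤ.* k ℤ.* (k ℤ.* k) ℤ.* (k ℤ.* k)

Nm-ι : ∀ k → Nm (ι k) ≡ k ⁶
Nm-ι k = ι-injective (begin
  ι (Nm (ι k))           ≡⟨ norm₃-∣∣² (ι k) ⟨
  norm₃ ∣ ι k ∣²         ≡⟨ cong norm₃ sq ⟩
  norm₃ (ι (k ℤ.* k))    ≡⟨ cong₂ (λ u v → ι (k ℤ.* k) * u * v) (σ-ι (k ℤ.* k)) (trans (cong σ (σ-ι (k ℤ.* k))) (σ-ι (k ℤ.* k))) ⟩
  ι (k ℤ.* k) * ι (k ℤ.* k) * ι (k ℤ.* k)  ≡⟨ cong (λ u → u * ι (k ℤ.* k)) (ι-*-homo (k ℤ.* k) (k ℤ.* k)) ⟨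
  ι (k ℤ.* k ℤ.* (k ℤ.* k)) * ι (k ℤ.* k)  ≡⟨ ι-*-homo _ (k ℤ.* k) ⟨
  ι (k ⁶)                ∎)
  where
  open ≡-Reasoning
  σ-ι : ∀ l → σ (ι l) ≡ ι l
  σ-ι l = cong (λ u → u ∷ replicate 5 (+ 0)) (ℤₚ.+-identityʳ l)
  sq : ∣ ι k ∣² ≡ ι (k ℤ.* k)
  sq = trans (cong (λ u → ι k * u) (cong (λ u → u ∷ replicate 5 (+ 0)) (ℤₚ.+-identityʳ k))) (sym (ι-*-homo k k))

∣Nm∣ : ∀ x → + ∣ Nm x ∣ ≡ Nm x
∣Nm∣ x = ℤₚ.0≤i⇒+∣i∣≡i (0≤Nm x)

-- Rounding and the covering by translates

round : ∀ h .{{_ : ℕ.NonZero h}} v → ∃[ a ] ∃[ t ] v ≡ a ℤ.* + h ℤ.+ t × + 4 ℤ.* (t ℤ.* t) ℤ.≤ + h ℤ.* + h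
round h v with 2 ℕ.* r ℕ.≤? h
  where r = v ℤDivMod.%ℕ h
... | yes 2r≤h = q , + r , trans (ℤDivMod.a≡a%ℕn+[a/ℕn]*n v h) (ℤₚ.+-comm (+ r) (q ℤ.* + h)) , bound
  where
  q = v ℤDivMod./ℕ h
  r = v ℤDivMod.%ℕ h
  bound : + 4 ℤ.* (+ r ℤ.* + r) ℤ.≤ + h ℤ.* + h
  bound = subst₂ ℤ._≤_
    (trans (ℤₚ.pos-* (2 ℕ.* r) (2 ℕ.* r)) (trans (cong₂ ℤ._*_ (ℤₚ.pos-* 2 r) (ℤₚ.pos-* 2 r)) (ℤ-solve 1 (λ r → con (+ 2) :* r :* (con (+ 2) :* r) :≡ con (+ 4) :* (r :* r)) refl (+ r))))
    (ℤₚ.pos-* h h) (+≤+ (ℕₚ.*-mono-≤ 2r≤h 2r≤h))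
... | no 2r≰h = + 1 ℤ.+ q , + r ℤ.- + h ,
    trans (ℤDivMod.a≡a%ℕn+[a/ℕn]*n v h) (ℤ-solve 3 (λ r q h → r :+ q :* h :≡ (con (+ 1) :+ q) :* h :+ (r :- h)) refl (+ r) q (+ h)) , bound
  where
  q = v ℤDivMod./ℕ h
  r = v ℤDivMod.%ℕ h
  r≤h : r ℕ.≤ h
  r≤h = ℕₚ.<⇒≤ (ℤDivMod.n%ℕd<d v h)
  s = h ℕ.∸ r
  2s≤h : 2 ℕ.* s ℕ.≤ h
  2s≤h = ℕₚ.+-cancelˡ-≤ (2 ℕ.* r) _ _ (begin
    2 ℕ.* r ℕ.+ 2 ℕ.* s     ≡⟨ ℕₚ.*-distribˡ-+ 2 r s ⟨
    2 ℕ.* (r ℕ.+ s)         ≡⟨ cong (2 ℕ.*_) (ℕₚ.m+[n∸m]≡n r≤h) ⟩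
    h ℕ.+ (h ℕ.+ 0)         ≡⟨ cong (h ℕ.+_) (ℕₚ.+-identityʳ h) ⟩
    h ℕ.+ h                 ≤⟨ ℕₚ.+-monoˡ-≤ h (ℕₚ.<⇒≤ (ℕₚ.≰⇒> 2r≰h)) ⟩
    2 ℕ.* r ℕ.+ h           ∎)
    where open ℕₚ.≤-Reasoning
  t≡-s : + r ℤ.- + h ≡ ℤ.- + s
  t≡-s = trans (cong (λ u → + r ℤ.- + u) (sym (ℕₚ.m+[n∸m]≡n r≤h)))
    (trans (cong (λ u → + r ℤ.- u) (ℤₚ.pos-+ r s)) (ℤ-solve 2 (λ r s → r :- (r :+ s) :≡ :- s) refl (+ r) (+ s)))
  bound : + 4 ℤ.* ((+ r ℤ.- + h) ℤ.* (+ r ℤ.- + h)) ℤ.≤ + h ℤ.* + h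
  bound = subst₂ ℤ._≤_
    (trans (ℤₚ.pos-* (2 ℕ.* s) (2 ℕ.* s)) (trans (cong₂ ℤ._*_ (ℤₚ.pos-* 2 s) (ℤₚ.pos-* 2 s))
      (trans (ℤ-solve 1 (λ r → con (+ 2) :* r :* (con (+ 2) :* r) :≡ con (+ 4) :* ((:- r) :* (:- r))) refl (+ s)) (cong (λ u → + 4 ℤ.* (u ℤ.* u)) (sym t≡-s)))))
    (ℤₚ.pos-* h h) (+≤+ (ℕₚ.*-mono-≤ 2s≤h 2s≤h))

shift : Fin 3 → ℤ → ℤ
shift i h = + Fin.toℕ i ℤ.* h

-- The shifts of v by 0, h and 2h, reduced modulo 3h, leave the remainders
-- t, t + h and t - h in some order, where t is the remainder of v modulo h.
coverℤ : ∀ h .{{_ : ℕ.NonZero h}} v → Σ[ b ∈ (Fin 3 → ℤ) ] Σ[ w ∈ (Fin 3 → ℤ) ]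
  (∀ i → v ℤ.+ shift i (+ h) ≡ + 3 ℤ.* + h ℤ.* b i ℤ.+ w i) ×
  + 4 ℤ.* (w (# 0) ℤ.* w (# 0) ℤ.+ w (# 1) ℤ.* w (# 1) ℤ.+ w (# 2) ℤ.* w (# 2)) ℤ.≤ + 11 ℤ.* (+ h ℤ.* + h)
coverℤ h v with round h v
... | a , t , v≡ , 4t²≤h² = cases (a ℤDivMod.%ℕ 3) (ℤDivMod.n%ℕd<d a 3) (ℤDivMod.a≡a%ℕn+[a/ℕn]*n a 3)
  where
  q = a ℤDivMod./ℕ 3
  H = + h
  w : ℤ → ℤ
  w m = t ℤ.+ m ℤ.* H
  shifted : ∀ s c k m → a ≡ s ℤ.+ q ℤ.* + 3 → s ℤ.+ c ≡ + 3 ℤ.* k ℤ.+ m →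
            v ℤ.+ c ℤ.* H ≡ + 3 ℤ.* H ℤ.* (q ℤ.+ k) ℤ.+ w m
  shifted s c k m a≡ s+c≡ = begin
    v ℤ.+ c ℤ.* H                                  ≡⟨ cong (ℤ._+ c ℤ.* H) (trans v≡ (cong (λ u → u ℤ.* H ℤ.+ t) a≡)) ⟩
    (s ℤ.+ q ℤ.* + 3) ℤ.* H ℤ.+ t ℤ.+ c ℤ.* H      ≡⟨ ℤ-solve 5 (λ s q c h t → (s :+ q :* con (+ 3)) :* h :+ t :+ c :* h :≡ (s :+ c) :* h :+ q :* con (+ 3) :* h :+ t) refl s q c H t ⟩
    (s ℤ.+ c) ℤ.* H ℤ.+ q ℤ.* + 3 ℤ.* H ℤ.+ t      ≡⟨ cong (λ u → u ℤ.* H ℤ.+ q ℤ.* + 3 ℤ.* H ℤ.+ t) s+c≡ ⟩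
    (+ 3 ℤ.* k ℤ.+ m) ℤ.* H ℤ.+ q ℤ.* + 3 ℤ.* H ℤ.+ t  ≡⟨ ℤ-solve 5 (λ k m q h t → (con (+ 3) :* k :+ m) :* h :+ q :* con (+ 3) :* h :+ t :≡ con (+ 3) :* h :* (q :+ k) :+ (t :+ m :* h)) refl k m q H t ⟩
    + 3 ℤ.* H ℤ.* (q ℤ.+ k) ℤ.+ w m                ∎
    where open ≡-Reasoning
  -- `t² + (t + h)² + (t - h)² = 3 t² + 2 h²`, and `4 t² ≤ h²` bounds this by `11/4 h²`.
  bound : ∀ {S} → S ≡ + 3 ℤ.* (+ 4 ℤ.* (t ℤ.* t)) ℤ.+ + 8 ℤ.* (H ℤ.* H) → S ℤ.≤ + 11 ℤ.* (H ℤ.* H)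
  bound {S} eq = begin
    S                                                  ≡⟨ eq ⟩
    + 3 ℤ.* (+ 4 ℤ.* (t ℤ.* t)) ℤ.+ + 8 ℤ.* (H ℤ.* H)  ≤⟨ ℤₚ.+-monoˡ-≤ (+ 8 ℤ.* (H ℤ.* H)) (ℤₚ.*-monoˡ-≤-nonNeg (+ 3) 4t²≤h²) ⟩
    + 3 ℤ.* (H ℤ.* H) ℤ.+ + 8 ℤ.* (H ℤ.* H)            ≡⟨ ℤₚ.*-distribʳ-+ (H ℤ.* H) (+ 3) (+ 8) ⟨
    + 11 ℤ.* (H ℤ.* H)                                 ∎
    where open ℤₚ.≤-Reasoning
  squares : ℤ → ℤ → ℤ → Polynomial 2 → Polynomial 2 → Polynomial 2 × Polynomial 2
  squares l m n t h =
    con (+ 4) :* ((t :+ con l :* h) :* (t :+ con l :* h) :+ (t :+ con m :* h) :* (t :+ con m :* h) :+ (t :+ con n :* h) :* (t :+ con n :* h))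
      :≡ con (+ 3) :* (con (+ 4) :* (t :* t)) :+ con (+ 8) :* (h :* h)
  cases : ∀ s → s ℕ.< 3 → a ≡ + s ℤ.+ q ℤ.* + 3 → Σ[ b ∈ (Fin 3 → ℤ) ] Σ[ w ∈ (Fin 3 → ℤ) ]
    (∀ i → v ℤ.+ shift i H ≡ + 3 ℤ.* H ℤ.* b i ℤ.+ w i) ×
    + 4 ℤ.* (w (# 0) ℤ.* w (# 0) ℤ.+ w (# 1) ℤ.* w (# 1) ℤ.+ w (# 2) ℤ.* w (# 2)) ℤ.≤ + 11 ℤ.* (H ℤ.* H)
  -- For `a` of residue `s` modulo 3, the shift `c` leads to `s + c = 3 k + m` with `m` among -1, 0,
  -- 1. The two tables list `k` and `m` for `c = 0, 1, 2`.
  cases 0 _ a≡ =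
    (λ i → q ℤ.+ lookup (+ 0 ∷ + 0 ∷ + 1 ∷ []) i) ,
    (λ i → w (lookup (+ 0 ∷ + 1 ∷ -[1+ 0 ] ∷ []) i)) ,
    (λ { zero             → shifted (+ 0) (+ 0) (+ 0) (+ 0) a≡ refl
       ; (suc zero)       → shifted (+ 0) (+ 1) (+ 0) (+ 1) a≡ refl
       ; (suc (suc zero)) → shifted (+ 0) (+ 2) (+ 1) -[1+ 0 ] a≡ refl }) ,
    bound (ℤ-solve 2 (squares (+ 0) (+ 1) -[1+ 0 ]) refl t H)
  cases 1 _ a≡ =
    (λ i → q ℤ.+ lookup (+ 0 ∷ + 1 ∷ + 1 ∷ []) i) ,
    (λ i → w (lookup (+ 1 ∷ -[1+ 0 ] ∷ + 0 ∷ []) i)) ,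
    (λ { zero             → shifted (+ 1) (+ 0) (+ 0) (+ 1) a≡ refl
       ; (suc zero)       → shifted (+ 1) (+ 1) (+ 1) -[1+ 0 ] a≡ refl
       ; (suc (suc zero)) → shifted (+ 1) (+ 2) (+ 1) (+ 0) a≡ refl }) ,
    bound (ℤ-solve 2 (squares (+ 1) -[1+ 0 ] (+ 0)) refl t H)
  cases 2 _ a≡ =
    (λ i → q ℤ.+ lookup (+ 1 ∷ + 1 ∷ + 1 ∷ []) i) ,
    (λ i → w (lookup (-[1+ 0 ] ∷ + 0 ∷ + 1 ∷ []) i)) ,
    (λ { zero             → shifted (+ 2) (+ 0) (+ 1) -[1+ 0 ] a≡ refl
       ; (suc zero)       → shifted (+ 2) (+ 1) (+ 1) (+ 0) a≡ refl
       ; (suc (suc zero)) → shifted (+ 2) (+ 2) (+ 1) (+ 1) a≡ refl }) ,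
    bound (ℤ-solve 2 (squares -[1+ 0 ] (+ 0) (+ 1)) refl t H)
  cases (suc (suc (suc _))) (ℕ.s≤s (ℕ.s≤s (ℕ.s≤s ()))) _

coverVec : ∀ h .{{_ : ℕ.NonZero h}} {k} (v : Vec ℤ k) → Σ[ b ∈ (Fin 3 → Vec ℤ k) ] Σ[ w ∈ (Fin 3 → Vec ℤ k) ]
  (∀ i → map (ℤ._+ shift i (+ h)) v ≡ zipWith (λ b w → + 3 ℤ.* + h ℤ.* b ℤ.+ w) (b i) (w i)) ×
  + 4 ℤ.* (sumSq (w (# 0)) ℤ.+ sumSq (w (# 1)) ℤ.+ sumSq (w (# 2))) ℤ.≤ + k ℤ.* (+ 11 ℤ.* (+ h ℤ.* + h))
coverVec h []      = (λ _ → []) , (λ _ → []) , (λ _ → refl) , ℤₚ.≤-refl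
coverVec h {suc k} (v ∷ vs) with coverℤ h v | coverVec h vs
... | b , w , eq , le | bs , ws , eqs , les =
  (λ i → b i ∷ bs i) , (λ i → w i ∷ ws i) , (λ i → cong₂ _∷_ (eq i) (eqs i)) ,
  subst₂ ℤ._≤_
    (ℤ-solve 6 (λ x y z X Y Z → con (+ 4) :* (x :+ y :+ z) :+ con (+ 4) :* (X :+ Y :+ Z) :≡ con (+ 4) :* (x :+ X :+ (y :+ Y) :+ (z :+ Z))) refl
      (w (# 0) ℤ.* w (# 0)) (w (# 1) ℤ.* w (# 1)) (w (# 2) ℤ.* w (# 2)) (sumSq (ws (# 0))) (sumSq (ws (# 1))) (sumSq (ws (# 2))))
    (trans (cong (ℤ._+ + k ℤ.* B) (sym (ℤₚ.*-identityˡ B))) (sym (ℤₚ.*-distribʳ-+ B (+ 1) (+ k))))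
    (ℤₚ.+-mono-≤ le les)
  where B = + 11 ℤ.* (+ h ℤ.* + h)

minimum≤mean : ∀ (f : Fin 3 → ℤ) B → f (# 0) ℤ.+ f (# 1) ℤ.+ f (# 2) ℤ.≤ + 3 ℤ.* B → ∃[ i ] f i ℤ.≤ B
minimum≤mean f B le with f (# 0) ℤₚ.≤? B | f (# 1) ℤₚ.≤? B | f (# 2) ℤₚ.≤? B
... | yes p | _     | _     = _ , p
... | no _  | yes p | _     = _ , p
... | no _  | no _  | yes p = _ , p
... | no p  | no q  | no r  = contradiction le (ℤₚ.<⇒≱ (subst (ℤ._< f (# 0) ℤ.+ f (# 1) ℤ.+ f (# 2))
  (ℤ-solve 1 (λ b → b :+ b :+ b :≡ con (+ 3) :* b) refl B) (ℤₚ.+-mono-< (ℤₚ.+-mono-< (ℤₚ.≰⇒> p) (ℤₚ.≰⇒> q)) (ℤₚ.≰⇒> r))))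

-- As `1 + ω + … + ω⁶ = 0`, adding `c` to all seven coordinates does not change the element;
-- subtracting the seventh coordinate returns to the basis of `R`.
remainder-small : ∀ h .{{_ : ℕ.NonZero h}} c x (b w : Vec ℤ 7) →
  (∀ i → lookup (x ∷ʳ + 0) i ℤ.+ c ≡ + 3 ℤ.* + h ℤ.* lookup b i ℤ.+ lookup w i) →
  + 12 ℤ.* sumSq w ℤ.≤ + 77 ℤ.* (+ h ℤ.* + h) →
  ∃[ q ] ∃[ r ] x ≡ + 3 ℤ.* + h • q + r × τ r ℤ.< + 27 ℤ.* (+ h ℤ.* + h)
remainder-small h c (x₀ ∷ x₁ ∷ x₂ ∷ x₃ ∷ x₄ ∷ x₅ ∷ [])
  (b₀ ∷ b₁ ∷ b₂ ∷ b₃ ∷ b₄ ∷ b₅ ∷ b₆ ∷ []) W@(w₀ ∷ w₁ ∷ w₂ ∷ w₃ ∷ w₄ ∷ w₅ ∷ w₆ ∷ []) eq small =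
  q , r ,
  ≡R (coordinate x₀ b₀ w₀ (eq (# 0))) (coordinate x₁ b₁ w₁ (eq (# 1))) (coordinate x₂ b₂ w₂ (eq (# 2)))
     (coordinate x₃ b₃ w₃ (eq (# 3))) (coordinate x₄ b₄ w₄ (eq (# 4))) (coordinate x₅ b₅ w₅ (eq (# 5))) ,
  ℤₚ.*-cancelˡ-<-nonNeg (+ 24) bound
  where
  q r : R
  q = (b₀ ℤ.- b₆) ∷ (b₁ ℤ.- b₆) ∷ (b₂ ℤ.- b₆) ∷ (b₃ ℤ.- b₆) ∷ (b₄ ℤ.- b₆) ∷ (b₅ ℤ.- b₆) ∷ []
  r = (w₀ ℤ.- w₆) ∷ (w₁ ℤ.- w₆) ∷ (w₂ ℤ.- w₆) ∷ (w₃ ℤ.- w₆) ∷ (w₄ ℤ.- w₆) ∷ (w₅ ℤ.- w₆) ∷ []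
  H = + 3 ℤ.* + h
  coordinate : ∀ x b w → x ℤ.+ c ≡ H ℤ.* b ℤ.+ w → x ≡ H ℤ.* (b ℤ.- b₆) ℤ.+ (w ℤ.- w₆)
  coordinate x b w x+c≡ = begin
    x                                                ≡⟨ ℤ-solve 2 (λ x c → x :≡ (x :+ c) :- (con (+ 0) :+ c)) refl x c ⟩
    (x ℤ.+ c) ℤ.- (+ 0 ℤ.+ c)                        ≡⟨ cong₂ ℤ._-_ x+c≡ (eq (# 6)) ⟩
    (H ℤ.* b ℤ.+ w) ℤ.- (H ℤ.* b₆ ℤ.+ w₆)            ≡⟨ ℤ-solve 5 (λ h b w b₆ w₆ → (h :* b :+ w) :- (h :* b₆ :+ w₆) :≡ h :* (b :- b₆) :+ (w :- w₆)) refl H b w b₆ w₆ ⟩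
    H ℤ.* (b ℤ.- b₆) ℤ.+ (w ℤ.- w₆)                  ∎
    where open ≡-Reasoning
  2τ : + 2 ℤ.* τ r ≡ + 7 ℤ.* sumSq W ℤ.- sum W ℤ.* sum W
  -- On seven coordinates the form `7 Σ wᵢ² - (Σ wᵢ)²` is invariant under a common shift, so
  -- subtracting `w₆` may be undone.
  2τ = trans (τ-formula r) (ℤ-solve 7 (λ a b c d e f g →
    let u = (a :- g) ∷ (b :- g) ∷ (c :- g) ∷ (d :- g) ∷ (e :- g) ∷ (f :- g) ∷ []
        v = a ∷ b ∷ c ∷ d ∷ e ∷ f ∷ g ∷ []
    in con (+ 7) :* sumSqₚ u :- sumₚ u :* sumₚ u :≡ con (+ 7) :* sumSqₚ v :- sumₚ v :* sumₚ v) refl w₀ w₁ w₂ w₃ w₄ w₅ w₆)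
  bound : + 24 ℤ.* τ r ℤ.< + 24 ℤ.* (+ 27 ℤ.* (+ h ℤ.* + h))
  bound = begin-strict
    + 24 ℤ.* τ r                         ≡⟨ ℤₚ.*-assoc (+ 12) (+ 2) (τ r) ⟩
    + 12 ℤ.* (+ 2 ℤ.* τ r)               ≡⟨ cong (+ 12 ℤ.*_) 2τ ⟩
    + 12 ℤ.* (+ 7 ℤ.* sumSq W ℤ.- sum W ℤ.* sum W)   ≤⟨ ℤₚ.*-monoˡ-≤-nonNeg (+ 12) (ℤₚ.i≤j⇒i-k≤j (sum W ℤ.* sum W) {{ℤ.nonNegative (0≤square (sum W))}} ℤₚ.≤-refl) ⟩
    + 12 ℤ.* (+ 7 ℤ.* sumSq W)           ≡⟨ ℤ-solve 1 (λ s → con (+ 12) :* (con (+ 7) :* s) :≡ con (+ 7) :* (con (+ 12) :* s)) refl (sumSq W) ⟩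
    + 7 ℤ.* (+ 12 ℤ.* sumSq W)           ≤⟨ ℤₚ.*-monoˡ-≤-nonNeg (+ 7) small ⟩
    + 7 ℤ.* (+ 77 ℤ.* (+ h ℤ.* + h))     ≡⟨ ℤₚ.*-assoc (+ 7) (+ 77) (+ h ℤ.* + h) ⟨
    -- The covering yields `τ r ≤ 539/24 h²`, strictly below the required `27 h² = 648/24 h²`.
    + 539 ℤ.* (+ h ℤ.* + h)              <⟨ ℤₚ.*-monoʳ-<-pos (+ h ℤ.* + h) {{h²-positive}} {+ 539} {+ 648} (ℤ.+<+ (ℕₚ.m<m+n 539 (ℕ.s≤s z≤n))) ⟩
    + 648 ℤ.* (+ h ℤ.* + h)              ≡⟨ ℤₚ.*-assoc (+ 24) (+ 27) (+ h ℤ.* + h) ⟩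
    + 24 ℤ.* (+ 27 ℤ.* (+ h ℤ.* + h))    ∎
    where
    open ℤₚ.≤-Reasoning
    h²-positive : ℤ.Positive (+ h ℤ.* + h)
    h²-positive = ℤ.positive (subst (+ 0 ℤ.<_) (ℤₚ.pos-* h h) (ℤ.+<+ (ℕ.>-nonZero⁻¹ (h ℕ.* h) {{ℕₚ.m*n≢0 h h}})))

-- Lenstra's covering argument.  Coordinates with respect to 1, ω, …, ω⁶ may be
-- shifted simultaneously, and one of the three shifts leaves small remainders.
covering : ∀ h .{{_ : ℕ.NonZero h}} x → ∃[ q ] ∃[ r ] x ≡ + 3 ℤ.* + h • q + r × τ r ℤ.< + 27 ℤ.* (+ h ℤ.* + h)
covering h x = remainder-small h (shift i (+ h)) x (b i) (w i) coordinates (proj₂ best)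
  where
  cover = coverVec h (x ∷ʳ + 0)
  b w : Fin 3 → Vec ℤ 7
  b = proj₁ cover
  w = proj₁ (proj₂ cover)
  best : ∃[ i ] + 12 ℤ.* sumSq (w i) ℤ.≤ + 77 ℤ.* (+ h ℤ.* + h)
  -- Over the three shifts together the seven coordinates contribute at most `7 · 11/4 h²`; some
  -- shift takes at most a third of it, `77/12 h²`.
  best = minimum≤mean (λ i → + 12 ℤ.* sumSq (w i)) (+ 77 ℤ.* (+ h ℤ.* + h)) (subst₂ ℤ._≤_
    (ℤ-solve 3 (λ x y z → con (+ 3) :* (con (+ 4) :* (x :+ y :+ z)) :≡ con (+ 12) :* x :+ con (+ 12) :* y :+ con (+ 12) :* z) refl (sumSq (w (# 0))) (sumSq (w (# 1))) (sumSq (w (# 2))))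
    (ℤ-solve 1 (λ h² → con (+ 3) :* (con (+ 7) :* (con (+ 11) :* h²)) :≡ con (+ 3) :* (con (+ 77) :* h²)) refl (+ h ℤ.* + h))
    (ℤₚ.*-monoˡ-≤-nonNeg (+ 3) (proj₂ (proj₂ (proj₂ cover)))))
  i = proj₁ best
  coordinates : ∀ k → lookup (x ∷ʳ + 0) k ℤ.+ shift i (+ h) ≡ + 3 ℤ.* + h ℤ.* lookup (b i) k ℤ.+ lookup (w i) k
  coordinates k = trans (sym (Vecₚ.lookup-map k (ℤ._+ shift i (+ h)) (x ∷ʳ + 0)))
    (trans (cong (λ v → lookup v k) (proj₁ (proj₂ (proj₂ cover)) i)) (Vecₚ.lookup-zipWith _ k (b i) (w i)))

-- Moments modulo 7

infix 4 _∼_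

-- The quotient is explicit, so that matching on `by k refl` turns a statement about congruences
-- into a polynomial identity for the solver. `_≅_` does the same in `R`.
record _∼_ (x y : ℤ) : Set where
  constructor by
  field
    multiple : ℤ
    equation : x ≡ y ℤ.+ + 7 ℤ.* multiple

∼-refl : ∀ {x} → x ∼ x
∼-refl {x} = by (+ 0) (sym (ℤₚ.+-identityʳ x))

∼-sym : ∀ {x y} → x ∼ y → y ∼ x
∼-sym {_} {y} (by k refl) = by (ℤ.- k) (ℤ-solve 2 (λ y k → y :≡ y :+ con (+ 7) :* k :+ con (+ 7) :* (:- k)) refl y k)

∼-trans : ∀ {x y z} → x ∼ y → y ∼ z → x ∼ z
∼-trans {z = z} (by k refl) (by l refl) = by (l ℤ.+ k)
  (ℤ-solve 3 (λ z k l → z :+ con (+ 7) :* l :+ con (+ 7) :* k :≡ z :+ con (+ 7) :* (l :+ k)) refl z k l)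

+-cong-∼ : ∀ {x x′ y y′} → x ∼ x′ → y ∼ y′ → x ℤ.+ y ∼ x′ ℤ.+ y′
+-cong-∼ {x′ = x} {y′ = y} (by k refl) (by l refl) = by (k ℤ.+ l)
  (ℤ-solve 4 (λ x y k l → x :+ con (+ 7) :* k :+ (y :+ con (+ 7) :* l) :≡ x :+ y :+ con (+ 7) :* (k :+ l)) refl x y k l)

*-cong-∼ : ∀ {x x′ y y′} → x ∼ x′ → y ∼ y′ → x ℤ.* y ∼ x′ ℤ.* y′
*-cong-∼ {x′ = x} {y′ = y} (by k refl) (by l refl) = by (x ℤ.* l ℤ.+ k ℤ.* y ℤ.+ + 7 ℤ.* k ℤ.* l)
  (ℤ-solve 4 (λ x y k l → (x :+ con (+ 7) :* k) :* (y :+ con (+ 7) :* l) :≡ x :* y :+ con (+ 7) :* (x :* l :+ k :* y :+ con (+ 7) :* k :* l)) refl x y k l)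

*-congˡ-∼ : ∀ x {y y′} → y ∼ y′ → x ℤ.* y ∼ x ℤ.* y′
*-congˡ-∼ x = *-cong-∼ (∼-refl {x})

neg-cong-∼ : ∀ {x x′} → x ∼ x′ → ℤ.- x ∼ ℤ.- x′
neg-cong-∼ {x′ = x} (by k refl) = by (ℤ.- k)
  (ℤ-solve 2 (λ x k → :- (x :+ con (+ 7) :* k) :≡ (:- x) :+ con (+ 7) :* (:- k)) refl x k)

≡⇒∼ : ∀ {x y} → x ≡ y → x ∼ y
≡⇒∼ refl = ∼-refl

-- Tₖ (a₀ , a₁ , …) = Σ iᵏ aᵢ, which modulo 7 depends only on Σ aᵢ ωⁱ for k ≤ 3;
-- it is k! times the coefficient of Λᵏ.
T₀ T₁ T₂ T₃ : ∀ {n} → Vec ℤ n → ℤ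
T₀ = sum
T₁ []      = + 0
T₁ (a ∷ x) = T₀ x ℤ.+ T₁ x
T₂ []      = + 0
T₂ (a ∷ x) = T₀ x ℤ.+ + 2 ℤ.* T₁ x ℤ.+ T₂ x
T₃ []      = + 0
T₃ (a ∷ x) = T₀ x ℤ.+ + 3 ℤ.* T₁ x ℤ.+ + 3 ℤ.* T₂ x ℤ.+ T₃ x

record Additive {n} (T : Vec ℤ n → ℤ) : Set where
  field
    +-homo : ∀ x y → T (zipWith ℤ._+_ x y) ≡ T x ℤ.+ T y
    •-homo : ∀ k x → T (map (k ℤ.*_) x) ≡ k ℤ.* T x

open Additive

T₀-additive : ∀ {n} → Additive (T₀ {n})
T₀-additive = record { +-homo = add ; •-homo = mul }
  where
  add : ∀ {n} (x y : Vec ℤ n) → T₀ (zipWith ℤ._+_ x y) ≡ T₀ x ℤ.+ T₀ y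
  add []      []      = refl
  add (a ∷ x) (b ∷ y) = trans (cong (λ u → a ℤ.+ b ℤ.+ u) (add x y))
    (ℤ-solve 4 (λ a b s t → a :+ b :+ (s :+ t) :≡ a :+ s :+ (b :+ t)) refl a b (T₀ x) (T₀ y))
  mul : ∀ {n} k (x : Vec ℤ n) → T₀ (map (k ℤ.*_) x) ≡ k ℤ.* T₀ x
  mul k []      = sym (ℤₚ.*-zeroʳ k)
  mul k (a ∷ x) = trans (cong (λ u → k ℤ.* a ℤ.+ u) (mul k x)) (sym (ℤₚ.*-distribˡ-+ k a (T₀ x)))

T₁-additive : ∀ {n} → Additive (T₁ {n})
T₁-additive = record { +-homo = add ; •-homo = mul }
  where
  add : ∀ {n} (x y : Vec ℤ n) → T₁ (zipWith ℤ._+_ x y) ≡ T₁ x ℤ.+ T₁ y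
  add []      []      = refl
  add (a ∷ x) (b ∷ y) = trans (cong₂ ℤ._+_ (T₀-additive .+-homo x y) (add x y))
    (ℤ-solve 4 (λ a b s t → a :+ b :+ (s :+ t) :≡ a :+ s :+ (b :+ t)) refl (T₀ x) (T₀ y) (T₁ x) (T₁ y))
  mul : ∀ {n} k (x : Vec ℤ n) → T₁ (map (k ℤ.*_) x) ≡ k ℤ.* T₁ x
  mul k []      = sym (ℤₚ.*-zeroʳ k)
  mul k (a ∷ x) = trans (cong₂ ℤ._+_ (T₀-additive .•-homo k x) (mul k x)) (sym (ℤₚ.*-distribˡ-+ k (T₀ x) (T₁ x)))

T₂-additive : ∀ {n} → Additive (T₂ {n})
T₂-additive = record { +-homo = add ; •-homo = mul }
  where
  add : ∀ {n} (x y : Vec ℤ n) → T₂ (zipWith ℤ._+_ x y) ≡ T₂ x ℤ.+ T₂ y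
  add []      []      = refl
  add (a ∷ x) (b ∷ y) = trans (cong₂ ℤ._+_ (cong₂ (λ u v → u ℤ.+ + 2 ℤ.* v) (T₀-additive .+-homo x y) (T₁-additive .+-homo x y)) (add x y))
    (ℤ-solve 6 (λ a b c d s t → a :+ b :+ con (+ 2) :* (c :+ d) :+ (s :+ t) :≡ a :+ con (+ 2) :* c :+ s :+ (b :+ con (+ 2) :* d :+ t)) refl
      (T₀ x) (T₀ y) (T₁ x) (T₁ y) (T₂ x) (T₂ y))
  mul : ∀ {n} k (x : Vec ℤ n) → T₂ (map (k ℤ.*_) x) ≡ k ℤ.* T₂ x
  mul k []      = sym (ℤₚ.*-zeroʳ k)
  mul k (a ∷ x) = trans (cong₂ ℤ._+_ (cong₂ (λ u v → u ℤ.+ + 2 ℤ.* v) (T₀-additive .•-homo k x) (T₁-additive .•-homo k x)) (mul k x))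
    (ℤ-solve 4 (λ k a b c → k :* a :+ con (+ 2) :* (k :* b) :+ k :* c :≡ k :* (a :+ con (+ 2) :* b :+ c)) refl k (T₀ x) (T₁ x) (T₂ x))

T₃-additive : ∀ {n} → Additive (T₃ {n})
T₃-additive = record { +-homo = add ; •-homo = mul }
  where
  add : ∀ {n} (x y : Vec ℤ n) → T₃ (zipWith ℤ._+_ x y) ≡ T₃ x ℤ.+ T₃ y
  add []      []      = refl
  add (a ∷ x) (b ∷ y) = trans (cong₂ ℤ._+_ (cong₂ ℤ._+_ (cong₂ (λ u v → u ℤ.+ + 3 ℤ.* v) (T₀-additive .+-homo x y) (T₁-additive .+-homo x y)) (cong (λ u → + 3 ℤ.* u) (T₂-additive .+-homo x y))) (add x y))
    (ℤ-solve 8 (λ a b c d e f s t → a :+ b :+ con (+ 3) :* (c :+ d) :+ con (+ 3) :* (e :+ f) :+ (s :+ t) :≡ a :+ con (+ 3) :* c :+ con (+ 3) :* e :+ s :+ (b :+ con (+ 3) :* d :+ con (+ 3) :* f :+ t)) refl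
      (T₀ x) (T₀ y) (T₁ x) (T₁ y) (T₂ x) (T₂ y) (T₃ x) (T₃ y))
  mul : ∀ {n} k (x : Vec ℤ n) → T₃ (map (k ℤ.*_) x) ≡ k ℤ.* T₃ x
  mul k []      = sym (ℤₚ.*-zeroʳ k)
  mul k (a ∷ x) = trans (cong₂ ℤ._+_ (cong₂ ℤ._+_ (cong₂ (λ u v → u ℤ.+ + 3 ℤ.* v) (T₀-additive .•-homo k x) (T₁-additive .•-homo k x)) (cong (λ u → + 3 ℤ.* u) (T₂-additive .•-homo k x))) (mul k x))
    (ℤ-solve 5 (λ k a b c d → k :* a :+ con (+ 3) :* (k :* b) :+ con (+ 3) :* (k :* c) :+ k :* d :≡ k :* (a :+ con (+ 3) :* b :+ con (+ 3) :* c :+ d)) refl k (T₀ x) (T₁ x) (T₂ x) (T₃ x))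

-- Moving `aᵢ` to index `i + 1` produces the binomial expansion. Rewriting `a₅ ω⁶` by
-- `1 + ω + … + ω⁶ = 0` subtracts `a₅ Σ iᵏ` over `i ≤ 6`; for `k = 0, 1, 2, 3` these sums are 7, 21,
-- 91, 441, which explains the factors 1, 3, 13, 63 here and in the next three lemmas.
T₀-ω· : ∀ z → T₀ (ω· z) ∼ T₀ z
T₀-ω· z@(_ ∷ _ ∷ _ ∷ _ ∷ _ ∷ f ∷ []) = by (ℤ.- f)
  (Symbolic.scalar z (sumₚ (ω·ₚ generic)) (sumₚ generic :+ con (+ 7) :* (:- lookup generic (# 5))) refl)

T₁ₚ T₂ₚ T₃ₚ : ∀ {n k} → Vec (Polynomial k) n → Polynomial k
T₁ₚ []      = con (+ 0)
T₁ₚ (a ∷ x) = sumₚ x :+ T₁ₚ x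
T₂ₚ []      = con (+ 0)
T₂ₚ (a ∷ x) = sumₚ x :+ con (+ 2) :* T₁ₚ x :+ T₂ₚ x
T₃ₚ []      = con (+ 0)
T₃ₚ (a ∷ x) = sumₚ x :+ con (+ 3) :* T₁ₚ x :+ con (+ 3) :* T₂ₚ x :+ T₃ₚ x

T₁-ω· : ∀ z → T₁ (ω· z) ∼ T₀ z ℤ.+ T₁ z
T₁-ω· z@(_ ∷ _ ∷ _ ∷ _ ∷ _ ∷ f ∷ []) = by (ℤ.- + 3 ℤ.* f)
  (Symbolic.scalar z (T₁ₚ (ω·ₚ generic)) (sumₚ generic :+ T₁ₚ generic :+ con (+ 7) :* (con (ℤ.- + 3) :* lookup generic (# 5))) refl)

T₂-ω· : ∀ z → T₂ (ω· z) ∼ T₀ z ℤ.+ + 2 ℤ.* T₁ z ℤ.+ T₂ z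
T₂-ω· z@(_ ∷ _ ∷ _ ∷ _ ∷ _ ∷ f ∷ []) = by (ℤ.- + 13 ℤ.* f)
  (Symbolic.scalar z (T₂ₚ (ω·ₚ generic)) (sumₚ generic :+ con (+ 2) :* T₁ₚ generic :+ T₂ₚ generic :+ con (+ 7) :* (con (ℤ.- + 13) :* lookup generic (# 5))) refl)

T₃-ω· : ∀ z → T₃ (ω· z) ∼ T₀ z ℤ.+ + 3 ℤ.* T₁ z ℤ.+ + 3 ℤ.* T₂ z ℤ.+ T₃ z
T₃-ω· z@(_ ∷ _ ∷ _ ∷ _ ∷ _ ∷ f ∷ []) = by (ℤ.- + 63 ℤ.* f)
  (Symbolic.scalar z (T₃ₚ (ω·ₚ generic)) (sumₚ generic :+ con (+ 3) :* T₁ₚ generic :+ con (+ 3) :* T₂ₚ generic :+ T₃ₚ generic :+ con (+ 7) :* (con (ℤ.- + 63) :* lookup generic (# 5))) refl)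

horner-step : ∀ {T : R → ℤ} → Additive T → ∀ {L} a y z → T (ω· z) ∼ L → T (a • y + ω· z) ∼ a ℤ.* T y ℤ.+ L
horner-step {T} add a y z le = ∼-trans
  (≡⇒∼ (trans (add .+-homo (a • y) (ω· z)) (cong (λ u → u ℤ.+ T (ω· z)) (add .•-homo a y))))
  (+-cong-∼ (∼-refl {a ℤ.* T y}) le)

-- The moments are the values at 1 of the iterates of the derivation `x d/dx` on polynomials, so
-- this and the next three lemmas are the Leibniz rule. Well-definedness modulo `1 + ω + … + ω⁶`
-- enters through the lemmas on `ω·`.
T₀-horner : ∀ {n} (x : Vec ℤ n) y → T₀ (horner ω· x y) ∼ T₀ x ℤ.* T₀ y
T₀-horner []      y = ∼-refl
T₀-horner (a ∷ x) y = ∼-trans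
  (horner-step T₀-additive a y (horner ω· x y) (∼-trans (T₀-ω· (horner ω· x y)) (T₀-horner x y)))
  (≡⇒∼ (sym (ℤₚ.*-distribʳ-+ (T₀ y) a (T₀ x))))

T₁-horner : ∀ {n} (x : Vec ℤ n) y → T₁ (horner ω· x y) ∼ T₀ x ℤ.* T₁ y ℤ.+ T₁ x ℤ.* T₀ y
T₁-horner []      y = ∼-refl
T₁-horner (a ∷ x) y = ∼-trans
  (horner-step T₁-additive a y (horner ω· x y) (∼-trans (T₁-ω· (horner ω· x y)) (+-cong-∼ (T₀-horner x y) (T₁-horner x y))))
  (≡⇒∼ (ℤ-solve 5 (λ a x₀ x₁ y₀ y₁ → a :* y₁ :+ (x₀ :* y₀ :+ (x₀ :* y₁ :+ x₁ :* y₀)) :≡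
    (a :+ x₀) :* y₁ :+ (x₀ :+ x₁) :* y₀) refl a (T₀ x) (T₁ x) (T₀ y) (T₁ y)))

T₂-horner : ∀ {n} (x : Vec ℤ n) y →
  T₂ (horner ω· x y) ∼ T₀ x ℤ.* T₂ y ℤ.+ + 2 ℤ.* T₁ x ℤ.* T₁ y ℤ.+ T₂ x ℤ.* T₀ y
T₂-horner []      y = ∼-refl
T₂-horner (a ∷ x) y = ∼-trans
  (horner-step T₂-additive a y (horner ω· x y) (∼-trans (T₂-ω· (horner ω· x y))
    (+-cong-∼ (+-cong-∼ (T₀-horner x y) (*-congˡ-∼ (+ 2) (T₁-horner x y))) (T₂-horner x y))))
  (≡⇒∼ (ℤ-solve 7 (λ a x₀ x₁ x₂ y₀ y₁ y₂ →
    a :* y₂ :+ (x₀ :* y₀ :+ con (+ 2) :* (x₀ :* y₁ :+ x₁ :* y₀) :+ (x₀ :* y₂ :+ con (+ 2) :* x₁ :* y₁ :+ x₂ :* y₀)) :≡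
    (a :+ x₀) :* y₂ :+ con (+ 2) :* (x₀ :+ x₁) :* y₁ :+ (x₀ :+ con (+ 2) :* x₁ :+ x₂) :* y₀) refl
    a (T₀ x) (T₁ x) (T₂ x) (T₀ y) (T₁ y) (T₂ y)))

T₃-horner : ∀ {n} (x : Vec ℤ n) y →
  T₃ (horner ω· x y) ∼ T₀ x ℤ.* T₃ y ℤ.+ + 3 ℤ.* T₁ x ℤ.* T₂ y ℤ.+ + 3 ℤ.* T₂ x ℤ.* T₁ y ℤ.+ T₃ x ℤ.* T₀ y
T₃-horner []      y = ∼-refl
T₃-horner (a ∷ x) y = ∼-trans
  (horner-step T₃-additive a y (horner ω· x y) (∼-trans (T₃-ω· (horner ω· x y))
    (+-cong-∼ (+-cong-∼ (+-cong-∼ (T₀-horner x y) (*-congˡ-∼ (+ 3) (T₁-horner x y))) (*-congˡ-∼ (+ 3) (T₂-horner x y))) (T₃-horner x y))))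
  (≡⇒∼ (ℤ-solve 9 (λ a x₀ x₁ x₂ x₃ y₀ y₁ y₂ y₃ →
    a :* y₃ :+ (x₀ :* y₀ :+ con (+ 3) :* (x₀ :* y₁ :+ x₁ :* y₀) :+ con (+ 3) :* (x₀ :* y₂ :+ con (+ 2) :* x₁ :* y₁ :+ x₂ :* y₀)
      :+ (x₀ :* y₃ :+ con (+ 3) :* x₁ :* y₂ :+ con (+ 3) :* x₂ :* y₁ :+ x₃ :* y₀)) :≡
    (a :+ x₀) :* y₃ :+ con (+ 3) :* (x₀ :+ x₁) :* y₂ :+ con (+ 3) :* (x₀ :+ con (+ 2) :* x₁ :+ x₂) :* y₁
      :+ (x₀ :+ con (+ 3) :* x₁ :+ con (+ 3) :* x₂ :+ x₃) :* y₀) refl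
    a (T₀ x) (T₁ x) (T₂ x) (T₃ x) (T₀ y) (T₁ y) (T₂ y) (T₃ y)))

T₀-* : ∀ x y → T₀ (x * y) ∼ T₀ x ℤ.* T₀ y
T₀-* x y = subst (λ u → T₀ u ∼ T₀ x ℤ.* T₀ y) (sym (*-horner x y)) (T₀-horner x y)

T₁-* : ∀ x y → T₁ (x * y) ∼ T₀ x ℤ.* T₁ y ℤ.+ T₁ x ℤ.* T₀ y
T₁-* x y = subst (λ u → T₁ u ∼ T₀ x ℤ.* T₁ y ℤ.+ T₁ x ℤ.* T₀ y) (sym (*-horner x y)) (T₁-horner x y)

T₂-* : ∀ x y → T₂ (x * y) ∼ T₀ x ℤ.* T₂ y ℤ.+ + 2 ℤ.* T₁ x ℤ.* T₁ y ℤ.+ T₂ x ℤ.* T₀ y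
T₂-* x y = subst (λ u → T₂ u ∼ T₀ x ℤ.* T₂ y ℤ.+ + 2 ℤ.* T₁ x ℤ.* T₁ y ℤ.+ T₂ x ℤ.* T₀ y) (sym (*-horner x y)) (T₂-horner x y)

T₃-* : ∀ x y → T₃ (x * y) ∼ T₀ x ℤ.* T₃ y ℤ.+ + 3 ℤ.* T₁ x ℤ.* T₂ y ℤ.+ + 3 ℤ.* T₂ x ℤ.* T₁ y ℤ.+ T₃ x ℤ.* T₀ y
T₃-* x y = subst (λ u → T₃ u ∼ T₀ x ℤ.* T₃ y ℤ.+ + 3 ℤ.* T₁ x ℤ.* T₂ y ℤ.+ + 3 ℤ.* T₂ x ℤ.* T₁ y ℤ.+ T₃ x ℤ.* T₀ y) (sym (*-horner x y)) (T₃-horner x y)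

cumulant : ℤ → ℤ → ℤ → ℤ → ℤ
cumulant t₀ t₁ t₂ t₃ = t₀ ℤ.* t₀ ℤ.* t₃ ℤ.+ (ℤ.- + 3) ℤ.* t₀ ℤ.* t₁ ℤ.* t₂ ℤ.+ + 2 ℤ.* t₁ ℤ.* t₁ ℤ.* t₁

-- T₀³ times the third cumulant; the cumulants are additive on products because
-- they are the coefficients of log (Σ Tₖ Λᵏ / k!).
κ₃ : R → ℤ
κ₃ x = cumulant (T₀ x) (T₁ x) (T₂ x) (T₃ x)

cumulant-cong : ∀ {a b c d a′ b′ c′ d′} → a ∼ a′ → b ∼ b′ → c ∼ c′ → d ∼ d′ → cumulant a b c d ∼ cumulant a′ b′ c′ d′
cumulant-cong a b c d = +-cong-∼
  (+-cong-∼ (*-cong-∼ (*-cong-∼ a a) d) (*-cong-∼ (*-cong-∼ (*-congˡ-∼ (ℤ.- + 3) a) b) c))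
  (*-cong-∼ (*-cong-∼ (*-congˡ-∼ (+ 2) b) b) b)

cube : ℤ → ℤ
cube a = a ℤ.* a ℤ.* a

κ₃-* : ∀ x y → κ₃ (x * y) ∼ cube (T₀ y) ℤ.* κ₃ x ℤ.+ cube (T₀ x) ℤ.* κ₃ y
κ₃-* x y = ∼-trans (cumulant-cong (T₀-* x y) (T₁-* x y) (T₂-* x y) (T₃-* x y))
  (≡⇒∼ (ℤ-solve 8 (λ x₀ x₁ x₂ x₃ y₀ y₁ y₂ y₃ →
    cumulantₚ (x₀ :* y₀) (x₀ :* y₁ :+ x₁ :* y₀) (x₀ :* y₂ :+ con (+ 2) :* x₁ :* y₁ :+ x₂ :* y₀)
      (x₀ :* y₃ :+ con (+ 3) :* x₁ :* y₂ :+ con (+ 3) :* x₂ :* y₁ :+ x₃ :* y₀) :≡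
    (y₀ :* y₀ :* y₀) :* cumulantₚ x₀ x₁ x₂ x₃ :+ (x₀ :* x₀ :* x₀) :* cumulantₚ y₀ y₁ y₂ y₃) refl
    (T₀ x) (T₁ x) (T₂ x) (T₃ x) (T₀ y) (T₁ y) (T₂ y) (T₃ y)))
  where
  cumulantₚ : Polynomial 8 → Polynomial 8 → Polynomial 8 → Polynomial 8 → Polynomial 8
  cumulantₚ t₀ t₁ t₂ t₃ = t₀ :* t₀ :* t₃ :+ con (ℤ.- + 3) :* t₀ :* t₁ :* t₂ :+ con (+ 2) :* t₁ :* t₁ :* t₁

∼0⇒≡ : ∀ {x} (p : x ∼ + 0) → x ≡ + 7 ℤ.* _∼_.multiple p
∼0⇒≡ (by k eq) = trans eq (ℤₚ.+-identityˡ (+ 7 ℤ.* k))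

∼0⇒∣ : ∀ {x} → x ∼ + 0 → 7 ℕDiv.∣ ∣ x ∣
∼0⇒∣ p@(by k _) = ℕDiv.divides ∣ k ∣ (trans (cong ∣_∣ (∼0⇒≡ p)) (trans (ℤₚ.abs-* (+ 7) k) (ℕₚ.*-comm 7 ∣ k ∣)))

∣⇒∼0 : ∀ {x} → 7 ℕDiv.∣ ∣ x ∣ → x ∼ + 0
∣⇒∼0 {x} 7∣x with Signed.∣ᵤ⇒∣ {+ 7} {x} 7∣x
... | Signed.divides q eq = by q (trans eq (trans (ℤₚ.*-comm q (+ 7)) (sym (ℤₚ.+-identityˡ (+ 7 ℤ.* q)))))

prime₇ : Prime 7
prime₇ = from-yes (prime? 7)

∼0-* : ∀ x y → x ℤ.* y ∼ + 0 → x ∼ + 0 ⊎ y ∼ + 0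
∼0-* x y xy∼0 with euclidsLemma ∣ x ∣ ∣ y ∣ prime₇ (subst (7 ℕDiv.∣_) (ℤₚ.abs-* x y) (∼0⇒∣ xy∼0))
... | inj₁ p = inj₁ (∣⇒∼0 p)
... | inj₂ p = inj₂ (∣⇒∼0 p)

∼0-square : ∀ x → x ℤ.* x ∼ + 0 → x ∼ + 0
∼0-square x = [ id , id ]′ ∘ ∼0-* x x

-- The totally ramified prime `π` above 7

quotπ : R → R
quotπ (a₀ ∷ a₁ ∷ a₂ ∷ a₃ ∷ a₄ ∷ a₅ ∷ []) =
  ℤ.- (a₁ ℤ.+ (a₂ ℤ.+ (a₃ ℤ.+ (a₄ ℤ.+ a₅)))) ∷ ℤ.- (a₂ ℤ.+ (a₃ ℤ.+ (a₄ ℤ.+ a₅))) ∷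
  ℤ.- (a₃ ℤ.+ (a₄ ℤ.+ a₅)) ∷ ℤ.- (a₄ ℤ.+ a₅) ∷ ℤ.- a₅ ∷ + 0 ∷ []

-- `ωⁱ - 1 = -π (1 + … + ωⁱ⁻¹)`, so the coefficient of `ωᵏ` in the quotient is minus the sum of the
-- `aᵢ` with `i > k`. Hence `T₀` is reduction modulo `π`.
π-division : ∀ x → x - ι (T₀ x) ≡ π * quotπ x
π-division x@(_ ∷ _ ∷ _ ∷ _ ∷ _ ∷ _ ∷ []) = trans
  (Symbolic.coordinatewise x (zipWith _:-_ generic (sumₚ generic ∷ replicate 5 (con (+ 0))))
    (hornerₚ ω·ₚ (con (+ 1) ∷ con (ℤ.- + 1) ∷ con (+ 0) ∷ con (+ 0) ∷ con (+ 0) ∷ con (+ 0) ∷ []) (quotₚ generic)) refl)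
  (sym (*-horner π (quotπ x)))
  where
  quotₚ : Symbolic.Poly → Symbolic.Poly
  quotₚ (a₀ ∷ a₁ ∷ a₂ ∷ a₃ ∷ a₄ ∷ a₅ ∷ []) =
    :- (a₁ :+ (a₂ :+ (a₃ :+ (a₄ :+ a₅)))) ∷ :- (a₂ :+ (a₃ :+ (a₄ :+ a₅))) ∷
    :- (a₃ :+ (a₄ :+ a₅)) ∷ :- (a₄ :+ a₅) ∷ :- a₅ ∷ con (+ 0) ∷ []

opaque
  unfolding _*_

  ∣π∣² : ∣ π ∣² ≡ (+ 3 ∷ + 0 ∷ + 1 ∷ + 1 ∷ + 1 ∷ + 1 ∷ [])
  ∣π∣² = refl

  -- The factors are `∣ π ∣² = 2 - ω - ω⁶` and its conjugate `2 - ω² - ω⁵`; the next lemma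
  -- multiplies by the third conjugate, `2 - ω³ - ω⁴`.
  θσθ : (+ 3 ∷ + 0 ∷ + 1 ∷ + 1 ∷ + 1 ∷ + 1 ∷ []) * (+ 2 ∷ + 0 ∷ ℤ.- + 1 ∷ + 0 ∷ + 0 ∷ ℤ.- + 1 ∷ []) ≡ (+ 5 ∷ + 0 ∷ ℤ.- + 1 ∷ + 2 ∷ + 2 ∷ ℤ.- + 1 ∷ [])
  θσθ = refl

  θσθσσθ : (+ 5 ∷ + 0 ∷ ℤ.- + 1 ∷ + 2 ∷ + 2 ∷ ℤ.- + 1 ∷ []) * (+ 2 ∷ + 0 ∷ + 0 ∷ ℤ.- + 1 ∷ ℤ.- + 1 ∷ + 0 ∷ []) ≡ ι (+ 7)
  θσθσσθ = refl

  -- 7 = (1 - ω) Σⱼ (6 - j) ωʲ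
  π∣7 : ι (+ 7) ≡ π * (+ 6 ∷ + 5 ∷ + 4 ∷ + 3 ∷ + 2 ∷ + 1 ∷ [])
  π∣7 = refl

  π² : π * π ≡ (+ 1 ∷ ℤ.- + 2 ∷ + 1 ∷ + 0 ∷ + 0 ∷ + 0 ∷ [])
  π² = refl

  π³ : π * (+ 1 ∷ ℤ.- + 2 ∷ + 1 ∷ + 0 ∷ + 0 ∷ + 0 ∷ []) ≡ (+ 1 ∷ ℤ.- + 3 ∷ + 3 ∷ ℤ.- + 1 ∷ + 0 ∷ + 0 ∷ [])
  π³ = refl

  π⁴ : π * (+ 1 ∷ ℤ.- + 3 ∷ + 3 ∷ ℤ.- + 1 ∷ + 0 ∷ + 0 ∷ []) ≡ (+ 1 ∷ ℤ.- + 4 ∷ + 6 ∷ ℤ.- + 4 ∷ + 1 ∷ + 0 ∷ [])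
  π⁴ = refl

  π⁵ : π * (+ 1 ∷ ℤ.- + 4 ∷ + 6 ∷ ℤ.- + 4 ∷ + 1 ∷ + 0 ∷ []) ≡ (+ 1 ∷ ℤ.- + 5 ∷ + 10 ∷ ℤ.- + 10 ∷ + 5 ∷ ℤ.- + 1 ∷ [])
  π⁵ = refl

  π⁶ : π * (+ 1 ∷ ℤ.- + 5 ∷ + 10 ∷ ℤ.- + 10 ∷ + 5 ∷ ℤ.- + 1 ∷ []) ≡ ι (+ 7) * (+ 0 ∷ ℤ.- + 1 ∷ + 2 ∷ ℤ.- + 3 ∷ + 2 ∷ ℤ.- + 1 ∷ [])
  π⁶ = refl

Nm-π : Nm π ≡ + 7
Nm-π = cong head (begin
  norm₃ ∣ π ∣²        ≡⟨ cong norm₃ ∣π∣² ⟩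
  (+ 3 ∷ + 0 ∷ + 1 ∷ + 1 ∷ + 1 ∷ + 1 ∷ []) * (+ 2 ∷ + 0 ∷ ℤ.- + 1 ∷ + 0 ∷ + 0 ∷ ℤ.- + 1 ∷ []) * (+ 2 ∷ + 0 ∷ + 0 ∷ ℤ.- + 1 ∷ ℤ.- + 1 ∷ + 0 ∷ [])        ≡⟨ cong (λ u → u * (+ 2 ∷ + 0 ∷ + 0 ∷ ℤ.- + 1 ∷ ℤ.- + 1 ∷ + 0 ∷ [])) θσθ ⟩
  (+ 5 ∷ + 0 ∷ ℤ.- + 1 ∷ + 2 ∷ + 2 ∷ ℤ.- + 1 ∷ []) * (+ 2 ∷ + 0 ∷ + 0 ∷ ℤ.- + 1 ∷ ℤ.- + 1 ∷ + 0 ∷ [])             ≡⟨ θσθσσθ ⟩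
  ι (+ 7)             ∎)
  where open ≡-Reasoning

7∣π⁶ : fold 1R (λ u → π * u) 6 ≡ ι (+ 7) * (+ 0 ∷ ℤ.- + 1 ∷ + 2 ∷ ℤ.- + 3 ∷ + 2 ∷ ℤ.- + 1 ∷ [])
7∣π⁶ = trans (cong (λ u → π * (π * (π * (π * (π * u))))) (*-identityʳ π))
  (trans (cong (λ u → π * (π * (π * (π * u)))) π²) (trans (cong (λ u → π * (π * (π * u))) π³)
  (trans (cong (λ u → π * (π * u)) π⁴) (trans (cong (λ u → π * u) π⁵) π⁶))))

x-y≡z⇒x≡z+y : ∀ {x y z} → x - y ≡ z → x ≡ z + y
x-y≡z⇒x≡z+y {x} {y} {z} eq = begin
  x               ≡⟨ solve 2 (λ x y → x := (x ⊖ y) ⊕ y) refl x y ⟩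
  (x + − y) + y   ≡⟨ cong (λ u → u + y) (trans (sym (sub-def x y)) eq) ⟩
  z + y           ∎
  where open ≡-Reasoning

∼0⇒π∣ : ∀ {x} → T₀ x ∼ + 0 → ∃[ y ] x ≡ π * y
∼0⇒π∣ {x} p@(by k _) = quotπ x + ι k * c , (begin
  x                             ≡⟨ x-y≡z⇒x≡z+y (π-division x) ⟩
  π * quotπ x + ι (T₀ x)        ≡⟨ cong (λ u → π * quotπ x + u) (trans (cong ι (∼0⇒≡ p)) (ι-*-homo (+ 7) k)) ⟩
  π * quotπ x + ι (+ 7) * ι k   ≡⟨ cong (λ u → π * quotπ x + u * ι k) π∣7 ⟩
  π * quotπ x + π * c * ι k     ≡⟨ solve 4 (λ p q c k → p ⊛ q ⊕ p ⊛ c ⊛ k := p ⊛ (q ⊕ k ⊛ c)) refl π (quotπ x) c (ι k) ⟩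
  π * (quotπ x + ι k * c)       ∎)
  where
  open ≡-Reasoning
  c : R
  c = + 6 ∷ + 5 ∷ + 4 ∷ + 3 ∷ + 2 ∷ + 1 ∷ []

T₀-σ : ∀ x → T₀ (σ x) ∼ T₀ x
T₀-σ x@(_ ∷ _ ∷ _ ∷ a₃ ∷ _ ∷ _ ∷ []) = by (ℤ.- a₃)
  (Symbolic.scalar x (sumₚ (σₚ generic)) (sumₚ generic :+ con (+ 7) :* (:- lookup generic (# 3))) refl)

T₀-bar : ∀ x → T₀ (bar x) ∼ T₀ x
T₀-bar x@(_ ∷ a₁ ∷ _ ∷ _ ∷ _ ∷ _ ∷ []) = by (ℤ.- a₁)
  (Symbolic.scalar x (sumₚ (barₚ generic)) (sumₚ generic :+ con (+ 7) :* (:- lookup generic (# 1))) refl)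

-- Total ramification: conjugation acts trivially on the residue field of `π`, so each of the six
-- conjugates contributes a factor `T₀ x`.
Nm∼T₀⁶ : ∀ x → Nm x ∼ T₀ x ⁶
Nm∼T₀⁶ x = ∼-trans (≡⇒∼ (sym (trans (cong T₀ (norm₃-∣∣² x)) (ℤₚ.+-identityʳ (Nm x)))))
  (∼-trans (T₀-* (∣ x ∣² * σ ∣ x ∣²) (σ (σ ∣ x ∣²)))
    (*-cong-∼ (∼-trans (T₀-* ∣ x ∣² (σ ∣ x ∣²)) (*-cong-∼ sq (∼-trans (T₀-σ ∣ x ∣²) sq))) (∼-trans (T₀-σ (σ ∣ x ∣²)) (∼-trans (T₀-σ ∣ x ∣²) sq))))
  where
  sq : T₀ ∣ x ∣² ∼ T₀ x ℤ.* T₀ x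
  sq = ∼-trans (T₀-* x (bar x)) (*-congˡ-∼ (T₀ x) (T₀-bar x))

-- Norm 0 forces `T₀ x` to vanish modulo 7, which gives divisibility by `π`; since `Nm π = 7` is not
-- 0, the quotient inherits norm 0.
Nm≡0⇒π∣ : ∀ {x} → Nm x ≡ + 0 → ∃[ y ] x ≡ π * y × Nm y ≡ + 0
Nm≡0⇒π∣ {x} eq = proj₁ div , proj₂ div , ([ (λ ()) , id ]′ (ℤₚ.i*j≡0⇒i≡0∨j≡0 (+ 7) Nm≡0))
  where
  a = T₀ x ℤ.* T₀ x
  a∼0 : a ∼ + 0
  a∼0 = [ ∼0-square a , id ]′ (∼0-* (a ℤ.* a) a (∼-trans (∼-sym (Nm∼T₀⁶ x)) (≡⇒∼ eq)))
  div = ∼0⇒π∣ (∼0-square (T₀ x) a∼0)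
  Nm≡0 : + 7 ℤ.* Nm (proj₁ div) ≡ + 0
  Nm≡0 = trans (cong (λ u → u ℤ.* Nm (proj₁ div)) (sym Nm-π)) (trans (sym (Nm-* π (proj₁ div))) (trans (cong Nm (sym (proj₂ div))) eq))

Nm≡0⇒π^∣ : ∀ k {x} → Nm x ≡ + 0 → ∃[ y ] x ≡ fold y (λ u → π * u) k × Nm y ≡ + 0
Nm≡0⇒π^∣ zero    eq = _ , refl , eq
Nm≡0⇒π^∣ (suc k) eq =
  let y , x≡ , eq′ = Nm≡0⇒π∣ eq
      z , y≡ , eq″ = Nm≡0⇒π^∣ k eq′
  in z , trans x≡ (cong (λ u → π * u) y≡) , eq″

fold-* : ∀ p y k → fold y (λ u → p * u) k ≡ fold 1R (λ u → p * u) k * y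
fold-* p y zero    = sym (trans (*-comm 1R y) (*-identityʳ y))
fold-* p y (suc k) = trans (cong (λ u → p * u) (fold-* p y k)) (sym (*-assoc p _ y))

Nm≡0⇒7∣ : ∀ {x} → Nm x ≡ + 0 → ∃[ y ] x ≡ + 7 • y × Nm y ≡ + 0
Nm≡0⇒7∣ {x} eq = step (Nm≡0⇒π^∣ 6 eq)
  where
  c : R
  c = + 0 ∷ ℤ.- + 1 ∷ + 2 ∷ ℤ.- + 3 ∷ + 2 ∷ ℤ.- + 1 ∷ []
  step : ∃[ y ] x ≡ fold y (λ u → π * u) 6 × Nm y ≡ + 0 → ∃[ y ] x ≡ + 7 • y × Nm y ≡ + 0
  step (y , x≡ , eq′) = c * y , (begin
    x                                 ≡⟨ x≡ ⟩
    fold y (λ u → π * u) 6            ≡⟨ fold-* π y 6 ⟩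
    fold 1R (λ u → π * u) 6 * y       ≡⟨ cong (λ u → u * y) 7∣π⁶ ⟩
    ι (+ 7) * c * y                   ≡⟨ *-assoc (ι (+ 7)) c y ⟩
    ι (+ 7) * (c * y)                 ≡⟨ ι-* (+ 7) (c * y) ⟩
    + 7 • (c * y)                     ∎) ,
    trans (Nm-* c y) (trans (cong (λ u → Nm c ℤ.* u) eq′) (ℤₚ.*-zeroʳ (Nm c)))
    where open ≡-Reasoning

sumSq-• : ∀ {n} k (x : Vec ℤ n) → sumSq (map (k ℤ.*_) x) ≡ k ℤ.* k ℤ.* sumSq x
sumSq-• k []      = sym (ℤₚ.*-zeroʳ (k ℤ.* k))
sumSq-• k (a ∷ x) = trans (cong (λ u → k ℤ.* a ℤ.* (k ℤ.* a) ℤ.+ u) (sumSq-• k x))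
  (ℤ-solve 3 (λ k a s → k :* a :* (k :* a) :+ k :* k :* s :≡ k :* k :* (a :* a :+ s)) refl k a (sumSq x))

sumSq-•-< : ∀ (y : R) → ∣ sumSq y ∣ ≢ 0 → ∣ sumSq y ∣ ℕ.< ∣ sumSq (+ 7 • y) ∣
sumSq-•-< y y≢0 = subst (∣ sumSq y ∣ ℕ.<_)
  (trans (ℕₚ.*-comm ∣ sumSq y ∣ 49) (trans (sym (ℤₚ.abs-* (+ 49) (sumSq y))) (cong ∣_∣ (sym (sumSq-• (+ 7) y)))))
  (ℕₚ.m<m*n ∣ sumSq y ∣ 49 {{ℕ.≢-nonZero y≢0}} (s≤s (s≤s z≤n)))

-- Infinite descent: a null vector of the norm is divisible by 7, with null quotient.
Nm-definite : ∀ x → Nm x ≡ + 0 → x ≡ 0R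
Nm-definite x = descend (suc ∣ sumSq x ∣) x ℕₚ.≤-refl
  where
  descend : ∀ fuel x → ∣ sumSq x ∣ ℕ.< fuel → Nm x ≡ + 0 → x ≡ 0R
  step : ∀ fuel x → ∣ sumSq x ∣ ℕ.≤ fuel → ∀ y → x ≡ + 7 • y → Nm y ≡ + 0 → Dec (∣ sumSq y ∣ ≡ 0) → y ≡ 0R
  descend (suc fuel) x (s≤s le) eq =
    let y , x≡ , eq′ = Nm≡0⇒7∣ eq
    in trans x≡ (trans (cong (+ 7 •_) (step fuel x le y x≡ eq′ (∣ sumSq y ∣ ℕ.≟ 0))) (•-zeroʳ (+ 7)))
  -- The factor 49 between `sumSq x` and `sumSq y` is a strict drop only if `sumSq y` is nonzero;
  -- otherwise `y` vanishes outright.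
  step fuel x le y x≡ eq′ (yes y≡0) = sumSq-definite y (ℤₚ.≤-reflexive (ℤₚ.∣i∣≡0⇒i≡0 y≡0))
  step fuel x le y x≡ eq′ (no  y≢0) = descend fuel y (ℕₚ.<-≤-trans smaller le) eq′
    where
    smaller : ∣ sumSq y ∣ ℕ.< ∣ sumSq x ∣
    smaller = subst (λ u → ∣ sumSq y ∣ ℕ.< ∣ sumSq u ∣) (sym x≡) (sumSq-•-< y y≢0)

cube-mono-< : ∀ {t b} → + 0 ℤ.≤ t → t ℤ.< b → t ℤ.* (t ℤ.* t) ℤ.< b ℤ.* (b ℤ.* b)
cube-mono-< {+ t} {+ b} _ (+<+ t<b) = subst₂ ℤ._<_ (pos t) (pos b) (+<+ (ℕₚ.*-mono-< t<b (ℕₚ.*-mono-< t<b t<b)))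
  where
  pos : ∀ t → + (t ℕ.* (t ℕ.* t)) ≡ + t ℤ.* (+ t ℤ.* + t)
  pos t = trans (ℤₚ.pos-* t (t ℕ.* t)) (cong (λ u → + t ℤ.* u) (ℤₚ.pos-* t t))

-- `27 Nm r ≤ (τ r)³ < (27 h²)³`, and `27³ h⁶ = 27 (3 h)⁶`.
Nm<n⁶ : ∀ h r → τ r ℤ.< + 27 ℤ.* (h ℤ.* h) → Nm r ℤ.< (+ 3 ℤ.* h) ⁶
Nm<n⁶ h r small = ℤₚ.*-cancelˡ-<-nonNeg (+ 27) (ℤₚ.≤-<-trans (27Nm≤τ³ r)
  (subst (τ r ℤ.* (τ r ℤ.* τ r) ℤ.<_)
    (ℤ-solve 1 (λ h → con (+ 27) :* (h :* h) :* (con (+ 27) :* (h :* h) :* (con (+ 27) :* (h :* h))) :≡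
      con (+ 27) :* (con (+ 3) :* h :* (con (+ 3) :* h) :* (con (+ 3) :* h :* (con (+ 3) :* h)) :* (con (+ 3) :* h :* (con (+ 3) :* h)))) refl h)
    (cube-mono-< (0≤τ r) small)))

size : R → ℕ
size x = ∣ Nm x ∣

size-* : ∀ x y → size (x * y) ≡ size x ℕ.* size y
size-* x y = trans (cong ∣_∣ (Nm-* x y)) (ℤₚ.abs-* (Nm x) (Nm y))

-- The fraction `x / y` is `x · adjoint y / n` with `n = size y`. The factor 3 makes a third of the
-- modulus `3 n` an integer shift. For the resulting `q` one has `r y = 3 n s`, and
-- `size r < (3 n)⁶` turns into `size s < n` by taking norms.
division : ∀ x y → y ≢ 0R → ∃[ q ] ∃[ r ] x ≡ q * y + r × size r ℕ.< size y
division x y y≢0 = q , s , solve 2 (λ x p → x := p ⊕ (x ⊖ p)) refl x (q * y) , smaller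
  where
  n = size y
  n≢0 : n ≢ 0
  n≢0 n≡0 = y≢0 (Nm-definite y (ℤₚ.∣i∣≡0⇒i≡0 n≡0))
  instance _ = ℕ.≢-nonZero n≢0
  cover = covering n (+ 3 • (x * adjoint y))
  q r s : R
  q = proj₁ cover
  r = proj₁ (proj₂ cover)
  s = x + − (q * y)
  N = + 3 ℤ.* + n
  r*y : r * y ≡ ι N * s
  r*y = begin
    r * y
      ≡⟨ solve 3 (λ r y p → r ⊛ y := (p ⊕ r) ⊛ y ⊖ p ⊛ y) refl r y (ι N * q) ⟩
    (ι N * q + r) * y + − (ι N * q * y)
      ≡⟨ cong (λ u → u * y + − (ι N * q * y)) (trans (cong (λ u → u + r) (ι-* N q)) (sym (proj₁ (proj₂ (proj₂ cover))))) ⟩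
    + 3 • (x * adjoint y) * y + − (ι N * q * y)
      ≡⟨ cong₂ (λ u v → u * y + − (v * q * y)) (sym (ι-* (+ 3) (x * adjoint y))) (trans (ι-*-homo (+ 3) (+ n)) (cong (λ u → ι (+ 3) * u) (trans (cong ι (∣Nm∣ y)) (sym (*-adjoint y))))) ⟩
    ι (+ 3) * (x * adjoint y) * y + − (ι (+ 3) * (y * adjoint y) * q * y)
      ≡⟨ solve 5 (λ k x a y q → k ⊛ (x ⊛ a) ⊛ y ⊖ k ⊛ (y ⊛ a) ⊛ q ⊛ y := k ⊛ (y ⊛ a) ⊛ (x ⊖ q ⊛ y)) refl (ι (+ 3)) x (adjoint y) y q ⟩
    ι (+ 3) * (y * adjoint y) * s
      ≡⟨ cong (λ u → u * s) (trans (ι-*-homo (+ 3) (+ n)) (cong (λ u → ι (+ 3) * u) (trans (cong ι (∣Nm∣ y)) (sym (*-adjoint y))))) ⟨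
    ι N * s ∎
    where open ≡-Reasoning
  Nm-r : ∣ N ⁶ ∣ ℕ.* size s ≡ size r ℕ.* n
  Nm-r = begin
    ∣ N ⁶ ∣ ℕ.* size s         ≡⟨ cong (λ u → ∣ u ∣ ℕ.* size s) (Nm-ι N) ⟨
    size (ι N) ℕ.* size s      ≡⟨ size-* (ι N) s ⟨
    size (ι N * s)             ≡⟨ cong size r*y ⟨
    size (r * y)               ≡⟨ size-* r y ⟩
    size r ℕ.* n               ∎
    where open ≡-Reasoning
  size-r : size r ℕ.< ∣ N ⁶ ∣
  size-r = abs-mono-< (0≤Nm r) (Nm<n⁶ (+ n) r (proj₂ (proj₂ (proj₂ cover))))
    where
    abs-mono-< : ∀ {a b} → + 0 ℤ.≤ a → a ℤ.< b → ∣ a ∣ ℕ.< ∣ b ∣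
    abs-mono-< {+ a} {+ b} _ (+<+ a<b) = a<b
  smaller : size s ℕ.< n
  smaller = ℕₚ.*-cancelˡ-< ∣ N ⁶ ∣ (size s) n (subst (ℕ._< ∣ N ⁶ ∣ ℕ.* n) (sym Nm-r) (ℕₚ.*-monoˡ-< n size-r))

-- The Euclidean algorithm

record Bézout (a b : R) : Set where
  field
    g u v a′ b′ : R
    combination : g ≡ u * a + v * b
    g∣a         : a ≡ g * a′
    g∣b         : b ≡ g * b′

bézout-zero : ∀ a → Bézout a 0R
bézout-zero a = record
  { g = a ; u = 1R ; v = 0R ; a′ = 1R ; b′ = 0R
  ; combination = solve 2 (λ a b → a := κ (+ 1) ⊛ a ⊕ κ (+ 0) ⊛ b) refl a 0R
  ; g∣a = sym (*-identityʳ a)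
  ; g∣b = solve 1 (λ a → κ (+ 0) := a ⊛ κ (+ 0)) refl a }

bézout-step : ∀ {a b q r} → a ≡ q * b + r → Bézout b r → Bézout a b
bézout-step {a} {b} {q} {r} a≡ B = record
  { g = g ; u = v ; v = u + − (v * q) ; a′ = q * a′ + b′ ; b′ = a′
  ; combination = begin
      g                               ≡⟨ combination ⟩
      u * b + v * r                   ≡⟨ solve 5 (λ u b v r q → u ⊛ b ⊕ v ⊛ r := v ⊛ (q ⊛ b ⊕ r) ⊕ (u ⊖ v ⊛ q) ⊛ b) refl u b v r q ⟩
      v * (q * b + r) + (u + − (v * q)) * b  ≡⟨ cong (λ w → v * w + (u + − (v * q)) * b) a≡ ⟨
      v * a + (u + − (v * q)) * b     ∎
  ; g∣a = begin
      a                               ≡⟨ a≡ ⟩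
      q * b + r                       ≡⟨ cong₂ (λ x y → q * x + y) g∣a g∣b ⟩
      q * (g * a′) + g * b′           ≡⟨ solve 4 (λ q g b r → q ⊛ (g ⊛ b) ⊕ g ⊛ r := g ⊛ (q ⊛ b ⊕ r)) refl q g a′ b′ ⟩
      g * (q * a′ + b′)               ∎
  ; g∣b = g∣a }
  where
  open Bézout B
  open ≡-Reasoning

bézout : ∀ a b → Bézout a b
bézout a b = go (suc (size b)) a b ℕₚ.≤-refl
  where
  go : ∀ fuel a b → size b ℕ.< fuel → Bézout a b
  step : ∀ fuel a b → size b ℕ.≤ fuel → Dec (b ≡ 0R) → Bézout a b
  go (suc fuel) a b (s≤s le) = step fuel a b le (Vecₚ.≡-dec ℤₚ._≟_ b 0R)
  step fuel a b le (yes refl) = bézout-zero a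
  step fuel a b le (no b≢0) =
    let q , r , a≡ , r<b = division a b b≢0
    in bézout-step {q = q} a≡ (go fuel b r (ℕₚ.<-≤-trans r<b le))

size≡1⇒unit : ∀ {x} → size x ≡ 1 → x * adjoint x ≡ 1R
size≡1⇒unit {x} eq = trans (*-adjoint x) (cong ι (trans (sym (∣Nm∣ x)) (cong +_ eq)))

-- Prime ideals

size-1R : size 1R ≡ 1
size-1R = cong ∣_∣ (Nm-ι (+ 1))

Irreducible : R → Set
Irreducible g = ∀ β γ → g ≡ β * γ → size β ≡ 1 ⊎ size γ ≡ 1

irreducible⇒prime : ∀ {g} → size g ≢ 1 → Irreducible g → IsPrimeIdeal ⟨ g ⟩
irreducible⇒prime {g} g≢1 irreducible = record
  { 0∈ = 0R , solve 1 (λ g → κ (+ 0) := g ⊛ κ (+ 0)) refl g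
  ; +-clos = λ { (y , refl) (z , refl) → y + z , solve 3 (λ g y z → g ⊛ y ⊕ g ⊛ z := g ⊛ (y ⊕ z)) refl g y z }
  ; *-clos = λ { x (z , refl) → x * z , solve 3 (λ g x z → x ⊛ (g ⊛ z) := g ⊛ (x ⊛ z)) refl g x z }
  ; proper = λ { (y , 1≡gy) → g≢1 (ℕₚ.m*n≡1⇒m≡1 (size g) (size y) (trans (sym (size-* g y)) (trans (cong size (sym 1≡gy)) size-1R))) }
  ; prime = prime
  }
  where
  prime : ∀ x y → x * y ∈ ⟨ g ⟩ → x ∈ ⟨ g ⟩ ⊎ y ∈ ⟨ g ⟩
  -- With `h` the greatest common divisor of `g` and `x`, irreducibility of `g = h g′` leaves two
  -- cases: if `h` is a unit, Bézout puts `y` into the ideal; if `g′` is one, `g` divides `x` along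
  -- with `h`.
  prime x y (z , xy≡gz) = [ inj₂ ∘ unitˡ , inj₁ ∘ unitʳ ]′ (irreducible h g′ g≡hg′)
    where
    open Bézout (bézout g x) renaming (g to h; a′ to g′; b′ to x′; g∣a to g≡hg′; g∣b to x≡hx′)
    open ≡-Reasoning
    unitˡ : size h ≡ 1 → y ∈ ⟨ g ⟩
    unitˡ h-unit = adjoint h * (u * y + v * z) , (begin
      y                                          ≡⟨ solve 1 (λ y → y := κ (+ 1) ⊛ y) refl y ⟩
      1R * y                                     ≡⟨ cong (λ w → w * y) (size≡1⇒unit h-unit) ⟨
      h * adjoint h * y                          ≡⟨ cong (λ w → w * adjoint h * y) combination ⟩
      (u * g + v * x) * adjoint h * y            ≡⟨ solve 6 (λ u g v x a y → (u ⊛ g ⊕ v ⊛ x) ⊛ a ⊛ y := g ⊛ (a ⊛ (u ⊛ y)) ⊕ a ⊛ v ⊛ (x ⊛ y)) refl u g v x (adjoint h) y ⟩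
      g * (adjoint h * (u * y)) + adjoint h * v * (x * y)  ≡⟨ cong (λ w → g * (adjoint h * (u * y)) + adjoint h * v * w) xy≡gz ⟩
      g * (adjoint h * (u * y)) + adjoint h * v * (g * z)  ≡⟨ solve 6 (λ u g v z a y → g ⊛ (a ⊛ (u ⊛ y)) ⊕ a ⊛ v ⊛ (g ⊛ z) := g ⊛ (a ⊛ (u ⊛ y ⊕ v ⊛ z))) refl u g v z (adjoint h) y ⟩
      g * (adjoint h * (u * y + v * z))          ∎)
    unitʳ : size g′ ≡ 1 → x ∈ ⟨ g ⟩
    unitʳ g′-unit = adjoint g′ * x′ , (begin
      x                              ≡⟨ x≡hx′ ⟩
      h * x′                         ≡⟨ solve 2 (λ h x → h ⊛ x := h ⊛ κ (+ 1) ⊛ x) refl h x′ ⟩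
      h * 1R * x′                    ≡⟨ cong (λ w → h * w * x′) (size≡1⇒unit g′-unit) ⟨
      h * (g′ * adjoint g′) * x′     ≡⟨ solve 4 (λ h g a x → h ⊛ (g ⊛ a) ⊛ x := h ⊛ g ⊛ (a ⊛ x)) refl h g′ (adjoint g′) x′ ⟩
      h * g′ * (adjoint g′ * x′)     ≡⟨ cong (λ w → w * (adjoint g′ * x′)) g≡hg′ ⟨
      g * (adjoint g′ * x′)          ∎)

κ₃-factor : ∀ β γ → ¬ κ₃ (β * γ) ∼ + 0 → κ₃ β ∼ + 0 → ¬ κ₃ γ ∼ + 0
κ₃-factor β γ κ≢0 κβ κγ = κ≢0 (∼-trans (κ₃-* β γ) (∼-trans
  (+-cong-∼ (*-congˡ-∼ (cube (T₀ γ)) κβ) (*-congˡ-∼ (cube (T₀ β)) κγ))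
  (≡⇒∼ (cong₂ ℤ._+_ (ℤₚ.*-zeroʳ (cube (T₀ γ))) (ℤₚ.*-zeroʳ (cube (T₀ β)))))))

∼0? : ∀ x → Dec (x ∼ + 0)
∼0? x with 7 ℕDiv.∣? ∣ x ∣
... | yes p = yes (∣⇒∼0 p)
... | no ¬p = no (¬p ∘ ∼0⇒∣)

-- If there were no such prime, then α, being irreducible by induction on its norm, would be one.
prime-divisor : ∀ α → size α ≢ 1 → ¬ κ₃ α ∼ + 0 →
  ¬ (∀ g → IsPrimeIdeal ⟨ g ⟩ → α ∈ ⟨ g ⟩ → ¬ κ₃ g ∼ + 0 → ⊥)
prime-divisor α = go (suc (size α)) α ℕₚ.≤-refl
  where
  go : ∀ fuel α → size α ℕ.< fuel → size α ≢ 1 → ¬ κ₃ α ∼ + 0 →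
       ¬ (∀ g → IsPrimeIdeal ⟨ g ⟩ → α ∈ ⟨ g ⟩ → ¬ κ₃ g ∼ + 0 → ⊥)
  go (suc fuel) α (s≤s le) α≢1 κα none = none α (irreducible⇒prime α≢1 irreducible) (1R , sym (*-identityʳ α)) κα
    where
    α≢0 : size α ≢ 0
    α≢0 eq = κα (≡⇒∼ (cong κ₃ (Nm-definite α (ℤₚ.∣i∣≡0⇒i≡0 eq))))
    smaller : ∀ {β γ} → α ≡ β * γ → size γ ≢ 1 → size β ℕ.< fuel
    smaller {β} {γ} α≡ γ≢1 = ℕₚ.<-≤-trans (subst (size β ℕ.<_) (sym eq) (ℕₚ.m<m*n (size β) (size γ) {{ℕ.≢-nonZero β≢0}} 1<γ)) le
      where
      eq : size α ≡ size β ℕ.* size γ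
      eq = trans (cong size α≡) (size-* β γ)
      β≢0 : size β ≢ 0
      β≢0 z = α≢0 (trans eq (cong (ℕ._* size γ) z))
      γ≢0 : size γ ≢ 0
      γ≢0 z = α≢0 (trans eq (trans (cong (size β ℕ.*_) z) (ℕₚ.*-zeroʳ (size β))))
      1<γ : 1 ℕ.< size γ
      1<γ = ℕₚ.≤∧≢⇒< (ℕₚ.n≢0⇒n>0 γ≢0) (γ≢1 ∘ sym)
    factor : ∀ {β γ} → α ≡ β * γ → size β ≢ 1 → size γ ≢ 1 → ¬ κ₃ β ∼ + 0 → ⊥
    factor {β} {γ} α≡ β≢1 γ≢1 κβ = go fuel β (smaller α≡ γ≢1) β≢1 κβ
      (λ { g pg (y , β≡gy) κg → none g pg (y * γ , trans α≡ (trans (cong (λ w → w * γ) β≡gy) (*-assoc g y γ))) κg })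
    irreducible : Irreducible α
    irreducible β γ α≡ = cases (size β ℕ.≟ 1) (size γ ℕ.≟ 1) (∼0? (κ₃ β))
      where
      cases : Dec (size β ≡ 1) → Dec (size γ ≡ 1) → Dec (κ₃ β ∼ + 0) → size β ≡ 1 ⊎ size γ ≡ 1
      cases (yes p) _       _       = inj₁ p
      cases (no _)  (yes q) _       = inj₂ q
      cases (no p)  (no q)  (no κβ) = ⊥-elim (factor α≡ p q κβ)
      -- If `κ₃ β` vanishes, additivity leaves the nonzero cumulant to `γ`, which then takes the
      -- place of `β`.
      cases (no p)  (no q)  (yes κβ) = ⊥-elim (factor (trans α≡ (*-comm β γ)) q p (κ₃-factor β γ (subst (λ w → ¬ κ₃ w ∼ + 0) α≡ κα) κβ))

-- `Nm g` is a multiple of `g`; primality of the ideal selects one of its rational prime factors.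
rational-prime : ∀ {g} → IsPrimeIdeal ⟨ g ⟩ → g ≢ 0R → ∃[ ℓ ] Prime ℓ × ι (+ ℓ) ∈ ⟨ g ⟩
rational-prime {g} isPrime g≢0 = go factors factorsPrime
  (adjoint g , trans (cong ι (trans (cong +_ (sym isFactorisation)) (∣Nm∣ g))) (sym (*-adjoint g)))
  where
  n≢0 : size g ≢ 0
  n≢0 eq = g≢0 (Nm-definite g (ℤₚ.∣i∣≡0⇒i≡0 eq))
  open PrimeFactorisation (factorise (size g) {{ℕ.≢-nonZero n≢0}})
  open IsPrimeIdeal isPrime
  go : ∀ ps → All Prime ps → ι (+ product ps) ∈ ⟨ g ⟩ → ∃[ ℓ ] Prime ℓ × ι (+ ℓ) ∈ ⟨ g ⟩
  go List.[]       All.[]         1∈ = ⊥-elim (proper 1∈)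
  go (p List.∷ ps) (pp All.∷ pps) p∈ =
    [ (λ ∈g → p , pp , ∈g) , go ps pps ]′
      (prime _ _ (subst (_∈ ⟨ g ⟩) (trans (cong ι (ℤₚ.pos-* p (product ps))) (ι-*-homo (+ p) (+ product ps))) p∈))

-- Logarithmic coordinates

∼⇒mod : ∀ {x y} → x ∼ y → x ≡ y [mod 7 ]
∼⇒mod {x} {y} (by k eq) = Signed.∣⇒∣ᵤ (Signed.divides k (begin
  x ℤ.- y                        ≡⟨ cong (λ u → u ℤ.- y) eq ⟩
  y ℤ.+ + 7 ℤ.* k ℤ.- y          ≡⟨ ℤ-solve 2 (λ y k → y :+ con (+ 7) :* k :- y :≡ k :* con (+ 7)) refl y k ⟩
  k ℤ.* + 7                      ∎))
  where open ≡-Reasoning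

mod⇒∼ : ∀ {x y} → x ≡ y [mod 7 ] → x ∼ y
mod⇒∼ {x} {y} m with Signed.∣ᵤ⇒∣ {+ 7} {x ℤ.- y} m
... | Signed.divides k eq = by k (begin
  x                     ≡⟨ ℤ-solve 2 (λ x y → x :≡ y :+ (x :- y)) refl x y ⟩
  y ℤ.+ (x ℤ.- y)       ≡⟨ cong (λ u → y ℤ.+ u) (trans eq (ℤₚ.*-comm k (+ 7))) ⟩
  y ℤ.+ + 7 ℤ.* k       ∎)
  where open ≡-Reasoning

residue : ∀ x → ∃[ r ] r ℕ.< 7 × x ∼ + r
residue x = x ℤDivMod.%ℕ 7 , ℤDivMod.n%ℕd<d x 7 , by (x ℤDivMod./ℕ 7)
  (trans (ℤDivMod.a≡a%ℕn+[a/ℕn]*n x 7) (cong (λ u → + (x ℤDivMod.%ℕ 7) ℤ.+ u) (ℤₚ.*-comm (x ℤDivMod./ℕ 7) (+ 7))))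

1≁0 : ¬ + 1 ∼ + 0
1≁0 1∼0 = contradiction (∼0⇒∣ 1∼0) (from-no (7 ℕDiv.∣? 1))

inverse-mod-7 : ∀ {x} → ¬ x ∼ + 0 → ∃[ y ] x ℤ.* y ∼ + 1
inverse-mod-7 {x} x≁0 = cases (residue x)
  where
  invert : ∀ {r} y k → x ∼ r → r ℤ.* y ≡ + 1 ℤ.+ + 7 ℤ.* k → ∃[ y ] x ℤ.* y ∼ + 1
  invert y k x∼r eq = y , ∼-trans (*-cong-∼ x∼r (∼-refl {y})) (by k eq)
  cases : ∃[ r ] r ℕ.< 7 × x ∼ + r → ∃[ y ] x ℤ.* y ∼ + 1
  cases (0 , _ , x∼) = contradiction x∼ x≁0
  cases (1 , _ , x∼) = invert (+ 1) (+ 0) x∼ refl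
  cases (2 , _ , x∼) = invert (+ 4) (+ 1) x∼ refl
  cases (3 , _ , x∼) = invert (+ 5) (+ 2) x∼ refl
  cases (4 , _ , x∼) = invert (+ 2) (+ 1) x∼ refl
  cases (5 , _ , x∼) = invert (+ 3) (+ 2) x∼ refl
  cases (6 , _ , x∼) = invert (+ 6) (+ 5) x∼ refl
  cases (suc (suc (suc (suc (suc (suc (suc _)))))) , s≤s (s≤s (s≤s (s≤s (s≤s (s≤s (s≤s ())))))) , _)

-- Congruence modulo 7 in `R` and the powers of `Λ`

infix 4 _≅_

record _≅_ (x y : R) : Set where
  constructor by
  field
    multiple : R
    equation : x ≡ y + ι (+ 7) * multiple

≅-refl : ∀ {x} → x ≅ x
≅-refl {x} = by 0R (solve 1 (λ x → x := x ⊕ κ (+ 7) ⊛ κ (+ 0)) refl x)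

≅-trans : ∀ {x y z} → x ≅ y → y ≅ z → x ≅ z
≅-trans {z = z} (by a refl) (by b refl) = by (b + a)
  (solve 3 (λ z a b → z ⊕ κ (+ 7) ⊛ b ⊕ κ (+ 7) ⊛ a := z ⊕ κ (+ 7) ⊛ (b ⊕ a)) refl z a b)

≅-sym : ∀ {x y} → x ≅ y → y ≅ x
≅-sym {y = y} (by a refl) = by (− a) (solve 2 (λ y a → y := y ⊕ κ (+ 7) ⊛ a ⊕ κ (+ 7) ⊛ (⊝ a)) refl y a)

+-cong-≅ : ∀ {x x′ y y′} → x ≅ x′ → y ≅ y′ → x + y ≅ x′ + y′
+-cong-≅ {x′ = x} {y′ = y} (by a refl) (by b refl) = by (a + b)
  (solve 4 (λ x y a b → x ⊕ κ (+ 7) ⊛ a ⊕ (y ⊕ κ (+ 7) ⊛ b) := x ⊕ y ⊕ κ (+ 7) ⊛ (a ⊕ b)) refl x y a b)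

*-cong-≅ : ∀ {x x′ y y′} → x ≅ x′ → y ≅ y′ → x * y ≅ x′ * y′
*-cong-≅ {x′ = x} {y′ = y} (by a refl) (by b refl) = by (x * b + a * y + ι (+ 7) * a * b)
  (solve 4 (λ x y a b → (x ⊕ κ (+ 7) ⊛ a) ⊛ (y ⊕ κ (+ 7) ⊛ b) := x ⊛ y ⊕ κ (+ 7) ⊛ (x ⊛ b ⊕ a ⊛ y ⊕ κ (+ 7) ⊛ a ⊛ b)) refl x y a b)

≅⇒≈ : ∀ {x y} → x ≅ y → x ≈ y
≅⇒≈ {x} {y} (by a eq) = a , (begin
  x - y                        ≡⟨ sub-def x y ⟩
  x + − y                      ≡⟨ cong (λ u → u + − y) eq ⟩
  y + ι (+ 7) * a + − y        ≡⟨ solve 2 (λ y a → y ⊕ κ (+ 7) ⊛ a ⊖ y := κ (+ 7) ⊛ a) refl y a ⟩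
  ι (+ 7) * a                  ∎)
  where open ≡-Reasoning

coordinates⇒≅ : ∀ {x₀ x₁ x₂ x₃ x₄ x₅ y₀ y₁ y₂ y₃ y₄ y₅} →
  x₀ ∼ y₀ → x₁ ∼ y₁ → x₂ ∼ y₂ → x₃ ∼ y₃ → x₄ ∼ y₄ → x₅ ∼ y₅ →
  x₀ ∷ x₁ ∷ x₂ ∷ x₃ ∷ x₄ ∷ x₅ ∷ [] ≅ y₀ ∷ y₁ ∷ y₂ ∷ y₃ ∷ y₄ ∷ y₅ ∷ []
coordinates⇒≅ {y₀ = y₀} {y₁} {y₂} {y₃} {y₄} {y₅} (by k₀ e₀) (by k₁ e₁) (by k₂ e₂) (by k₃ e₃) (by k₄ e₄) (by k₅ e₅) =
  by k (trans (≡R e₀ e₁ e₂ e₃ e₄ e₅) (cong (λ u → (y₀ ∷ y₁ ∷ y₂ ∷ y₃ ∷ y₄ ∷ y₅ ∷ []) + u) (sym (ι-* (+ 7) k))))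
  where
  k : R
  k = k₀ ∷ k₁ ∷ k₂ ∷ k₃ ∷ k₄ ∷ k₅ ∷ []

-- Representatives of Λ, …, Λ⁵ modulo 7.
Λ₁ : R
Λ₁ = -[1+ 0 ] ∷ -[1+ 1 ] ∷ + 2 ∷ + 1 ∷ -[1+ 2 ] ∷ + 3 ∷ []
Λ₂ : R
Λ₂ = + 2 ∷ + 0 ∷ -[1+ 1 ] ∷ + 1 ∷ + 1 ∷ -[1+ 1 ] ∷ []
Λ₃ : R
Λ₃ = + 1 ∷ + 2 ∷ + 2 ∷ + 0 ∷ + 2 ∷ + 0 ∷ []
Λ₄ : R
Λ₄ = + 3 ∷ + 0 ∷ -[1+ 1 ] ∷ -[1+ 2 ] ∷ -[1+ 2 ] ∷ -[1+ 1 ] ∷ []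
Λ₅ : R
Λ₅ = -[1+ 0 ] ∷ -[1+ 1 ] ∷ -[1+ 2 ] ∷ + 3 ∷ + 2 ∷ + 1 ∷ []

opaque
  unfolding _*_

  -- Horner's evaluation of the logarithm at `ω - 1`, from the inside out: the right factor of each
  -- step is the previous value plus the next coefficient, in the order -2, 5, -4, 1.
  log-step₁ : (ω - 1R) * (+ 3 ∷ + 0 ∷ + 0 ∷ + 0 ∷ + 0 ∷ + 0 ∷ []) ≡ -[1+ 2 ] ∷ + 3 ∷ + 0 ∷ + 0 ∷ + 0 ∷ + 0 ∷ []
  log-step₁ = refl

  log-step₂ : (ω - 1R) * (-[1+ 4 ] ∷ + 3 ∷ + 0 ∷ + 0 ∷ + 0 ∷ + 0 ∷ []) ≡ + 5 ∷ -[1+ 7 ] ∷ + 3 ∷ + 0 ∷ + 0 ∷ + 0 ∷ []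
  log-step₂ = refl

  log-step₃ : (ω - 1R) * (+ 10 ∷ -[1+ 7 ] ∷ + 3 ∷ + 0 ∷ + 0 ∷ + 0 ∷ []) ≡ -[1+ 9 ] ∷ + 18 ∷ -[1+ 10 ] ∷ + 3 ∷ + 0 ∷ + 0 ∷ []
  log-step₃ = refl

  log-step₄ : (ω - 1R) * (-[1+ 13 ] ∷ + 18 ∷ -[1+ 10 ] ∷ + 3 ∷ + 0 ∷ + 0 ∷ []) ≡ + 14 ∷ -[1+ 31 ] ∷ + 29 ∷ -[1+ 13 ] ∷ + 3 ∷ + 0 ∷ []
  log-step₄ = refl

  log-step₅ : (ω - 1R) * (+ 15 ∷ -[1+ 31 ] ∷ + 29 ∷ -[1+ 13 ] ∷ + 3 ∷ + 0 ∷ []) ≡ -[1+ 14 ] ∷ + 47 ∷ -[1+ 60 ] ∷ + 43 ∷ -[1+ 16 ] ∷ + 3 ∷ []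
  log-step₅ = refl

  Λ≡ : -[1+ 14 ] ∷ + 47 ∷ -[1+ 60 ] ∷ + 43 ∷ -[1+ 16 ] ∷ + 3 ∷ [] ≡ Λ₁ + ι (+ 7) * (-[1+ 1 ] ∷ + 7 ∷ -[1+ 8 ] ∷ + 6 ∷ -[1+ 1 ] ∷ + 0 ∷ [])
  Λ≡ = refl

  Λ₁*Λ₁ : Λ₁ * Λ₁ ≡ Λ₂ + ι (+ 7) * (+ 4 ∷ + 6 ∷ + 1 ∷ + 3 ∷ + 4 ∷ + 5 ∷ [])
  Λ₁*Λ₁ = refl

  Λ₁*Λ₂ : Λ₁ * Λ₂ ≡ Λ₃ + ι (+ 7) * (-[1+ 3 ] ∷ -[1+ 2 ] ∷ + 0 ∷ -[1+ 1 ] ∷ -[1+ 3 ] ∷ -[1+ 0 ] ∷ [])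
  Λ₁*Λ₂ = refl

  Λ₁*Λ₃ : Λ₁ * Λ₃ ≡ Λ₄ + ι (+ 7) * (+ 0 ∷ -[1+ 1 ] ∷ + 0 ∷ + 0 ∷ + 0 ∷ -[1+ 0 ] ∷ [])
  Λ₁*Λ₃ = refl

  Λ₁*Λ₄ : Λ₁ * Λ₄ ≡ Λ₅ + ι (+ 7) * (-[1+ 0 ] ∷ -[1+ 0 ] ∷ + 1 ∷ + 0 ∷ -[1+ 0 ] ∷ + 1 ∷ [])
  Λ₁*Λ₄ = refl

Λ≅Λ₁ : Λ ≅ Λ₁
Λ≅Λ₁ = by (-[1+ 1 ] ∷ + 7 ∷ -[1+ 8 ] ∷ + 6 ∷ -[1+ 1 ] ∷ + 0 ∷ []) (begin
  X * (1R + X * (ι (ℤ.- + 4) + X * (ι (+ 5) + X * (ι (ℤ.- + 2) + X * (ι (+ 3) + 0R)))))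
    ≡⟨ cong (λ u → X * (1R + X * (ι (ℤ.- + 4) + X * (ι (+ 5) + X * (ι (ℤ.- + 2) + u))))) log-step₁ ⟩
  X * (1R + X * (ι (ℤ.- + 4) + X * (ι (+ 5) + X * (-[1+ 4 ] ∷ + 3 ∷ + 0 ∷ + 0 ∷ + 0 ∷ + 0 ∷ []))))
    ≡⟨ cong (λ u → X * (1R + X * (ι (ℤ.- + 4) + X * (ι (+ 5) + u)))) log-step₂ ⟩
  X * (1R + X * (ι (ℤ.- + 4) + X * (+ 10 ∷ -[1+ 7 ] ∷ + 3 ∷ + 0 ∷ + 0 ∷ + 0 ∷ [])))
    ≡⟨ cong (λ u → X * (1R + X * (ι (ℤ.- + 4) + u))) log-step₃ ⟩
  X * (1R + X * (-[1+ 13 ] ∷ + 18 ∷ -[1+ 10 ] ∷ + 3 ∷ + 0 ∷ + 0 ∷ []))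
    ≡⟨ cong (λ u → X * (1R + u)) log-step₄ ⟩
  X * (+ 15 ∷ -[1+ 31 ] ∷ + 29 ∷ -[1+ 13 ] ∷ + 3 ∷ + 0 ∷ [])
    ≡⟨ trans log-step₅ Λ≡ ⟩
  Λ₁ + ι (+ 7) * (-[1+ 1 ] ∷ + 7 ∷ -[1+ 8 ] ∷ + 6 ∷ -[1+ 1 ] ∷ + 0 ∷ []) ∎)
  where
  open ≡-Reasoning
  X = ω - 1R

Λ*Λ₁ : Λ * Λ₁ ≅ Λ₂
Λ*Λ₁ = ≅-trans (*-cong-≅ Λ≅Λ₁ (≅-refl {Λ₁})) (by _ Λ₁*Λ₁)

Λ*Λ₂ : Λ * Λ₂ ≅ Λ₃
Λ*Λ₂ = ≅-trans (*-cong-≅ Λ≅Λ₁ (≅-refl {Λ₂})) (by _ Λ₁*Λ₂)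

Λ*Λ₃ : Λ * Λ₃ ≅ Λ₄
Λ*Λ₃ = ≅-trans (*-cong-≅ Λ≅Λ₁ (≅-refl {Λ₃})) (by _ Λ₁*Λ₃)

Λ*Λ₄ : Λ * Λ₄ ≅ Λ₅
Λ*Λ₄ = ≅-trans (*-cong-≅ Λ≅Λ₁ (≅-refl {Λ₄})) (by _ Λ₁*Λ₄)

evalPoly-Λ : ∀ c₁ c₂ c₃ c₄ c₅ → evalPoly (c₁ ∷ c₂ ∷ c₃ ∷ c₄ ∷ c₅ ∷ []) Λ ≅
  c₁ • Λ₁ + c₂ • Λ₂ + c₃ • Λ₃ + c₄ • Λ₄ + c₅ • Λ₅
evalPoly-Λ c₁ c₂ c₃ c₄ c₅ = ≅-trans (≡⇒≅ (expand Λ (ι c₁) (ι c₂) (ι c₃) (ι c₄) (ι c₅)))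
  (+-cong-≅ (+-cong-≅ (+-cong-≅ (+-cong-≅ (term c₁ Λ≅Λ₁) (term c₂ Λ²)) (term c₃ Λ³)) (term c₄ Λ⁴)) (term c₅ Λ⁵))
  where
  ≡⇒≅ : ∀ {x y} → x ≡ y → x ≅ y
  ≡⇒≅ refl = ≅-refl
  expand : ∀ l c₁ c₂ c₃ c₄ c₅ → l * (c₁ + l * (c₂ + l * (c₃ + l * (c₄ + l * (c₅ + 0R))))) ≡
    c₁ * l + c₂ * (l * l) + c₃ * (l * (l * l)) + c₄ * (l * (l * (l * l))) + c₅ * (l * (l * (l * (l * l))))
  expand = solve 6 (λ l c₁ c₂ c₃ c₄ c₅ → l ⊛ (c₁ ⊕ l ⊛ (c₂ ⊕ l ⊛ (c₃ ⊕ l ⊛ (c₄ ⊕ l ⊛ (c₅ ⊕ κ (+ 0)))))) :=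
    c₁ ⊛ l ⊕ c₂ ⊛ (l ⊛ l) ⊕ c₃ ⊛ (l ⊛ (l ⊛ l)) ⊕ c₄ ⊛ (l ⊛ (l ⊛ (l ⊛ l))) ⊕ c₅ ⊛ (l ⊛ (l ⊛ (l ⊛ (l ⊛ l))))) refl
  term : ∀ c {x y} → x ≅ y → ι c * x ≅ c • y
  term c {x} {y} x≅y = ≅-trans (*-cong-≅ (≅-refl {ι c}) x≅y) (≡⇒≅ (ι-* c y))
  Λ² : Λ * Λ ≅ Λ₂
  Λ² = ≅-trans (*-cong-≅ (≅-refl {Λ}) Λ≅Λ₁) Λ*Λ₁
  Λ³ : Λ * (Λ * Λ) ≅ Λ₃
  Λ³ = ≅-trans (*-cong-≅ (≅-refl {Λ}) Λ²) Λ*Λ₂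
  Λ⁴ : Λ * (Λ * (Λ * Λ)) ≅ Λ₄
  Λ⁴ = ≅-trans (*-cong-≅ (≅-refl {Λ}) Λ³) Λ*Λ₃
  Λ⁵ : Λ * (Λ * (Λ * (Λ * Λ))) ≅ Λ₅
  Λ⁵ = ≅-trans (*-cong-≅ (≅-refl {Λ}) Λ⁴) Λ*Λ₄

-- k! cₖ = Tₖ; for k = 4 and 5 the weights iᵏ / k! are reduced modulo 7.
coefficient₄ coefficient₅ : R → ℤ
coefficient₄ (_ ∷ a₁ ∷ a₂ ∷ a₃ ∷ a₄ ∷ a₅ ∷ []) = + 5 ℤ.* (a₁ ℤ.+ + 2 ℤ.* a₂ ℤ.+ + 4 ℤ.* a₃ ℤ.+ + 4 ℤ.* a₄ ℤ.+ + 2 ℤ.* a₅)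
coefficient₅ (_ ∷ a₁ ∷ a₂ ∷ a₃ ∷ a₄ ∷ a₅ ∷ []) = a₁ ℤ.+ + 4 ℤ.* a₂ ℤ.+ + 5 ℤ.* a₃ ℤ.+ + 2 ℤ.* a₄ ℤ.+ + 3 ℤ.* a₅

-- In `A` one has `ω = exp Λ`, so `Σ aᵢ ωⁱ = Σ aᵢ exp (i Λ) = Σ Tₖ Λᵏ / k!`; modulo 7 the inverses
-- of `2!` and `3!` are 4 and 6. The proof verifies this coordinate by coordinate on the
-- representatives of the powers of `Λ`.
Λ-expansion : ∀ w → T₀ w ∼ + 0 →
  w ≅ evalPoly (T₁ w ∷ + 4 ℤ.* T₂ w ∷ + 6 ℤ.* T₃ w ∷ coefficient₄ w ∷ coefficient₅ w ∷ []) Λ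
Λ-expansion w@(a₀ ∷ a₁ ∷ a₂ ∷ a₃ ∷ a₄ ∷ a₅ ∷ []) w∼0 = ≅-trans
  (coordinates⇒≅
    -- The term `k = 0` of the expansion is `T₀ w`; it affects only the coordinate of 1, where the
    -- hypothesis removes it.
    (absorb (by (+ 0 ℤ.* a₀ ℤ.+ -[1+ 3 ] ℤ.* a₁ ℤ.+ -[1+ 14 ] ℤ.* a₂ ℤ.+ -[1+ 40 ] ℤ.* a₃ ℤ.+ -[1+ 80 ] ℤ.* a₄ ℤ.+ -[1+ 138 ] ℤ.* a₅) (Symbolic.scalar w (var (# 0)) (T₁ₚ generic :* con (-[1+ 0 ]) :+ (con (+ 4) :* T₂ₚ generic) :* con (+ 2) :+ (con (+ 6) :* T₃ₚ generic) :* con (+ 1) :+ c₄ generic :* con (+ 3) :+ c₅ generic :* con (-[1+ 0 ]) :+ sumₚ generic :+ con (+ 7) :* (con (+ 0) :* var (# 0) :+ con (-[1+ 3 ]) :* var (# 1) :+ con (-[1+ 14 ]) :* var (# 2) :+ con (-[1+ 40 ]) :* var (# 3) :+ con (-[1+ 80 ]) :* var (# 4) :+ con (-[1+ 138 ]) :* var (# 5))) refl)))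
    (by (+ 0 ℤ.* a₀ ℤ.+ -[1+ 0 ] ℤ.* a₁ ℤ.+ -[1+ 11 ] ℤ.* a₂ ℤ.+ -[1+ 43 ] ℤ.* a₃ ℤ.+ -[1+ 107 ] ℤ.* a₄ ℤ.+ -[1+ 211 ] ℤ.* a₅) (Symbolic.scalar w (var (# 1)) (T₁ₚ generic :* con (-[1+ 1 ]) :+ (con (+ 4) :* T₂ₚ generic) :* con (+ 0) :+ (con (+ 6) :* T₃ₚ generic) :* con (+ 2) :+ c₄ generic :* con (+ 0) :+ c₅ generic :* con (-[1+ 1 ]) :+ con (+ 7) :* (con (+ 0) :* var (# 0) :+ con (-[1+ 0 ]) :* var (# 1) :+ con (-[1+ 11 ]) :* var (# 2) :+ con (-[1+ 43 ]) :* var (# 3) :+ con (-[1+ 107 ]) :* var (# 4) :+ con (-[1+ 211 ]) :* var (# 5))) refl))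
    (by (+ 0 ℤ.* a₀ ℤ.+ + 1 ℤ.* a₁ ℤ.+ -[1+ 4 ] ℤ.* a₂ ℤ.+ -[1+ 28 ] ℤ.* a₃ ℤ.+ -[1+ 85 ] ℤ.* a₄ ℤ.+ -[1+ 182 ] ℤ.* a₅) (Symbolic.scalar w (var (# 2)) (T₁ₚ generic :* con (+ 2) :+ (con (+ 4) :* T₂ₚ generic) :* con (-[1+ 1 ]) :+ (con (+ 6) :* T₃ₚ generic) :* con (+ 2) :+ c₄ generic :* con (-[1+ 1 ]) :+ c₅ generic :* con (-[1+ 2 ]) :+ con (+ 7) :* (con (+ 0) :* var (# 0) :+ con (+ 1) :* var (# 1) :+ con (-[1+ 4 ]) :* var (# 2) :+ con (-[1+ 28 ]) :* var (# 3) :+ con (-[1+ 85 ]) :* var (# 4) :+ con (-[1+ 182 ]) :* var (# 5))) refl))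
    (by (+ 0 ℤ.* a₀ ℤ.+ + 1 ℤ.* a₁ ℤ.+ + 0 ℤ.* a₂ ℤ.+ + 1 ℤ.* a₃ ℤ.+ -[1+ 1 ] ℤ.* a₄ ℤ.+ -[1+ 11 ] ℤ.* a₅) (Symbolic.scalar w (var (# 3)) (T₁ₚ generic :* con (+ 1) :+ (con (+ 4) :* T₂ₚ generic) :* con (+ 1) :+ (con (+ 6) :* T₃ₚ generic) :* con (+ 0) :+ c₄ generic :* con (-[1+ 2 ]) :+ c₅ generic :* con (+ 3) :+ con (+ 7) :* (con (+ 0) :* var (# 0) :+ con (+ 1) :* var (# 1) :+ con (+ 0) :* var (# 2) :+ con (+ 1) :* var (# 3) :+ con (-[1+ 1 ]) :* var (# 4) :+ con (-[1+ 11 ]) :* var (# 5))) refl))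
    (by (+ 0 ℤ.* a₀ ℤ.+ + 0 ℤ.* a₁ ℤ.+ -[1+ 11 ] ℤ.* a₂ ℤ.+ -[1+ 42 ] ℤ.* a₃ ℤ.+ -[1+ 108 ] ℤ.* a₄ ℤ.+ -[1+ 222 ] ℤ.* a₅) (Symbolic.scalar w (var (# 4)) (T₁ₚ generic :* con (-[1+ 2 ]) :+ (con (+ 4) :* T₂ₚ generic) :* con (+ 1) :+ (con (+ 6) :* T₃ₚ generic) :* con (+ 2) :+ c₄ generic :* con (-[1+ 2 ]) :+ c₅ generic :* con (+ 2) :+ con (+ 7) :* (con (+ 0) :* var (# 0) :+ con (+ 0) :* var (# 1) :+ con (-[1+ 11 ]) :* var (# 2) :+ con (-[1+ 42 ]) :* var (# 3) :+ con (-[1+ 108 ]) :* var (# 4) :+ con (-[1+ 222 ]) :* var (# 5))) refl))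
    (by (+ 0 ℤ.* a₀ ℤ.+ + 2 ℤ.* a₁ ℤ.+ + 6 ℤ.* a₂ ℤ.+ + 14 ℤ.* a₃ ℤ.+ + 22 ℤ.* a₄ ℤ.+ + 29 ℤ.* a₅) (Symbolic.scalar w (var (# 5)) (T₁ₚ generic :* con (+ 3) :+ (con (+ 4) :* T₂ₚ generic) :* con (-[1+ 1 ]) :+ (con (+ 6) :* T₃ₚ generic) :* con (+ 0) :+ c₄ generic :* con (-[1+ 1 ]) :+ c₅ generic :* con (+ 1) :+ con (+ 7) :* (con (+ 0) :* var (# 0) :+ con (+ 2) :* var (# 1) :+ con (+ 6) :* var (# 2) :+ con (+ 14) :* var (# 3) :+ con (+ 22) :* var (# 4) :+ con (+ 29) :* var (# 5))) refl))
  )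
  (≅-sym (evalPoly-Λ (T₁ w) (+ 4 ℤ.* T₂ w) (+ 6 ℤ.* T₃ w) (coefficient₄ w) (coefficient₅ w)))
  where
  absorb : ∀ {x y} → x ∼ y ℤ.+ T₀ w → x ∼ y
  absorb {y = y} x∼ = ∼-trans x∼ (∼-trans (+-cong-∼ (∼-refl {y}) w∼0) (≡⇒∼ (ℤₚ.+-identityʳ y)))
  c₄ c₅ : Symbolic.Poly → Polynomial 6
  c₄ (_ ∷ a₁ ∷ a₂ ∷ a₃ ∷ a₄ ∷ a₅ ∷ []) = con (+ 5) :* (a₁ :+ con (+ 2) :* a₂ :+ con (+ 4) :* a₃ :+ con (+ 4) :* a₄ :+ con (+ 2) :* a₅)
  c₅ (_ ∷ a₁ ∷ a₂ ∷ a₃ ∷ a₄ ∷ a₅ ∷ []) = a₁ :+ con (+ 4) :* a₂ :+ con (+ 5) :* a₃ :+ con (+ 2) :* a₄ :+ con (+ 3) :* a₅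

T-sub : ∀ {T : R → ℤ} → Additive T → ∀ x y → T (x - y) ≡ T x ℤ.- T y
T-sub {T} add x y = begin
  T (x - y)                      ≡⟨ cong T (trans (sub-def x y) (cong (λ u → x + u) (−≡• y))) ⟩
  T (x + ℤ.- + 1 • y)            ≡⟨ add .+-homo x (ℤ.- + 1 • y) ⟩
  T x ℤ.+ T (ℤ.- + 1 • y)        ≡⟨ cong (λ u → T x ℤ.+ u) (trans (add .•-homo (ℤ.- + 1) y) (ℤₚ.-1*i≡-i (T y))) ⟩
  T x ℤ.- T y                    ∎
  where open ≡-Reasoning

-- Modulo 7, the moments of log (1 + X) are the cumulants of the moments of 1 + X.
module _ (X : R) (X∼0 : T₀ X ∼ + 0) where

  private
    t₁ t₂ t₃ : ℤ
    t₁ = T₁ X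
    t₂ = T₂ X
    t₃ = T₃ X

    mul₀ : ∀ z → T₀ (X * z) ∼ + 0
    mul₀ z = ∼-trans (T₀-* X z) (*-cong-∼ X∼0 (∼-refl {T₀ z}))

    absorb : ∀ y b {c} → b ∼ c → T₀ X ℤ.* y ℤ.+ b ∼ c
    absorb y b {c} p = ∼-trans (+-cong-∼ (*-cong-∼ X∼0 (∼-refl {y})) p) (≡⇒∼ (ℤₚ.+-identityˡ c))

    mul₁ : ∀ {z z₀} → T₀ z ∼ z₀ → T₁ (X * z) ∼ t₁ ℤ.* z₀
    mul₁ {z} p = ∼-trans (T₁-* X z) (absorb (T₁ z) (t₁ ℤ.* T₀ z) (*-congˡ-∼ t₁ p))

    mul₂ : ∀ {z z₀ z₁} → T₀ z ∼ z₀ → T₁ z ∼ z₁ → T₂ (X * z) ∼ + 2 ℤ.* t₁ ℤ.* z₁ ℤ.+ t₂ ℤ.* z₀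
    mul₂ {z} p₀ p₁ = ∼-trans (T₂-* X z)
      (+-cong-∼ (absorb (T₂ z) (+ 2 ℤ.* t₁ ℤ.* T₁ z) (*-congˡ-∼ (+ 2 ℤ.* t₁) p₁)) (*-congˡ-∼ t₂ p₀))

    mul₃ : ∀ {z z₀ z₁ z₂} → T₀ z ∼ z₀ → T₁ z ∼ z₁ → T₂ z ∼ z₂ →
           T₃ (X * z) ∼ + 3 ℤ.* t₁ ℤ.* z₂ ℤ.+ + 3 ℤ.* t₂ ℤ.* z₁ ℤ.+ t₃ ℤ.* z₀
    mul₃ {z} p₀ p₁ p₂ = ∼-trans (T₃-* X z)
      (+-cong-∼ (+-cong-∼ (absorb (T₃ z) (+ 3 ℤ.* t₁ ℤ.* T₂ z) (*-congˡ-∼ (+ 3 ℤ.* t₁) p₂))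
        (*-congˡ-∼ (+ 3 ℤ.* t₂) p₁)) (*-congˡ-∼ t₃ p₀))

    const₀ : ∀ k z → T₀ (ι k + X * z) ∼ k
    const₀ k z = ∼-trans (≡⇒∼ (T₀-additive .+-homo (ι k) (X * z))) (∼-trans (+-cong-∼ (≡⇒∼ (ℤₚ.+-identityʳ k)) (mul₀ z)) (≡⇒∼ (ℤₚ.+-identityʳ k)))

    const₁ : ∀ k z {t} → T₁ (X * z) ∼ t → T₁ (ι k + X * z) ∼ t
    const₁ k z p = ∼-trans (≡⇒∼ (trans (T₁-additive .+-homo (ι k) (X * z)) (ℤₚ.+-identityˡ (T₁ (X * z))))) p

    const₂ : ∀ k z {t} → T₂ (X * z) ∼ t → T₂ (ι k + X * z) ∼ t
    const₂ k z p = ∼-trans (≡⇒∼ (trans (T₂-additive .+-homo (ι k) (X * z)) (ℤₚ.+-identityˡ (T₂ (X * z))))) p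

    z₄ z₃ z₂ z₁ : R
    z₄ = ι (ℤ.- + 2) + X * (ι (+ 3) + 0R)
    z₃ = ι (+ 5) + X * z₄
    z₂ = ι (ℤ.- + 4) + X * z₃
    z₁ = 1R + X * z₂

    T₁z₂ : T₁ z₂ ∼ t₁ ℤ.* + 5
    T₁z₂ = const₁ (ℤ.- + 4) z₃ (mul₁ {z₃} (const₀ (+ 5) z₄))

    T₁z₁ : T₁ z₁ ∼ t₁ ℤ.* (ℤ.- + 4)
    T₁z₁ = const₁ (+ 1) z₂ (mul₁ {z₂} (const₀ (ℤ.- + 4) z₃))

    T₂z₁ : T₂ z₁ ∼ + 2 ℤ.* t₁ ℤ.* (t₁ ℤ.* + 5) ℤ.+ t₂ ℤ.* (ℤ.- + 4)
    T₂z₁ = const₂ (+ 1) z₂ (mul₂ {z₂} (const₀ (ℤ.- + 4) z₃) T₁z₂)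

  T₀-log : T₀ (log1+ X) ∼ + 0
  T₀-log = mul₀ z₁

  T₃-log : T₃ (log1+ X) ∼ cumulant (+ 1) (T₁ X) (T₂ X) (T₃ X)
  -- `X⁴` and `X⁵` have vanishing third moment modulo 7. The coefficients 1, -4, 5 of the lower
  -- powers give `t₃ - 24 t₁ t₂ + 30 t₁³`, which agrees with the cumulant modulo 7.
  T₃-log = ∼-trans (mul₃ {z₁} (const₀ (+ 1) z₂) T₁z₁ T₂z₁) (by (+ 4 ℤ.* (t₁ ℤ.* t₁ ℤ.* t₁) ℤ.+ ℤ.- + 3 ℤ.* t₁ ℤ.* t₂)
    (ℤ-solve 3 (λ t₁ t₂ t₃ →
      con (+ 3) :* t₁ :* (con (+ 2) :* t₁ :* (t₁ :* con (+ 5)) :+ t₂ :* con (ℤ.- + 4)) :+ con (+ 3) :* t₂ :* (t₁ :* con (ℤ.- + 4)) :+ t₃ :* con (+ 1) :≡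
      (con (+ 1) :* con (+ 1) :* t₃ :+ con (ℤ.- + 3) :* con (+ 1) :* t₁ :* t₂ :+ con (+ 2) :* t₁ :* t₁ :* t₁)
        :+ con (+ 7) :* (con (+ 4) :* (t₁ :* t₁ :* t₁) :+ con (ℤ.- + 3) :* t₁ :* t₂)) refl t₁ t₂ t₃))

cumulant-homogeneous : ∀ b t₀ t₁ t₂ t₃ → cumulant (b ℤ.* t₀) (b ℤ.* t₁) (b ℤ.* t₂) (b ℤ.* t₃) ≡ cube b ℤ.* cumulant t₀ t₁ t₂ t₃
cumulant-homogeneous = ℤ-solve 5 (λ b t₀ t₁ t₂ t₃ →
  (b :* t₀) :* (b :* t₀) :* (b :* t₃) :+ con (ℤ.- + 3) :* (b :* t₀) :* (b :* t₁) :* (b :* t₂) :+ con (+ 2) :* (b :* t₁) :* (b :* t₁) :* (b :* t₁) :≡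
  (b :* b :* b) :* (t₀ :* t₀ :* t₃ :+ con (ℤ.- + 3) :* t₀ :* t₁ :* t₂ :+ con (+ 2) :* t₁ :* t₁ :* t₁)) refl

module Coordinates (g : R) (b : ℤ) (inverse : T₀ g ℤ.* b ∼ + 1) where

  X w : R
  X = ι b * g - 1R
  w = log1+ X

  T-X : ∀ {T : R → ℤ} → Additive T → T X ≡ b ℤ.* T g ℤ.- T 1R
  T-X {T} add = trans (T-sub add (ι b * g) 1R) (cong (λ u → u ℤ.- T 1R) (trans (cong T (ι-* b g)) (add .•-homo b g)))

  bT₀∼1 : b ℤ.* T₀ g ∼ + 1
  bT₀∼1 = ∼-trans (≡⇒∼ (ℤₚ.*-comm b (T₀ g))) inverse

  X∼0 : T₀ X ∼ + 0
  X∼0 = ∼-trans (≡⇒∼ (T-X T₀-additive)) (+-cong-∼ bT₀∼1 (∼-refl {ℤ.- + 1}))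

  coords : LogCoords g
  coords = record
    { a = T₀ g ; a⁻¹ = b
    ; residue = quotπ g , π-division g
    ; inverse = ∼⇒mod inverse
    ; c₁ = T₁ w ; c₂ = + 4 ℤ.* T₂ w ; c₃ = + 6 ℤ.* T₃ w ; c₄ = coefficient₄ w ; c₅ = coefficient₅ w
    ; expansion = ≅⇒≈ (Λ-expansion w (T₀-log X X∼0))
    }

  -- `1 + X` is `b g`, and the cumulant is homogeneous of degree 3; its first argument 1 is replaced
  -- by `b T₀ g` so that homogeneity applies.
  T₃w : T₃ w ∼ cube b ℤ.* κ₃ g
  T₃w = ∼-trans (T₃-log X X∼0) (∼-trans
    (cumulant-cong (∼-sym bT₀∼1) (moment T₁-additive refl) (moment T₂-additive refl) (moment T₃-additive refl))
    (≡⇒∼ (cumulant-homogeneous b (T₀ g) (T₁ g) (T₂ g) (T₃ g))))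
    where
    moment : ∀ {T : R → ℤ} → Additive T → T 1R ≡ + 0 → T X ∼ b ℤ.* T g
    moment {T} add eq = ≡⇒∼ (trans (T-X add) (trans (cong (λ u → b ℤ.* T g ℤ.- u) eq) (ℤₚ.+-identityʳ (b ℤ.* T g))))

  d≁0 : ¬ κ₃ g ∼ + 0 → ¬ d coords ∼ + 0
  d≁0 κ≁0 d∼0 = [ b³≁0 , κ≁0 ]′ (∼0-* (cube b) (κ₃ g) (∼-trans (∼-sym T₃w) (24-cancel (T₃ w) d∼0)))
    where
    24-cancel : ∀ t → + 4 ℤ.* (+ 6 ℤ.* t) ∼ + 0 → t ∼ + 0
    -- 5 inverts 24 modulo 7, as `5 · 24 = 1 + 7 · 17`.
    24-cancel t p = ∼-trans (by (ℤ.- + 17 ℤ.* t)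
      (ℤ-solve 1 (λ t → t :≡ con (+ 5) :* (con (+ 4) :* (con (+ 6) :* t)) :+ con (+ 7) :* (con (ℤ.- + 17) :* t)) refl t))
      (*-congˡ-∼ (+ 5) p)
    b≁0 : ¬ b ∼ + 0
    b≁0 b∼0 = 1≁0 (∼-trans (∼-sym bT₀∼1) (*-cong-∼ b∼0 (∼-refl {T₀ g})))
    b³≁0 : ¬ cube b ∼ + 0
    b³≁0 p = [ (λ q → b≁0 (∼0-square b q)) , b≁0 ]′ (∼0-* (b ℤ.* b) b p)

-- The inverse of `n` modulo 7 also has a representative of absolute value at most 3. It serves as
-- the multiplier of δ(ℓ), so an exponent of at least `3 ord₇ ℓ` suffices for membership in `L₁₀`.
δ-exists : ∀ {x} → ¬ x ∼ + 0 → ∃[ n ] n ℕ.≤ 3 × (+ n ∼ x ⊎ + n ∼ ℤ.- x) × (∃[ j ] ∣ j ∣ ℕ.≤ 3 × j ℤ.* + n ∼ + 1)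
δ-exists {x} x≁0 = cases (residue x)
  where
  negated : ∀ r n → + n ℤ.+ + r ≡ + 7 → x ∼ + r → + n ∼ ℤ.- x
  negated r n eq x∼r = ∼-trans (by (+ 1) (trans (ℤ-solve 2 (λ n r → n :≡ (:- r) :+ (n :+ r)) refl (+ n) (+ r)) (cong (λ u → ℤ.- + r ℤ.+ u) eq)))
    (neg-cong-∼ (∼-sym x∼r))
  ≤3 : ∀ {n} {n≤3 : True (n ℕ.≤? 3)} → n ℕ.≤ 3
  ≤3 {n≤3 = n≤3} = toWitness n≤3
  cases : ∃[ r ] r ℕ.< 7 × x ∼ + r → ∃[ n ] n ℕ.≤ 3 × (+ n ∼ x ⊎ + n ∼ ℤ.- x) × (∃[ j ] ∣ j ∣ ℕ.≤ 3 × j ℤ.* + n ∼ + 1)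
  cases (0 , _ , x∼) = contradiction x∼ x≁0
  cases (1 , _ , x∼) = 1 , ≤3 , inj₁ (∼-sym x∼) , + 1 , ≤3 , by (+ 0) refl
  cases (2 , _ , x∼) = 2 , ≤3 , inj₁ (∼-sym x∼) , -[1+ 2 ] , ≤3 , by -[1+ 0 ] refl
  cases (3 , _ , x∼) = 3 , ≤3 , inj₁ (∼-sym x∼) , -[1+ 1 ] , ≤3 , by -[1+ 0 ] refl
  cases (4 , _ , x∼) = 3 , ≤3 , inj₂ (negated 4 3 refl x∼) , -[1+ 1 ] , ≤3 , by -[1+ 0 ] refl
  cases (5 , _ , x∼) = 2 , ≤3 , inj₂ (negated 5 2 refl x∼) , -[1+ 2 ] , ≤3 , by -[1+ 0 ] refl
  cases (6 , _ , x∼) = 1 , ≤3 , inj₂ (negated 6 1 refl x∼) , + 1 , ≤3 , by (+ 0) refl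
  cases (suc (suc (suc (suc (suc (suc (suc _)))))) , s≤s (s≤s (s≤s (s≤s (s≤s (s≤s (s≤s ())))))) , _)

-- A visible prime

-- The quadratic Gauss sum `1 + 2 (ω + ω² + ω⁴)`; the same vector as `Λ₃`, the representative of
-- `Λ³`.
√-7 : R
√-7 = + 1 ∷ + 2 ∷ + 2 ∷ + 0 ∷ + 2 ∷ + 0 ∷ []

opaque
  unfolding _*_

  √-7-square : √-7 * √-7 ≡ ι (ℤ.- + 7)
  √-7-square = refl

norm-form : ∀ M → (1R + ι (ℤ.- + M) * √-7) * (1R + ι (+ M) * √-7) ≡ ι (+ (1 ℕ.+ 7 ℕ.* (M ℕ.* M)))
norm-form M = begin
  (1R + ι (ℤ.- m) * √-7) * (1R + ι m * √-7)          ≡⟨ multiply (ι m) √-7 ⟩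
  1R + − (ι m * ι m * (√-7 * √-7))                   ≡⟨ cong₂ (λ u v → 1R + − (u * v)) (sym (ι-*-homo m m)) √-7-square ⟩
  1R + − (ι (m ℤ.* m) * ι (ℤ.- + 7))                 ≡⟨ cong (λ u → 1R + − u) (ι-*-homo (m ℤ.* m) (ℤ.- + 7)) ⟨
  ι (+ 1 ℤ.+ ℤ.- (m ℤ.* m ℤ.* ℤ.- + 7))              ≡⟨ cong ι (ℤ-solve 1 (λ m → con (+ 1) :+ :- (m :* m :* con (ℤ.- + 7)) :≡ con (+ 1) :+ con (+ 7) :* (m :* m)) refl m) ⟩
  ι (+ 1 ℤ.+ + 7 ℤ.* (m ℤ.* m))                      ≡⟨ cong (λ u → ι (+ 1 ℤ.+ u)) (trans (ℤₚ.pos-* 7 (M ℕ.* M)) (cong (λ u → + 7 ℤ.* u) (ℤₚ.pos-* M M))) ⟨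
  ι (+ (1 ℕ.+ 7 ℕ.* (M ℕ.* M)))                      ∎
  where
  open ≡-Reasoning
  m = + M
  multiply : ∀ m s → (1R + − m * s) * (1R + m * s) ≡ 1R + − (m * m * (s * s))
  multiply = solve 2 (λ m s → (κ (+ 1) ⊕ (⊝ m) ⊛ s) ⊛ (κ (+ 1) ⊕ m ⊛ s) := κ (+ 1) ⊕ (⊝ (m ⊛ m ⊛ (s ⊛ s)))) refl

conj-coordinate : ∀ m → lookup (1R + ι m * √-7) (# 1) ≡ m ℤ.* + 2
conj-coordinate m = trans (cong (λ v → lookup (1R + v) (# 1)) (ι-* m √-7)) (ℤₚ.+-identityˡ (m ℤ.* + 2))

module 1+M√-7 (M : ℕ) (7∤M : ¬ 7 ℕDiv.∣ M) where

  α : R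
  α = 1R + ι (+ M) * √-7

  T-α : ∀ {T : R → ℤ} → Additive T → T α ≡ T 1R ℤ.+ + M ℤ.* T √-7
  T-α {T} add = trans (add .+-homo 1R (ι (+ M) * √-7))
    (cong (λ u → T 1R ℤ.+ u) (trans (cong T (ι-* (+ M) √-7)) (add .•-homo (+ M) √-7)))

  T₀-α : T₀ α ∼ + 1
  T₀-α = by (+ M) (trans (T-α T₀-additive) (cong (λ u → + 1 ℤ.+ u) (ℤₚ.*-comm (+ M) (+ 7))))

  T₀-α≁0 : ¬ T₀ α ∼ + 0
  T₀-α≁0 p = 1≁0 (∼-trans (∼-sym T₀-α) p)

  T₁-α : T₁ α ∼ + 0
  T₁-α = by (+ 2 ℤ.* + M) (trans (T-α T₁-additive) (ℤ-solve 1 (λ m → con (+ 0) :+ m :* con (+ 14) :≡ con (+ 0) :+ con (+ 7) :* (con (+ 2) :* m)) refl (+ M)))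

  T₂-α : T₂ α ∼ + 0
  T₂-α = by (+ 6 ℤ.* + M) (trans (T-α T₂-additive) (ℤ-solve 1 (λ m → con (+ 0) :+ m :* con (+ 42) :≡ con (+ 0) :+ con (+ 7) :* (con (+ 6) :* m)) refl (+ M)))

  -- The moments of `√-7` are 7, 14, 42 and `146 = 7 · 21 - 1`: the third is the first that does not
  -- vanish modulo 7, as `√-7` is congruent to `Λ³`.
  T₃-α : T₃ α ∼ ℤ.- + M
  T₃-α = by (+ 21 ℤ.* + M) (trans (T-α T₃-additive) (ℤ-solve 1 (λ m → con (+ 0) :+ m :* con (+ 146) :≡ (:- m) :+ con (+ 7) :* (con (+ 21) :* m)) refl (+ M)))

  κ₃-α≁0 : ¬ κ₃ α ∼ + 0
  κ₃-α≁0 p = 7∤M (∼0⇒∣ (∼-trans (≡⇒∼ (sym (ℤₚ.neg-involutive (+ M)))) (neg-cong-∼ (∼-trans (∼-sym κ₃-α) p))))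
    where
    κ₃-α : κ₃ α ∼ ℤ.- + M
    κ₃-α = ∼-trans (cumulant-cong T₀-α T₁-α T₂-α T₃-α)
      (≡⇒∼ (ℤ-solve 1 (λ m → con (+ 1) :* con (+ 1) :* m :+ con (ℤ.- + 3) :* con (+ 1) :* con (+ 0) :* con (+ 0) :+ con (+ 2) :* con (+ 0) :* con (+ 0) :* con (+ 0) :≡ m) refl (ℤ.- + M)))

  M≢0 : M ≢ 0
  M≢0 M≡0 = 7∤M (subst (7 ℕDiv.∣_) (sym M≡0) (7 ℕDiv.∣0))

  -- A unit α would make 1 + 7M² divide the conjugate of α, whose ω-coordinate is - 2M.
  size-α≢1 : size α ≢ 1
  size-α≢1 α-unit = ℕₚ.<⇒≱ 2M<n n≤2M
    where
    n = 1 ℕ.+ 7 ℕ.* (M ℕ.* M)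
    y : R
    y = adjoint α
    y₁ = lookup y (# 1)
    conj≡ny : 1R + ι (ℤ.- + M) * √-7 ≡ + n • y
    conj≡ny = begin
      1R + ι (ℤ.- + M) * √-7               ≡⟨ *-identityʳ _ ⟨
      (1R + ι (ℤ.- + M) * √-7) * 1R        ≡⟨ cong (λ u → (1R + ι (ℤ.- + M) * √-7) * u) (size≡1⇒unit α-unit) ⟨
      (1R + ι (ℤ.- + M) * √-7) * (α * y)   ≡⟨ *-assoc _ α y ⟨
      (1R + ι (ℤ.- + M) * √-7) * α * y     ≡⟨ cong (λ u → u * y) (norm-form M) ⟩
      ι (+ n) * y                          ≡⟨ ι-* (+ n) y ⟩
      + n • y                              ∎
      where open ≡-Reasoning
    coordinate : 2 ℕ.* M ≡ n ℕ.* ∣ y₁ ∣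
    coordinate = begin
      2 ℕ.* M                          ≡⟨ ℕₚ.*-comm 2 M ⟩
      M ℕ.* 2                          ≡⟨ cong (ℕ._* 2) (ℤₚ.∣-i∣≡∣i∣ (+ M)) ⟨
      ∣ ℤ.- + M ∣ ℕ.* 2                ≡⟨ ℤₚ.abs-* (ℤ.- + M) (+ 2) ⟨
      ∣ (ℤ.- + M) ℤ.* + 2 ∣            ≡⟨ cong ∣_∣ (conj-coordinate (ℤ.- + M)) ⟨
      ∣ lookup (1R + ι (ℤ.- + M) * √-7) (# 1) ∣  ≡⟨ cong (λ v → ∣ lookup v (# 1) ∣) conj≡ny ⟩
      ∣ lookup (+ n • y) (# 1) ∣       ≡⟨ cong ∣_∣ (Vecₚ.lookup-map (# 1) (+ n ℤ.*_) y) ⟩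
      ∣ + n ℤ.* y₁ ∣                   ≡⟨ ℤₚ.abs-* (+ n) y₁ ⟩
      n ℕ.* ∣ y₁ ∣                     ∎
      where open ≡-Reasoning
    instance _ = ℕ.≢-nonZero M≢0
    2M≢0 : 2 ℕ.* M ≢ 0
    2M≢0 eq = M≢0 ([ (λ ()) , id ]′ (ℕₚ.m*n≡0⇒m≡0∨n≡0 2 eq))
    n≤2M : n ℕ.≤ 2 ℕ.* M
    n≤2M = ℕDiv.∣⇒≤ {{ℕ.≢-nonZero 2M≢0}} (ℕDiv.divides ∣ y₁ ∣ (trans coordinate (ℕₚ.*-comm n ∣ y₁ ∣)))
    2M<n : 2 ℕ.* M ℕ.< n
    2M<n = s≤s (ℕₚ.*-mono-≤ {2} {7} (s≤s (s≤s z≤n)) (ℕₚ.m≤m*n M M))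

prime∣prime⇒≡ : ∀ {p q} → Prime p → Prime q → p ℕDiv.∣ q → p ≡ q
prime∣prime⇒≡ pp pq p∣q = [ (λ { refl → contradiction pp ¬prime[1] }) , id ]′ (prime⇒irreducible pq p∣q)

remove-7 : ∀ N → N ≢ 0 → ∃[ M ] ¬ 7 ℕDiv.∣ M × (∀ {ℓ} → Prime ℓ → ℓ ≢ 7 → ℓ ℕDiv.∣ N → ℓ ℕDiv.∣ M)
remove-7 N = go (suc N) N ℕₚ.≤-refl
  where
  go : ∀ fuel N → N ℕ.< fuel → N ≢ 0 → ∃[ M ] ¬ 7 ℕDiv.∣ M × (∀ {ℓ} → Prime ℓ → ℓ ≢ 7 → ℓ ℕDiv.∣ N → ℓ ℕDiv.∣ M)
  go (suc fuel) N (s≤s le) N≢0 with 7 ℕDiv.∣? N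
  ... | no 7∤N = N , 7∤N , λ _ _ ∣N → ∣N
  ... | yes (ℕDiv.divides q refl) =
    let M , 7∤M , f = go fuel q (ℕₚ.<-≤-trans (ℕₚ.m<m*n q 7 {{ℕ.≢-nonZero q≢0}} (s≤s (s≤s z≤n))) le) q≢0
    in M , 7∤M , λ {ℓ} pℓ ℓ≢7 ℓ∣ → f pℓ ℓ≢7 ([ id , (λ ℓ∣7 → contradiction (prime∣prime⇒≡ pℓ prime₇ ℓ∣7) ℓ≢7) ]′ (euclidsLemma q 7 pℓ ℓ∣))
    where
    q≢0 : q ≢ 0
    q≢0 refl = N≢0 refl

-- `d≁0` serves both sets: it refutes invisibility, and it makes δ(ℓ) invertible modulo 7.
record VisiblePrime (N : ℕ) : Set where
  field
    ℓ       : ℕ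
    isPrime : Prime ℓ
    ℓ≢7     : ℓ ≢ 7
    ℓ∤N     : ¬ ℓ ℕDiv.∣ N
    g       : R
    isPrimeIdeal : IsPrimeIdeal ⟨ g ⟩
    ℓ∈⟨g⟩   : ι (+ ℓ) ∈ ⟨ g ⟩
    coords  : LogCoords g
    d≁0     : ¬ d coords ∼ + 0

-- `π⁶` is a multiple of 7, so 7 in the ideal would put `π` there by primality. As `g` is congruent
-- to `T₀ g` modulo `π`, the integer `T₀ g` would follow, and it is invertible modulo 7.
7∉ideal : ∀ {g} → IsPrimeIdeal ⟨ g ⟩ → ¬ T₀ g ∼ + 0 → ¬ ι (+ 7) ∈ ⟨ g ⟩
7∉ideal {g} isPrime T₀≁0 7∈ = proper (π^∈⇒1∈ 6 (subst (_∈ ⟨ g ⟩) (trans (*-comm c (ι (+ 7))) (sym 7∣π⁶)) (*-clos c 7∈)))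
  where
  open IsPrimeIdeal isPrime
  c : R
  c = + 0 ∷ ℤ.- + 1 ∷ + 2 ∷ ℤ.- + 3 ∷ + 2 ∷ ℤ.- + 1 ∷ []
  q = quotπ g
  b = proj₁ (inverse-mod-7 T₀≁0)
  π∈⇒1∈ : π ∈ ⟨ g ⟩ → 1R ∈ ⟨ g ⟩
  π∈⇒1∈ π∈ with proj₂ (inverse-mod-7 T₀≁0)
  ... | by k eq = subst (_∈ ⟨ g ⟩) combine
    (+-clos (*-clos (ι b) (1R , sym (*-identityʳ g))) (+-clos (*-clos (− (ι b * q)) π∈) (*-clos (− ι k) 7∈)))
    where
    open ≡-Reasoning
    1≡ : 1R ≡ ι (T₀ g) * ι b + − (ι (+ 7) * ι k)
    1≡ = trans (cong ι (trans (ℤ-solve 1 (λ s → con (+ 1) :≡ con (+ 1) :+ s :- s) refl (+ 7 ℤ.* k)) (cong (λ u → u ℤ.- + 7 ℤ.* k) (sym eq))))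
      (trans (ι-+-homo (T₀ g ℤ.* b) _) (cong₂ (λ u v → u + − v) (ι-*-homo (T₀ g) b) (ι-*-homo (+ 7) k)))
    cancel : ∀ b p q t k s → b * (p * q + t) + (− (b * q) * p + − k * s) ≡ t * b + − (s * k)
    cancel = solve 6 (λ b p q t k s → b ⊛ (p ⊛ q ⊕ t) ⊕ ((⊝ (b ⊛ q)) ⊛ p ⊕ (⊝ k) ⊛ s) := t ⊛ b ⊕ (⊝ (s ⊛ k))) refl
    combine : ι b * g + (− (ι b * q) * π + − ι k * ι (+ 7)) ≡ 1R
    combine = begin
      ι b * g + (− (ι b * q) * π + − ι k * ι (+ 7))
        ≡⟨ cong (λ u → ι b * u + (− (ι b * q) * π + − ι k * ι (+ 7))) (x-y≡z⇒x≡z+y (π-division g)) ⟩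
      ι b * (π * q + ι (T₀ g)) + (− (ι b * q) * π + − ι k * ι (+ 7))
        ≡⟨ cancel (ι b) π q (ι (T₀ g)) (ι k) (ι (+ 7)) ⟩
      ι (T₀ g) * ι b + − (ι (+ 7) * ι k)
        ≡⟨ 1≡ ⟨
      1R ∎
  π^∈⇒1∈ : ∀ k → fold 1R (λ u → π * u) k ∈ ⟨ g ⟩ → 1R ∈ ⟨ g ⟩
  π^∈⇒1∈ zero    1∈ = 1∈
  π^∈⇒1∈ (suc k) p  = [ π∈⇒1∈ , π^∈⇒1∈ k ]′ (prime π _ p)

prime∤N : ∀ {g M ℓ} → IsPrimeIdeal ⟨ g ⟩ → 1R + ι (+ M) * √-7 ∈ ⟨ g ⟩ → ι (+ ℓ) ∈ ⟨ g ⟩ → ¬ ℓ ℕDiv.∣ M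
prime∤N {g} {M} {ℓ} isPrime α∈ ℓ∈ (ℕDiv.divides k M≡kℓ) =
  proper (subst (_∈ ⟨ g ⟩) eq (+-clos α∈ (*-clos (− (ι (+ k) * √-7)) ℓ∈)))
  where
  open IsPrimeIdeal isPrime
  open ≡-Reasoning
  cancel : ∀ k l s → 1R + k * l * s + − (k * s) * l ≡ 1R
  cancel = solve 3 (λ k l s → κ (+ 1) ⊕ k ⊛ l ⊛ s ⊕ (⊝ (k ⊛ s)) ⊛ l := κ (+ 1)) refl
  eq : 1R + ι (+ M) * √-7 + − (ι (+ k) * √-7) * ι (+ ℓ) ≡ 1R
  eq = begin
    1R + ι (+ M) * √-7 + − (ι (+ k) * √-7) * ι (+ ℓ)
      ≡⟨ cong (λ u → 1R + u * √-7 + − (ι (+ k) * √-7) * ι (+ ℓ)) (trans (cong ι (trans (cong +_ M≡kℓ) (ℤₚ.pos-* k ℓ))) (ι-*-homo (+ k) (+ ℓ))) ⟩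
    1R + ι (+ k) * ι (+ ℓ) * √-7 + − (ι (+ k) * √-7) * ι (+ ℓ)
      ≡⟨ cancel (ι (+ k)) (ι (+ ℓ)) √-7 ⟩
    1R ∎

visible-coords : ∀ {g} → ¬ T₀ g ∼ + 0 → ¬ κ₃ g ∼ + 0 → Σ[ v ∈ LogCoords g ] ¬ d v ∼ + 0
visible-coords {g} T₀≁0 κ≁0 =
  let b , inv = inverse-mod-7 T₀≁0
  in Coordinates.coords g b inv , Coordinates.d≁0 g b inv κ≁0

visible-prime : ∀ {N M} → (∀ {ℓ} → Prime ℓ → ℓ ≢ 7 → ℓ ℕDiv.∣ N → ℓ ℕDiv.∣ M) →
  ∀ {g} → IsPrimeIdeal ⟨ g ⟩ → 1R + ι (+ M) * √-7 ∈ ⟨ g ⟩ → ¬ T₀ g ∼ + 0 → ¬ κ₃ g ∼ + 0 → VisiblePrime N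
visible-prime ∣N⇒∣M {g} isPrime α∈ T₀≁0 κ≁0 = build (rational-prime isPrime g≢0) (visible-coords T₀≁0 κ≁0)
  where
  g≢0 : g ≢ 0R
  g≢0 g≡0 = T₀≁0 (≡⇒∼ (cong T₀ g≡0))
  build : ∃[ ℓ ] Prime ℓ × ι (+ ℓ) ∈ ⟨ g ⟩ → Σ[ v ∈ LogCoords g ] ¬ d v ∼ + 0 → VisiblePrime _
  build (ℓ , pℓ , ℓ∈) (v , d≁0) = record
    { ℓ = ℓ ; isPrime = pℓ ; ℓ≢7 = ℓ≢7 ; ℓ∤N = λ ℓ∣N → prime∤N isPrime α∈ ℓ∈ (∣N⇒∣M pℓ ℓ≢7 ℓ∣N)
    ; g = g ; isPrimeIdeal = isPrime ; ℓ∈⟨g⟩ = ℓ∈ ; coords = v ; d≁0 = d≁0 }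
    where
    ℓ≢7 : ℓ ≢ 7
    ℓ≢7 ℓ≡7 = 7∉ideal isPrime T₀≁0 (subst (λ n → ι (+ n) ∈ ⟨ g ⟩) ℓ≡7 ℓ∈)

¬¬visible-prime : ∀ N → N ≢ 0 → ¬ ¬ VisiblePrime N
¬¬visible-prime N N≢0 none = from (remove-7 N N≢0)
  where
  from : ¬ (∃[ M ] ¬ 7 ℕDiv.∣ M × (∀ {ℓ} → Prime ℓ → ℓ ≢ 7 → ℓ ℕDiv.∣ N → ℓ ℕDiv.∣ M))
  from (M , 7∤M , ∣N⇒∣M) = prime-divisor α size-α≢1 κ₃-α≁0 λ g isPrime α∈ κ≁0 →
    none (visible-prime ∣N⇒∣M isPrime α∈ (T₀≁0 α∈) κ≁0)
    where
    open 1+M√-7 M 7∤M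
    T₀≁0 : ∀ {g} → α ∈ ⟨ g ⟩ → ¬ T₀ g ∼ + 0
    -- `α` has residue 1 modulo `π`, so its divisor `g` is prime to `π`; this later excludes
    -- `ℓ = 7`.
    T₀≁0 {g} (y , α≡gy) p = T₀-α≁0 (∼-trans (≡⇒∼ (cong T₀ α≡gy)) (∼-trans (T₀-* g y) (*-cong-∼ p (∼-refl {T₀ y}))))

-- Prime powers congruent to 1

∣prime^*-cancel : ∀ {N ℓ} → Prime ℓ → ¬ ℓ ℕDiv.∣ N → ∀ k {x} → N ℕDiv.∣ ℓ ℕ.^ k ℕ.* x → N ℕDiv.∣ x
∣prime^*-cancel {N} pℓ ℓ∤N zero    {x} N∣ = subst (N ℕDiv.∣_) (ℕₚ.*-identityˡ x) N∣
∣prime^*-cancel {N} {ℓ} pℓ ℓ∤N (suc k) {x} N∣ =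
  ∣prime^*-cancel pℓ ℓ∤N k (coprime-divisor coprime (subst (N ℕDiv.∣_) (ℕₚ.*-assoc ℓ (ℓ ℕ.^ k) x) N∣))
  where
  coprime : ∀ {c} → c ℕDiv.∣ N × c ℕDiv.∣ ℓ → c ≡ 1
  coprime (c∣N , c∣ℓ) = [ id , (λ { refl → contradiction c∣N ℓ∤N }) ]′ (prime⇒irreducible pℓ c∣ℓ)

-- By the pigeonhole principle two powers of ℓ¹⁸ agree modulo N.  The factor
-- 18 = 3 · 6 ensures ⌊a / ord₇ ℓ⌋ ≥ 3, the bound on the multiplier of δ(ℓ).
prime^18k≡1 : ∀ {N ℓ} .{{_ : NonZero N}} → Prime ℓ → ¬ ℓ ℕDiv.∣ N →
  ∃[ k ] + (ℓ ℕ.^ (18 ℕ.* suc k)) ≡ + 1 [mod N ]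
prime^18k≡1 {N} {ℓ} pℓ ℓ∤N = collision (Finₚ.pigeonhole (ℕₚ.n<1+n N) (λ i → (ℓ ℕ.^ (18 ℕ.* Fin.toℕ i)) ℕDivMod.mod N))
  where
  power : ℕ → ℕ
  power i = ℓ ℕ.^ (18 ℕ.* i)
  ∣∸ : ∀ a b → a ℕ.% N ≡ b ℕ.% N → N ℕDiv.∣ b ℕ.∸ a
  ∣∸ a b eq = ℕDiv.divides (b ℕ./ N ℕ.∸ a ℕ./ N) (begin
    b ℕ.∸ a                                              ≡⟨ cong₂ ℕ._∸_ (ℕDivMod.m≡m%n+[m/n]*n b N) (ℕDivMod.m≡m%n+[m/n]*n a N) ⟩
    (b ℕ.% N ℕ.+ b ℕ./ N ℕ.* N) ℕ.∸ (a ℕ.% N ℕ.+ a ℕ./ N ℕ.* N)  ≡⟨ cong (λ r → (b ℕ.% N ℕ.+ b ℕ./ N ℕ.* N) ℕ.∸ (r ℕ.+ a ℕ./ N ℕ.* N)) eq ⟩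
    (b ℕ.% N ℕ.+ b ℕ./ N ℕ.* N) ℕ.∸ (b ℕ.% N ℕ.+ a ℕ./ N ℕ.* N)  ≡⟨ ℕₚ.[m+n]∸[m+o]≡n∸o (b ℕ.% N) _ _ ⟩
    b ℕ./ N ℕ.* N ℕ.∸ a ℕ./ N ℕ.* N                      ≡⟨ ℕₚ.*-distribʳ-∸ N (b ℕ./ N) (a ℕ./ N) ⟨
    (b ℕ./ N ℕ.∸ a ℕ./ N) ℕ.* N                          ∎)
    where open ≡-Reasoning
  ∸1⇒mod : ∀ b .{{_ : NonZero b}} → N ℕDiv.∣ b ℕ.∸ 1 → + b ≡ + 1 [mod N ]
  ∸1⇒mod (suc b) N∣b = N∣b
  collision : ∃[ i ] ∃[ j ] i Fin.< j × (power (Fin.toℕ i)) ℕDivMod.mod N ≡ (power (Fin.toℕ j)) ℕDivMod.mod N →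
    ∃[ k ] + power (suc k) ≡ + 1 [mod N ]
  collision (i , j , i<j , eq) = k , ∸1⇒mod (power (suc k)) {{ℕₚ.m^n≢0 ℓ (18 ℕ.* suc k) {{prime⇒nonZero pℓ}}}}
    (∣prime^*-cancel pℓ ℓ∤N (18 ℕ.* m) (subst (N ℕDiv.∣_) factored (∣∸ (power m) (power n) eq%)))
    where
    m = Fin.toℕ i
    n = Fin.toℕ j
    -- The exponents differ by `suc k`, so the resulting power of `ℓ` is never the trivial one.
    k = n ℕ.∸ suc m
    eq% : power m ℕ.% N ≡ power n ℕ.% N
    eq% = trans (sym (Finₚ.toℕ-fromℕ< _)) (trans (cong Fin.toℕ eq) (Finₚ.toℕ-fromℕ< _))
    n≡ : n ≡ m ℕ.+ suc k
    n≡ = trans (sym (ℕₚ.m+[n∸m]≡n i<j)) (sym (ℕₚ.+-suc m k))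
    factored : power n ℕ.∸ power m ≡ power m ℕ.* (power (suc k) ℕ.∸ 1)
    factored = begin
      power n ℕ.∸ power m                                   ≡⟨ cong (λ e → ℓ ℕ.^ e ℕ.∸ power m) (trans (cong (18 ℕ.*_) n≡) (ℕₚ.*-distribˡ-+ 18 m (suc k))) ⟩
      ℓ ℕ.^ (18 ℕ.* m ℕ.+ 18 ℕ.* suc k) ℕ.∸ power m         ≡⟨ cong₂ ℕ._∸_ (ℕₚ.^-distribˡ-+-* ℓ (18 ℕ.* m) (18 ℕ.* suc k)) (sym (ℕₚ.*-identityʳ (power m))) ⟩
      power m ℕ.* power (suc k) ℕ.∸ power m ℕ.* 1           ≡⟨ ℕₚ.*-distribˡ-∸ (power m) (power (suc k)) 1 ⟨
      power m ℕ.* (power (suc k) ℕ.∸ 1)                     ∎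
      where open ≡-Reasoning

All≡⇒replicate : ∀ {x} {xs : List ℕ} → All (_≡ x) xs → xs ≡ List.replicate (length xs) x
All≡⇒replicate All.[]           = refl
All≡⇒replicate (refl All.∷ eqs) = cong (_ List.∷_) (All≡⇒replicate eqs)

product-replicate : ∀ n x → product (List.replicate n x) ≡ x ℕ.^ n
product-replicate zero    x = refl
product-replicate (suc n) x = cong (x ℕ.*_) (product-replicate n x)

module PrimePower {ℓ} (pℓ : Prime ℓ) (ℓ≢7 : ℓ ≢ 7) (e : ℕ) .{{_ : NonZero e}} where

  m : ℤ
  m = + (ℓ ℕ.^ e)

  instance
    m≢0 : ℤ.NonZero m
    m≢0 = ℕₚ.m^n≢0 ℓ e {{prime⇒nonZero pℓ}}

  -- Unique factorisation determines the factors only up to permutation, but a permutation of a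
  -- constant list is that list.
  primeFactors-m : primeFactors m ≡ List.replicate e ℓ
  primeFactors-m = trans (All≡⇒replicate (All-resp-↭ (↭-sym perm) (Allₚ.replicate⁺ e refl)))
    (cong (λ n → List.replicate n ℓ) (trans (↭-length perm) (Listₚ.length-replicate e)))
    where
    perm : primeFactors m ↭ List.replicate e ℓ
    perm = factorisationUnique (factorise (ℓ ℕ.^ e)) (record
      { factors = List.replicate e ℓ ; isFactorisation = sym (product-replicate e ℓ) ; factorsPrime = Allₚ.replicate⁺ e pℓ })

  primeDivisors-m : primeDivisors m ≡ ℓ List.∷ List.[]
  primeDivisors-m = trans (cong (deduplicate ℕ._≟_) primeFactors-m) (nonEmpty e)
    where
    drop : filter (¬? ∘ (ℓ ℕ.≟_)) (ℓ List.∷ List.[]) ≡ List.[]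
    drop = Listₚ.filter-reject (¬? ∘ (ℓ ℕ.≟_)) (λ ℓ≢ℓ → ℓ≢ℓ refl)
    nonEmpty : ∀ n .{{_ : NonZero n}} → deduplicate ℕ._≟_ (List.replicate n ℓ) ≡ ℓ List.∷ List.[]
    nonEmpty (suc zero)    = refl
    nonEmpty (suc (suc n)) = cong (ℓ List.∷_) (trans (cong (filter (¬? ∘ (ℓ ℕ.≟_))) (nonEmpty (suc n))) drop)

  ∈primeDivisors⇒≡ : ∀ {p} → p ∈ˡ primeDivisors m → p ≡ ℓ
  ∈primeDivisors⇒≡ p∈ with subst (_ ∈ˡ_) primeDivisors-m p∈
  ... | here eq = eq

  ℓ∈primeDivisors : ℓ ∈ˡ primeDivisors m
  ℓ∈primeDivisors = subst (ℓ ∈ˡ_) (sym primeDivisors-m) (here refl)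

  exponent-m : exponent m ℓ ≡ e
  exponent-m = begin
    length (filter (ℓ ℕ.≟_) (primeFactors m))        ≡⟨ cong (λ ps → length (filter (ℓ ℕ.≟_) ps)) primeFactors-m ⟩
    length (filter (ℓ ℕ.≟_) (List.replicate e ℓ))    ≡⟨ cong length (Listₚ.filter-all (ℓ ℕ.≟_) (Allₚ.replicate⁺ e refl)) ⟩
    length (List.replicate e ℓ)                      ≡⟨ Listₚ.length-replicate e ⟩
    e                                                ∎
    where open ≡-Reasoning

  m-coprime : ∀ {c} → c ℕDiv.∣ ℓ ℕ.^ e × c ℕDiv.∣ 7 → c ≡ 1
  m-coprime (c∣m , c∣7) = [ id , (λ { refl → contradiction (7∣power e c∣m) (ℓ≢7 ∘ sym) }) ]′ (prime⇒irreducible prime₇ c∣7)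
    where
    7∣power : ∀ n → 7 ℕDiv.∣ ℓ ℕ.^ n → 7 ≡ ℓ
    7∣power zero    7∣1 = contradiction 7∣1 (from-no (7 ℕDiv.∣? 1))
    7∣power (suc n) 7∣  = [ prime∣prime⇒≡ prime₇ pℓ , 7∣power n ]′ (euclidsLemma ℓ (ℓ ℕ.^ n) prime₇ 7∣)

length-takeWhile : ∀ {P : ℕ → Set} (P? : Decidable P) xs → length (takeWhile P? xs) ℕ.≤ length xs
length-takeWhile P? List.[]       = z≤n
length-takeWhile P? (x List.∷ xs) with P? x
... | yes _ = s≤s (length-takeWhile P? xs)
... | no  _ = z≤n

ord₇≤6 : ∀ ℓ → ord₇ ℓ ℕ.≤ 6
ord₇≤6 ℓ = s≤s (length-takeWhile (λ k → ¬? ((ℓ ℕ.^ k) ℕ.% 7 ℕ.≟ 1)) (1 List.∷ 2 List.∷ 3 List.∷ 4 List.∷ 5 List.∷ List.[]))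

module _ {N} (visible : VisiblePrime N) (k : ℕ) where

  open VisiblePrime visible

  private
    n₀ : ℕ
    n₀ = 18 ℕ.* suc k

  open PrimePower isPrime ℓ≢7 n₀

  private
    3*ord₇≤n₀ : 3 ℕ.* ord₇ ℓ ℕ.≤ n₀
    3*ord₇≤n₀ = ℕₚ.≤-trans (ℕₚ.*-monoʳ-≤ 3 (ord₇≤6 ℓ)) (ℕₚ.m≤m*n 18 (suc k))

    over : ⟨ g ⟩ LiesOver ℓ
    over = record { isPrimeIdeal = isPrimeIdeal ; ℓ∈𝔮 = ℓ∈⟨g⟩ }

    representative : ∃[ n ] n ℕ.≤ 3 × (+ n ∼ d coords ⊎ + n ∼ ℤ.- d coords) × (∃[ j ] ∣ j ∣ ℕ.≤ 3 × j ℤ.* + n ∼ + 1)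
    representative = δ-exists d≁0

  power∈L₁₀ : L₁₀ m
  power∈L₁₀ = build representative
    where
    build : ∃[ n ] n ℕ.≤ 3 × (+ n ∼ d coords ⊎ + n ∼ ℤ.- d coords) × (∃[ j ] ∣ j ∣ ℕ.≤ 3 × j ℤ.* + n ∼ + 1) → L₁₀ m
    build (n , n≤3 , n∼±d , j , ∣j∣≤3 , jn∼1) = record
      { nonZero = m≢0
      ; coprime = m-coprime
      -- Constant functions will do for `δ` and `j`, since `ℓ` is the only prime divisor of `m`.
      ; δ = λ _ → n
      ; isδ = λ p∈ → subst (λ p → Isδ p n) (sym (∈primeDivisors⇒≡ p∈))
          (n≤3 , ⟨ g ⟩ , over , g , (id , id) , coords , Sum.map ∼⇒mod ∼⇒mod n∼±d)
      ; j = λ _ → j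
      ; bound = λ {p} p∈ → subst (λ p → ∣ j ∣ ℕ.≤ exponent m p ℕ./ ord₇ p) (sym (∈primeDivisors⇒≡ p∈))
          (ℕₚ.≤-trans ∣j∣≤3 3≤quotient)
      ; sum≡±1 = inj₁ (∼⇒mod (∼-trans (≡⇒∼ (trans (cong (λ ps → sumOver ps (λ _ → j ℤ.* + n)) primeDivisors-m) (ℤₚ.+-identityʳ (j ℤ.* + n)))) jn∼1))
      }
      where
      3≤quotient : 3 ℕ.≤ exponent m ℓ ℕ./ ord₇ ℓ
      3≤quotient = subst₂ ℕ._≤_ (ℕDivMod.m*n/n≡m 3 (ord₇ ℓ)) (cong (ℕ._/ ord₇ ℓ) (sym exponent-m)) (ℕDivMod./-monoˡ-≤ (ord₇ ℓ) 3*ord₇≤n₀)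

  power∈L₁₁ : L₁₁ m
  power∈L₁₁ = record
    { nonZero = m≢0
    ; coprime = m-coprime
    ; ℓ = ℓ
    ; divisor = ℓ∈primeDivisors
    ; usable = subst (ord₇ ℓ ℕ.≤_) (sym exponent-m) (ℕₚ.≤-trans (ℕₚ.m≤n*m (ord₇ ℓ) 3) 3*ord₇≤n₀)
    ; notInvisible = λ invisible → d≁0 (mod⇒∼ (proj₁ (invisible ⟨ g ⟩ over g (id , id) coords)))
    }

-- There are no prime divisors, so the sum is the empty one and either congruence reduces to 7
-- dividing 1.
1∉L₁₀ : ¬ L₁₀ (+ 1)
1∉L₁₀ record { sum≡±1 = inj₁ 7∣1 } = contradiction 7∣1 (from-no (7 ℕDiv.∣? 1))
1∉L₁₀ record { sum≡±1 = inj₂ 7∣1 } = contradiction 7∣1 (from-no (7 ℕDiv.∣? 1))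

1∉L₁₁ : ¬ L₁₁ (+ 1)
1∉L₁₁ record { divisor = () }

union-of-classes-closed : ∀ {a N} {L : Pred ℤ a} → IsUnionOfClasses N L → ∀ {x y} → x ≡ y [mod N ] → x ∈ L → y ∈ L
union-of-classes-closed {N = N} (S , L⇔) {x} {y} x≡y x∈L =
  let r , r∈S , x≡r = Equivalence.to (L⇔ x) x∈L
  in Equivalence.from (L⇔ y) (r , r∈S , Signed.∣⇒∣ᵤ (subst (+ N Signed.∣_) (difference r)
       (Signed.∣m∣n⇒∣m-n (Signed.∣ᵤ⇒∣ {+ N} {x ℤ.- r} x≡r) (Signed.∣ᵤ⇒∣ {+ N} {x ℤ.- y} x≡y))))
  where
  difference : ∀ r → (x ℤ.- r) ℤ.- (x ℤ.- y) ≡ y ℤ.- r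
  difference r = ℤ-solve 3 (λ x y r → (x :- r) :- (x :- y) :≡ y :- r) refl x y r

corollary1p3 : ∀ (N : ℕ) → .{{_ : NonZero N}} →
    ¬ IsUnionOfClasses N L₁₀ × ¬ IsUnionOfClasses N L₁₁
corollary1p3 N {{N≢0}} = not-union power∈L₁₀ 1∉L₁₀ , not-union power∈L₁₁ 1∉L₁₁
  where
  not-union : ∀ {a} {L : Pred ℤ a} →
    ((visible : VisiblePrime N) → ∀ k → + (VisiblePrime.ℓ visible ℕ.^ (18 ℕ.* suc k)) ∈ L) →
    ¬ + 1 ∈ L → ¬ IsUnionOfClasses N L
  -- The goal is absurdity, so the doubly negated prime may be used as if it were given.
  not-union power∈L 1∉L union = ¬¬visible-prime N (ℕ.≢-nonZero⁻¹ N) λ visible →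
    let open VisiblePrime visible
        k , ℓ^e≡1 = prime^18k≡1 {N} isPrime ℓ∤N
    in 1∉L (union-of-classes-closed union ℓ^e≡1 (power∈L visible k))
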